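{- Fix an integer $n>1$ and let $K$ be a number field of degree $n$. Let $$a(n) = \max_{0 \leq d \leq n-1} \left(\frac{d(n-1-d)}{n-1+d} + \frac{1}{n-1+d}\right),$$ where the maximum is over all integers $d$ with $0\le d\le n-1$. Then $$B^{\frac{1}{2}a(n)} \ll N_K(B) \quad \text{as } B\to\infty,$$ i.e. there are constants $c>0$ and $B_0$ (depending on $K$) such that $N_K(B)\ge c\,B^{a(n)/2}$ for all $B\ge B_0$.
   Context: Let $\mathcal{O}_K$ be the ring of integers of $K$. An order in $\mathcal{O}_K$ is a finite index subring of $\mathcal{O}_K$ containing the multiplicative identity. For a positive integer $k$, $F_K(k)=\#\{\mathcal{O}\subset\mathcal{O}_K : \mathcal{O} \text{ is an order of } \mathcal{O}_K \text{ and } |\operatorname{disc}(\mathcal{O})|=k\}$, where $\operatorname{disc}(\mathcal{O})=\operatorname{disc}(\mathcal{O}_K)[\mathcal{O}_K:\mathcal{O}]^2$. Finally $N_K(B)=\sum_{k\le B}F_K(k)$ is the number of orders in $\mathcal{O}_K$ whose discriminant has absolute value at most $B$. -}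

module Defs where

open import Level using (0ℓ; _⊔_) renaming (suc to lsuc)
open import Algebra.Bundles using (CommutativeRing)
open import Algebra.Definitions using (Invertible)
open import Algebra.Morphism.Structures using (IsRingHomomorphism)
import Algebra.Properties.Group as GroupProperties
import Algebra.Properties.Semiring.Exp as Exp
import Algebra.Properties.Semiring.Sum as Sum
open import Data.Fin.Base as Fin using (Fin; zero; suc; toℕ)
import Data.Fin.Properties as Fin
open import Data.Integer.Base as ℤ using (ℤ; ∣_∣; +_)
import Data.List.Base as List
import Data.Nat.ListAction as ListAction
open import Data.Nat.Base as ℕ using (ℕ; zero; suc; NonZero; NonTrivial)
open import Data.Product.Base using (Σ; ∃; _×_; _,_; proj₁; proj₂)
open import Data.Rational.Base as ℚ using (ℚ; 0ℚ; 1ℚ)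
import Data.Rational.Properties as ℚ
import Data.Vec.Base as Vec
open import Data.Vec.Functional using (Vector; removeAt)
open import Function.Base using (_∘_)
open import Function.Bundles using (Inverse)
open import Relation.Binary.Bundles using (Setoid)
import Relation.Binary.Reasoning.Setoid as SetoidReasoning
open import Relation.Binary.PropositionalEquality.Core using (_≡_)
open import Relation.Nullary.Negation.Core using (¬_)
open import Relation.Unary using (Pred; _∈_; _⊆_; _≐_)
open import Relation.Unary.Properties using (≐-refl; ≐-sym; ≐-trans)

HasCardinality : ∀ {a ℓ} → Setoid a ℓ → ℕ → Set (a ⊔ ℓ)
HasCardinality S m = Inverse (Fin.≡-setoid m) S

open Sum (CommutativeRing.semiring ℚ.+-*-commutativeRing)
  using () renaming (sum to sumℚ)
open Exp (CommutativeRing.semiring ℚ.+-*-commutativeRing)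
  using () renaming (_^_ to _^ℚ_)

fromℤ : ℤ → ℚ
fromℤ z = z ℚ./ 1

fromℕ : ℕ → ℚ
fromℕ m = fromℤ (+ m)

Matrix : ℕ → Set
Matrix n = Fin n → Fin n → ℚ

-- Laplace expansion along the first row.
det : ∀ {n} → Matrix n → ℚ
det {zero}  A = 1ℚ
det {suc n} A = sumℚ λ j →
  (ℚ.- 1ℚ) ^ℚ toℕ j ℚ.* A zero j ℚ.* det (λ i → removeAt (A (suc i)) j)

-- A ℚ-basis witnessing [K : ℚ] = n is part of the data; Tr does not depend on it.
record NumberField (n : ℕ) : Set₁ where
  field
    commutativeRing : CommutativeRing 0ℓ 0ℓ

  open CommutativeRing commutativeRing public
  open Sum semiring public using (sum)
  open Exp semiring public using (_^_)

  field
    0≉1        : ¬ 0# ≈ 1#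
    invertible : ∀ x → ¬ x ≈ 0# → Invertible _≈_ 1# _*_ x

    ι              : ℚ → Carrier
    ι-homomorphism : IsRingHomomorphism
      (CommutativeRing.rawRing ℚ.+-*-commutativeRing) rawRing ι

    basis       : Vector Carrier n
    coordinates : Carrier → Vector ℚ n
    spanning    : ∀ x → x ≈ sum (λ i → ι (coordinates x i) * basis i)
    independent : ∀ (q : Vector ℚ n) →
                  sum (λ i → ι (q i) * basis i) ≈ 0# → ∀ i → q i ≡ 0ℚ

module _ {n : ℕ} (K : NumberField n) where
  open NumberField K

  -- Trace of the ℚ-linear map y ↦ x * y.
  Tr : Carrier → ℚ
  Tr x = sumℚ λ i → coordinates (x * basis i) i

  -- x ^ m + c (m - 1) * x ^ (m - 1) + … + c 0 = 0 for some c with entries in ℤ.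
  𝓞 : Pred Carrier 0ℓ
  𝓞 x = ∃ λ m → Σ (Vector ℤ m) λ c →
    x ^ m + sum (λ i → ι (fromℤ (c i)) * x ^ toℕ i) ≈ 0#

  record IsIntegralBasis (ω : Vector Carrier n) : Set where
    field
      integral    : ∀ i → ω i ∈ 𝓞
      spanning    : ∀ {x} → x ∈ 𝓞 → Σ (Vector ℤ n) λ z →
                    x ≈ sum (λ i → ι (fromℤ (z i)) * ω i)
      independent : ∀ (z : Vector ℤ n) →
                    sum (λ i → ι (fromℤ (z i)) * ω i) ≈ 0# → ∀ i → z i ≡ ℤ.0ℤ

  IsFieldDiscriminant : ℤ → Set
  IsFieldDiscriminant D = ∃ λ ω →
    IsIntegralBasis ω × det (λ i j → Tr (ω i * ω j)) ≡ fromℤ D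

  record IsSubring (O : Pred Carrier 0ℓ) : Set where
    field
      resp       : ∀ {x y} → x ≈ y → x ∈ O → y ∈ O
      1-closed   : 1# ∈ O
      +-closed   : ∀ {x y} → x ∈ O → y ∈ O → x + y ∈ O
      neg-closed : ∀ {x} → x ∈ O → - x ∈ O
      *-closed   : ∀ {x y} → x ∈ O → y ∈ O → x * y ∈ O

  -- The additive quotient 𝓞 / O, whose cardinality is the index [𝓞 : O].
  quotient : ∀ {O} → IsSubring O → Setoid 0ℓ 0ℓ
  quotient {O} isSubring = record
    { Carrier       = ∃ 𝓞
    ; _≈_           = λ x y → proj₁ x - proj₁ y ∈ O
    ; isEquivalence = record
      { refl  = λ {x} → resp (trans (-‿inverseʳ 1#) (sym (-‿inverseʳ (proj₁ x))))
                             (+-closed 1-closed (neg-closed 1-closed))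
      ; sym   = λ {x} {y} x~y → resp (⁻¹-anti-homo-// (proj₁ x) (proj₁ y)) (neg-closed x~y)
      ; trans = λ {x} {y} {z} x~y y~z →
                resp (diff-trans (proj₁ x) (proj₁ y) (proj₁ z)) (+-closed x~y y~z)
      }
    }
    where
    open IsSubring isSubring
    open GroupProperties +-group using (⁻¹-anti-homo-//)
    open SetoidReasoning setoid

    diff-trans : ∀ x y z → (x - y) + (y - z) ≈ x - z
    diff-trans x y z = begin
      (x - y) + (y - z)     ≈⟨ +-assoc x (- y) (y - z) ⟩
      x + (- y + (y - z))   ≈⟨ +-congˡ (+-assoc (- y) y (- z)) ⟨
      x + ((- y + y) - z)   ≈⟨ +-congˡ (+-congʳ (-‿inverseˡ y)) ⟩
      x + (0# - z)          ≈⟨ +-congˡ (+-identityˡ (- z)) ⟩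
      x - z                 ∎

  record Order : Set₁ where
    field
      member        : Pred Carrier 0ℓ
      isSubring     : IsSubring member
      integral      : member ⊆ 𝓞
      index         : ℕ
      index-correct : HasCardinality (quotient isSubring) index

  IsDiscriminant : Order → ℤ → Set
  IsDiscriminant O d = ∃ λ D →
    IsFieldDiscriminant D × d ≡ D ℤ.* (+ Order.index O) ℤ.^ 2

  -- Two orders are identified when they have the same elements.
  ordersOfDiscriminant : ℕ → Setoid (lsuc 0ℓ) 0ℓ
  ordersOfDiscriminant k = record
    { Carrier       = Σ Order λ O → ∃ λ d → IsDiscriminant O d × ∣ d ∣ ≡ k
    ; _≈_           = λ O O′ → Order.member (proj₁ O) ≐ Order.member (proj₁ O′)
    ; isEquivalence = record { refl = ≐-refl ; sym = ≐-sym ; trans = ≐-trans }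
    }

  -- This determines F at every positive integer; F 0 is left unspecified.
  IsOrderCount : (ℕ → ℕ) → Set₁
  IsOrderCount F = ∀ k → .{{NonZero k}} → HasCardinality (ordersOfDiscriminant k) (F k)

-- ∑ F k over 1 ≤ k ≤ B (a discriminant is never 0)
cumulative : (ℕ → ℕ) → ℕ → ℕ
cumulative F B = ListAction.sum (List.applyUpTo (F ∘ suc) B)

exponentTerm : (n d : ℕ) → .{{NonZero (n ℕ.∸ 1 ℕ.+ d)}} → ℚ
exponentTerm n d =
  + (d ℕ.* (n ℕ.∸ 1 ℕ.∸ d)) ℚ./ (n ℕ.∸ 1 ℕ.+ d) ℚ.+ + 1 ℚ./ (n ℕ.∸ 1 ℕ.+ d)

a : (n : ℕ) → .{{NonTrivial n}} → ℚ
a n@(suc (suc _)) = Vec.foldr₁ ℚ._⊔_ (Vec.tabulate {n = n} λ d → exponentTerm n (toℕ d))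

-- c · x ^ e ≤ y for c, x, y, e ≥ 0.  With e = p / q in lowest terms this is
-- c ^ q · x ^ p ≤ y ^ q, since t ↦ t ^ q is increasing on nonnegative reals.
_·_^_≤_ : ℚ → ℚ → ℚ → ℚ → Set
c · x ^ e ≤ y =
  (c ^ℚ ℚ.↧ₙ e) ℚ.* (x ^ℚ ∣ ℚ.↥ e ∣) ℚ.≤ y ^ℚ ℚ.↧ₙ e

{-# OPTIONS --safe #-}

-- Let 1, h₁, …, hₑ, k₁, …, k_d be an integral basis, e + d = n - 1.  For m ≥ 1 and a d × e matrix c
-- modulo m, the lattice spanned by 1, m (hᵢ + ∑ⱼ cⱼᵢ kⱼ) and m² kⱼ lies between m²𝓞 and ℤ + m𝓞, hence
-- is an order; its index is m ^ (e + 2 d) and it determines c.  So N(B) is at least ∑ m ^ (d e) over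
-- |D| m ^ (2 (e + 2 d)) ≤ B, which is ≫ B ^ ((d e + 1) / (2 (e + 2 d))); using all m instead of only
-- primes avoids a loss of log B.
--
-- Constructively the integral basis is not available: deciding integrality is avoided by noting that
-- for a fixed B the inequality is decidable, so that a basis is only needed up to double negation,
-- provided that the constants depend on an explicit bound for |D|.  The ring of integers lies between
-- two explicit lattices of finite index, hence is one of finitely many explicit candidates; the bound is
-- the largest discriminant among them.

module Submission where

open import Defs
open import Algebra.Bundles using (CommutativeRing)
open import Algebra.Morphism.Structures using (IsRingHomomorphism)
import Algebra.Properties.Ring as RingProperties
import Algebra.Properties.Semiring.Exp as Exp
import Algebra.Properties.Semiring.Sum as Sum
import Algebra.Solver.Ring as RingSolver
import Algebra.Solver.Ring.AlmostCommutativeRing as ACR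
open import Data.Bool.Base using (Bool; true; false; if_then_else_)
open import Data.Fin.Base as Fin using (Fin; zero; suc; toℕ; inject₁; punchIn; punchOut)
import Data.Fin.Induction as Fin
import Data.Fin.Properties as Fin
open import Data.Integer.Base as ℤ using (ℤ; +_; -[1+_]; ∣_∣)
import Data.Integer.Divisibility.Signed as ℤ
import Data.Integer.DivMod as ℤ
import Data.Integer.Properties as ℤ
import Data.Integer.Solver as ℤSolver
import Data.List.Base as List
import Data.List.Properties as List
open import Data.Maybe.Base using (Maybe; just; nothing)
open import Data.Nat.Base as ℕ using (ℕ; zero; suc; NonTrivial; _≥_)
import Data.Nat.Divisibility as ℕ
import Data.Nat.DivMod as ℕ
import Data.Nat.GCD as ℕ
import Data.Nat.ListAction as ListAction
import Data.Nat.ListAction.Properties as ListAction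
import Data.Nat.Properties as ℕ
import Data.Nat.Solver as ℕSolver
open import Data.Product.Base using (Σ; ∃; ∃₂; _×_; _,_; proj₁; proj₂)
open import Data.Rational.Base as ℚ using (ℚ; 0ℚ; 1ℚ; ½)
import Data.Rational.Properties as ℚ
import Data.Rational.Solver as ℚSolver
import Data.Rational.Unnormalised.Base as ℚᵘ
import Data.Rational.Unnormalised.Properties as ℚᵘ
open import Data.Sum.Base using (inj₁; inj₂; [_,_]′)
open import Data.Vec.Base as Vec using (Vec)
open import Data.Vec.Functional using (Vector; removeAt; []; _∷_; _++_)
import Data.Vec.Properties as Vec
open import Function.Base using (_∘_; id)
open import Function.Bundles using (Inverse)
open import Relation.Binary.Construct.Closure.ReflexiveTransitive using (Star; ε; _◅_; _◅◅_)
open import Relation.Binary.PropositionalEquality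
  using (_≡_; _≢_; refl; sym; trans; cong; cong₂; subst; subst₂; module ≡-Reasoning)
import Relation.Binary.Reasoning.Setoid as SetoidReasoning
open import Relation.Nullary.Decidable using (Dec; yes; no; decidable-stable)
open import Relation.Nullary.Negation using (¬_; contradiction)
open import Relation.Unary using (_∈_)

-- What must be made explicit is the bound for |D|, and this shapes the algebra. The lower lattice
-- is spanned by `M` times the given ℚ-basis, with `M` clearing the structure constants so that the
-- lattice is closed under multiplication. The upper one comes from the dual basis of the trace
-- form, because an integral element has integer trace against the lower lattice. Each selection
-- among the finitely many classes between them yields an independent family starting with 1 and a
-- discriminant, even if the selection does not generate a ring; wrong selections only enlarge the
-- bound. Integrality is treated throughout as stability of a finitely generated subgroup containing
-- 1. This gives the ring structure without resultants, integer traces without conjugates, and 𝓞 ∩ ℚ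
-- = ℤ without unique factorisation. Bases of such subgroups exist because a linear functional takes
-- a cyclic group of values on them.

module Sumℚ = Sum (CommutativeRing.semiring ℚ.+-*-commutativeRing)
module Expℚ = Exp (CommutativeRing.semiring ℚ.+-*-commutativeRing)
open Sumℚ using () renaming (sum to sumℚ)
open Expℚ using () renaming (_^_ to _^ℚ_)

-- Integers inside the rationals, common denominators

toℚᵘ-fromℤ : ∀ z → ℚ.toℚᵘ (fromℤ z) ℚᵘ.≃ ℚᵘ.mkℚᵘ z 0
toℚᵘ-fromℤ z = ℚ.toℚᵘ-fromℚᵘ (ℚᵘ.mkℚᵘ z 0)

fromℤ-injective : ∀ {y z} → fromℤ y ≡ fromℤ z → y ≡ z
fromℤ-injective {y} {z} eq with ℚᵘ.≃-trans (ℚᵘ.≃-sym (toℚᵘ-fromℤ y))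
                            (ℚᵘ.≃-trans (ℚ.toℚᵘ-cong eq) (toℚᵘ-fromℤ z))
... | ℚᵘ.*≡* y≡z = trans (sym (ℤ.*-identityʳ y)) (trans y≡z (ℤ.*-identityʳ z))

fromℤ-homo-+ : ∀ y z → fromℤ (y ℤ.+ z) ≡ fromℤ y ℚ.+ fromℤ z
fromℤ-homo-+ y z = ℚ.toℚᵘ-injective (begin
  ℚ.toℚᵘ (fromℤ (y ℤ.+ z))                     ≈⟨ toℚᵘ-fromℤ (y ℤ.+ z) ⟩
  ℚᵘ.mkℚᵘ (y ℤ.+ z) 0                           ≈⟨ ℚᵘ.*≡* (cong (ℤ._* ℤ.1ℤ) (cong₂ ℤ._+_ (sym (ℤ.*-identityʳ y)) (sym (ℤ.*-identityʳ z)))) ⟩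
  ℚᵘ.mkℚᵘ y 0 ℚᵘ.+ ℚᵘ.mkℚᵘ z 0                  ≈⟨ ℚᵘ.+-cong (toℚᵘ-fromℤ y) (toℚᵘ-fromℤ z) ⟨
  ℚ.toℚᵘ (fromℤ y) ℚᵘ.+ ℚ.toℚᵘ (fromℤ z)        ≈⟨ ℚ.toℚᵘ-homo-+ (fromℤ y) (fromℤ z) ⟨
  ℚ.toℚᵘ (fromℤ y ℚ.+ fromℤ z)                  ∎)
  where open ℚᵘ.≃-Reasoning

fromℤ-homo-* : ∀ y z → fromℤ (y ℤ.* z) ≡ fromℤ y ℚ.* fromℤ z
fromℤ-homo-* y z = ℚ.toℚᵘ-injective (begin
  ℚ.toℚᵘ (fromℤ (y ℤ.* z))                     ≈⟨ toℚᵘ-fromℤ (y ℤ.* z) ⟩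
  ℚᵘ.mkℚᵘ y 0 ℚᵘ.* ℚᵘ.mkℚᵘ z 0                  ≈⟨ ℚᵘ.*-cong (toℚᵘ-fromℤ y) (toℚᵘ-fromℤ z) ⟨
  ℚ.toℚᵘ (fromℤ y) ℚᵘ.* ℚ.toℚᵘ (fromℤ z)        ≈⟨ ℚ.toℚᵘ-homo-* (fromℤ y) (fromℤ z) ⟨
  ℚ.toℚᵘ (fromℤ y ℚ.* fromℤ z)                  ∎)
  where open ℚᵘ.≃-Reasoning

fromℤ-homo‿- : ∀ z → fromℤ (ℤ.- z) ≡ ℚ.- fromℤ z
fromℤ-homo‿- z = begin
  fromℤ (ℤ.- z)                                    ≡⟨ solve 2 (λ x y → y := (:- x) :+ (x :+ y)) refl (fromℤ z) (fromℤ (ℤ.- z)) ⟩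
  ℚ.- fromℤ z ℚ.+ (fromℤ z ℚ.+ fromℤ (ℤ.- z))      ≡⟨ cong (ℚ.- fromℤ z ℚ.+_) (fromℤ-homo-+ z (ℤ.- z)) ⟨
  ℚ.- fromℤ z ℚ.+ fromℤ (z ℤ.+ ℤ.- z)              ≡⟨ cong (λ w → ℚ.- fromℤ z ℚ.+ fromℤ w) (ℤ.+-inverseʳ z) ⟩
  ℚ.- fromℤ z ℚ.+ 0ℚ                               ≡⟨ ℚ.+-identityʳ _ ⟩
  ℚ.- fromℤ z                                      ∎
  where
  open ≡-Reasoning
  open ℚSolver.+-*-Solver

fromℤ-≢0 : ∀ {z} → z ≢ ℤ.0ℤ → fromℤ z ≢ 0ℚ
fromℤ-≢0 z≢0 eq = z≢0 (fromℤ-injective eq)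

inv : (q : ℚ) → q ≢ 0ℚ → ℚ
inv q q≢0 = ℚ.1/_ q {{ℚ.≢-nonZero q≢0}}

*-inv : ∀ q (q≢0 : q ≢ 0ℚ) → q ℚ.* inv q q≢0 ≡ 1ℚ
*-inv q q≢0 = ℚ.*-inverseʳ q {{ℚ.≢-nonZero q≢0}}

*-cancel-0 : ∀ {p q} → p ≢ 0ℚ → p ℚ.* q ≡ 0ℚ → q ≡ 0ℚ
*-cancel-0 {p} {q} p≢0 pq≡0 = begin
  q                            ≡⟨ ℚ.*-identityˡ q ⟨
  1ℚ ℚ.* q                     ≡⟨ cong (ℚ._* q) (*-inv p p≢0) ⟨
  p ℚ.* inv p p≢0 ℚ.* q        ≡⟨ solve 3 (λ x y z → x :* y :* z := y :* (x :* z)) refl p (inv p p≢0) q ⟩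
  inv p p≢0 ℚ.* (p ℚ.* q)      ≡⟨ cong (inv p p≢0 ℚ.*_) pq≡0 ⟩
  inv p p≢0 ℚ.* 0ℚ             ≡⟨ ℚ.*-zeroʳ (inv p p≢0) ⟩
  0ℚ                           ∎
  where
  open ≡-Reasoning
  open ℚSolver.+-*-Solver

*-≢0 : ∀ {p q} → p ≢ 0ℚ → q ≢ 0ℚ → p ℚ.* q ≢ 0ℚ
*-≢0 p≢0 q≢0 = q≢0 ∘ *-cancel-0 p≢0

*-denominator : ∀ q → q ℚ.* fromℤ (ℚ.↧ q) ≡ fromℤ (ℚ.↥ q)
*-denominator q@record{} = ℚ.toℚᵘ-injective (begin
  ℚ.toℚᵘ (q ℚ.* fromℤ (ℚ.↧ q))                  ≈⟨ ℚ.toℚᵘ-homo-* q (fromℤ (ℚ.↧ q)) ⟩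
  ℚ.toℚᵘ q ℚᵘ.* ℚ.toℚᵘ (fromℤ (ℚ.↧ q))           ≈⟨ ℚᵘ.*-congˡ {ℚ.toℚᵘ q} (toℚᵘ-fromℤ (ℚ.↧ q)) ⟩
  ℚ.toℚᵘ q ℚᵘ.* ℚᵘ.mkℚᵘ (ℚ.↧ q) 0              ≈⟨ ℚᵘ.*≡* (trans (ℤ.*-identityʳ _) (cong (ℚ.↥ q ℤ.*_) (cong (+_) (sym (ℕ.*-identityʳ _))))) ⟩
  ℚᵘ.mkℚᵘ (ℚ.↥ q) 0                               ≈⟨ toℚᵘ-fromℤ (ℚ.↥ q) ⟨
  ℚ.toℚᵘ (fromℤ (ℚ.↥ q))                          ∎)
  where open ℚᵘ.≃-Reasoning

IsInteger : ℚ → Set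
IsInteger q = ∃ λ z → q ≡ fromℤ z

integer-+ : ∀ {p q} → IsInteger p → IsInteger q → IsInteger (p ℚ.+ q)
integer-+ (y , refl) (z , refl) = y ℤ.+ z , sym (fromℤ-homo-+ y z)

integer-* : ∀ {p q} → IsInteger p → IsInteger q → IsInteger (p ℚ.* q)
integer-* (y , refl) (z , refl) = y ℤ.* z , sym (fromℤ-homo-* y z)

integer-sum : ∀ {n} (q : Vector ℚ n) → (∀ i → IsInteger (q i)) → IsInteger (sumℚ q)
integer-sum {zero}  q int = ℤ.0ℤ , refl
integer-sum {suc n} q int = integer-+ (int zero) (integer-sum (q ∘ suc) (int ∘ suc))

commonDenominator : ∀ {n} (q : Vector ℚ n) → ∃ λ M → M ≢ ℤ.0ℤ × ∀ i → IsInteger (fromℤ M ℚ.* q i)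
commonDenominator {zero}  q = ℤ.1ℤ , (λ ()) , λ ()
commonDenominator {suc n} q =
  let M , M≢0 , M-clears = commonDenominator (q ∘ suc)
  in M ℤ.* ℚ.↧ q zero , product≢0 M≢0 , λ
     { zero    → subst IsInteger (swapʳ M (ℚ.↧ q zero) (q zero))
                   (integer-* (M , refl) (ℚ.↥ q zero , *-denominator (q zero)))
     ; (suc i) → subst IsInteger (swapˡ M (ℚ.↧ q zero) (q (suc i)))
                   (integer-* (ℚ.↧ q zero , refl) (M-clears i)) }
  where
  open ≡-Reasoning
  open ℚSolver.+-*-Solver

  product≢0 : ∀ {M} → M ≢ ℤ.0ℤ → M ℤ.* ℚ.↧ q zero ≢ ℤ.0ℤ
  product≢0 {M} M≢0 eq with ℤ.i*j≡0⇒i≡0∨j≡0 M eq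
  ... | inj₁ M≡0 = M≢0 M≡0
  ... | inj₂ ()

  swapʳ : ∀ M d r → fromℤ M ℚ.* (r ℚ.* fromℤ d) ≡ fromℤ (M ℤ.* d) ℚ.* r
  swapʳ M d r = trans
    (solve 3 (λ x y z → x :* (y :* z) := x :* z :* y) refl (fromℤ M) r (fromℤ d))
    (cong (ℚ._* r) (sym (fromℤ-homo-* M d)))

  swapˡ : ∀ M d r → fromℤ d ℚ.* (fromℤ M ℚ.* r) ≡ fromℤ (M ℤ.* d) ℚ.* r
  swapˡ M d r = trans
    (solve 3 (λ x y z → x :* (y :* z) := y :* x :* z) refl (fromℤ d) (fromℤ M) r)
    (cong (ℚ._* r) (sym (fromℤ-homo-* M d)))

-- Finitely generated subgroups of ℤ and ℚ are cyclic.

bézout-ℤ : ∀ y z → ∃ λ g → (∃₂ λ u v → g ≡ u ℤ.* y ℤ.+ v ℤ.* z) × (∃ λ k → y ≡ k ℤ.* g) × (∃ λ l → z ≡ l ℤ.* g)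
bézout-ℤ y z with ℕ.Bézout.lemma ∣ y ∣ ∣ z ∣
... | ℕ.Bézout.result d d-gcd identity = + d , combination identity , multiple y (ℕ.GCD.gcd∣m d-gcd) , multiple z (ℕ.GCD.gcd∣n d-gcd)
  where
  -- The Bézout identity is about absolute values. The unit `s` converts in both directions between
  -- an integer and its absolute value.
  sign : ∀ w → ∃ λ s → + ∣ w ∣ ≡ s ℤ.* w × w ≡ s ℤ.* + ∣ w ∣
  sign (+ w)      = ℤ.1ℤ , sym (ℤ.*-identityˡ _) , sym (ℤ.*-identityˡ _)
  sign (-[1+ w ]) = ℤ.-1ℤ , sym (ℤ.-1*i≡-i -[1+ w ]) , sym (ℤ.-1*i≡-i (+ suc w))

  multiple : ∀ w → d ℕ.∣ ∣ w ∣ → ∃ λ k → w ≡ k ℤ.* + d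
  multiple w (ℕ.divides k eq) with sign w
  ... | s , _ , w≡ = s ℤ.* + k , trans w≡ (trans (cong (λ v → s ℤ.* + v) eq) (trans (cong (s ℤ.*_) (ℤ.pos-* k d)) (sym (ℤ.*-assoc s (+ k) (+ d)))))

  open ≡-Reasoning
  open ℤSolver.+-*-Solver

  combine : ∀ a b c e m n → d ℕ.+ b ℕ.* n ≡ a ℕ.* m → + m ≡ c → + n ≡ e →
            + d ≡ + a ℤ.* c ℤ.+ ℤ.- (+ b) ℤ.* e
  combine a b c e m n eq refl refl = begin
    + d                                                ≡⟨ solve 2 (λ x y → x := x :+ y :+ :- y) refl (+ d) (+ (b ℕ.* n)) ⟩
    + (d ℕ.+ b ℕ.* n) ℤ.+ ℤ.- (+ (b ℕ.* n))            ≡⟨ cong₂ (λ x y → + x ℤ.+ ℤ.- y) eq (ℤ.pos-* b n) ⟩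
    + (a ℕ.* m) ℤ.+ ℤ.- (+ b ℤ.* + n)                  ≡⟨ cong₂ ℤ._+_ (ℤ.pos-* a m) (ℤ.neg-distribˡ-* (+ b) (+ n)) ⟩
    + a ℤ.* + m ℤ.+ ℤ.- (+ b) ℤ.* + n                  ∎

  combination : ℕ.Bézout.Identity d ∣ y ∣ ∣ z ∣ → ∃₂ λ u v → + d ≡ u ℤ.* y ℤ.+ v ℤ.* z
  combination (ℕ.Bézout.+- a b eq) with sign y | sign z
  ... | s , ∣y∣≡ , _ | t , ∣z∣≡ , _ = + a ℤ.* s , ℤ.- (+ b) ℤ.* t , trans (combine a b _ _ _ _ eq ∣y∣≡ ∣z∣≡)
    (sym (cong₂ ℤ._+_ (ℤ.*-assoc (+ a) s y) (ℤ.*-assoc (ℤ.- (+ b)) t z)))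
  combination (ℕ.Bézout.-+ a b eq) with sign y | sign z
  ... | s , ∣y∣≡ , _ | t , ∣z∣≡ , _ = ℤ.- (+ a) ℤ.* s , + b ℤ.* t , trans (combine b a _ _ _ _ eq ∣z∣≡ ∣y∣≡)
    (trans (ℤ.+-comm (+ b ℤ.* (t ℤ.* z)) _) (sym (cong₂ ℤ._+_ (ℤ.*-assoc (ℤ.- (+ a)) s y) (ℤ.*-assoc (+ b) t z))))

-- Multiplying by a common denominator moves the pair into ℤ; the generator found there, divided by
-- that denominator, is `t`.
bézout-ℚ : ∀ p q → ∃ λ t → (∃₂ λ u v → t ≡ fromℤ u ℚ.* p ℚ.+ fromℤ v ℚ.* q)
                         × (∃ λ k → p ≡ fromℤ k ℚ.* t) × (∃ λ l → q ≡ fromℤ l ℚ.* t)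
bézout-ℚ p q =
  let M , M≢0 , M-clears = commonDenominator (p ∷ (q ∷ []))
      y , Mp≡y = M-clears zero
      z , Mq≡z = M-clears (suc zero)
      g , (u , v , g≡) , (k , y≡) , (l , z≡) = bézout-ℤ y z
      m≢0 = fromℤ-≢0 M≢0
  in inv (fromℤ M) m≢0 ℚ.* fromℤ g ,
     (u , v , t≡ (fromℤ M) m≢0 g u v y z Mp≡y Mq≡z g≡) ,
     (k , multiple (fromℤ M) m≢0 g p y k Mp≡y y≡) ,
     (l , multiple (fromℤ M) m≢0 g q z l Mq≡z z≡)
  where
  open ≡-Reasoning
  open ℚSolver.+-*-Solver

  module _ (m : ℚ) (m≢0 : m ≢ 0ℚ) (g : ℤ) where
    m⁻¹ = inv m m≢0

    divide : ∀ r w → m ℚ.* r ≡ fromℤ w → r ≡ m⁻¹ ℚ.* fromℤ w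
    divide r w mr≡w = begin
      r                        ≡⟨ ℚ.*-identityˡ r ⟨
      1ℚ ℚ.* r                 ≡⟨ cong (ℚ._* r) (*-inv m m≢0) ⟨
      m ℚ.* m⁻¹ ℚ.* r          ≡⟨ solve 3 (λ a b c → a :* b :* c := b :* (a :* c)) refl m m⁻¹ r ⟩
      m⁻¹ ℚ.* (m ℚ.* r)        ≡⟨ cong (m⁻¹ ℚ.*_) mr≡w ⟩
      m⁻¹ ℚ.* fromℤ w          ∎

    multiple : ∀ r w k → m ℚ.* r ≡ fromℤ w → w ≡ k ℤ.* g → r ≡ fromℤ k ℚ.* (m⁻¹ ℚ.* fromℤ g)
    multiple r w k mr≡w w≡ = begin
      r                                  ≡⟨ divide r w mr≡w ⟩
      m⁻¹ ℚ.* fromℤ w                    ≡⟨ cong (λ s → m⁻¹ ℚ.* fromℤ s) w≡ ⟩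
      m⁻¹ ℚ.* fromℤ (k ℤ.* g)            ≡⟨ cong (m⁻¹ ℚ.*_) (fromℤ-homo-* k g) ⟩
      m⁻¹ ℚ.* (fromℤ k ℚ.* fromℤ g)      ≡⟨ solve 3 (λ a b c → a :* (b :* c) := b :* (a :* c)) refl m⁻¹ (fromℤ k) (fromℤ g) ⟩
      fromℤ k ℚ.* (m⁻¹ ℚ.* fromℤ g)      ∎

    t≡ : ∀ u v y z → m ℚ.* p ≡ fromℤ y → m ℚ.* q ≡ fromℤ z → g ≡ u ℤ.* y ℤ.+ v ℤ.* z →
         m⁻¹ ℚ.* fromℤ g ≡ fromℤ u ℚ.* p ℚ.+ fromℤ v ℚ.* q
    t≡ u v y z mp≡y mq≡z g≡ = begin
      m⁻¹ ℚ.* fromℤ g                                              ≡⟨ cong (λ s → m⁻¹ ℚ.* fromℤ s) g≡ ⟩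
      m⁻¹ ℚ.* fromℤ (u ℤ.* y ℤ.+ v ℤ.* z)                          ≡⟨ cong (m⁻¹ ℚ.*_) (fromℤ-homo-+ (u ℤ.* y) (v ℤ.* z)) ⟩
      m⁻¹ ℚ.* (fromℤ (u ℤ.* y) ℚ.+ fromℤ (v ℤ.* z))                ≡⟨ cong₂ (λ a b → m⁻¹ ℚ.* (a ℚ.+ b)) (fromℤ-homo-* u y) (fromℤ-homo-* v z) ⟩
      m⁻¹ ℚ.* (fromℤ u ℚ.* fromℤ y ℚ.+ fromℤ v ℚ.* fromℤ z)        ≡⟨ solve 5 (λ a b c d e → a :* (b :* c :+ d :* e) := b :* (a :* c) :+ d :* (a :* e)) refl m⁻¹ (fromℤ u) (fromℤ y) (fromℤ v) (fromℤ z) ⟩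
      fromℤ u ℚ.* (m⁻¹ ℚ.* fromℤ y) ℚ.+ fromℤ v ℚ.* (m⁻¹ ℚ.* fromℤ z) ≡⟨ cong₂ (λ a b → fromℤ u ℚ.* a ℚ.+ fromℤ v ℚ.* b) (divide p y mp≡y) (divide q z mq≡z) ⟨
      fromℤ u ℚ.* p ℚ.+ fromℤ v ℚ.* q                              ∎

-- Both coefficient vectors matter when `q` lists the values of a functional on generators: `u`
-- names an element with value `t`, and `k` tells how often to subtract it from each generator to
-- land in the kernel.
cyclic : ∀ {n} (q : Vector ℚ n) → ∃ λ t →
         (Σ (Vector ℤ n) λ u → t ≡ sumℚ (λ i → fromℤ (u i) ℚ.* q i)) ×
         (Σ (Vector ℤ n) λ k → ∀ i → q i ≡ fromℤ (k i) ℚ.* t)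
cyclic {zero}  q = 0ℚ , ((λ ()) , refl) , (λ ()) , λ ()
cyclic {suc n} q =
  let s , (u , s≡) , (k , q≡) = cyclic (q ∘ suc)
      t , (a , b , t≡) , (k₀ , q₀≡) , (l , s≡lt) = bézout-ℚ (q zero) s
  in t , (a ∷ (λ i → b ℤ.* u i) , combination a b t s u t≡ s≡) , (k₀ ∷ (λ i → k i ℤ.* l)) , λ
     { zero    → q₀≡
     ; (suc i) → trans (q≡ i) (multiple (k i) l s t s≡lt) }
  where
  open ≡-Reasoning

  multiple : ∀ k l s t → s ≡ fromℤ l ℚ.* t → fromℤ k ℚ.* s ≡ fromℤ (k ℤ.* l) ℚ.* t
  multiple k l s t s≡lt = begin
    fromℤ k ℚ.* s                       ≡⟨ cong (fromℤ k ℚ.*_) s≡lt ⟩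
    fromℤ k ℚ.* (fromℤ l ℚ.* t)         ≡⟨ ℚ.*-assoc (fromℤ k) (fromℤ l) t ⟨
    fromℤ k ℚ.* fromℤ l ℚ.* t           ≡⟨ cong (ℚ._* t) (fromℤ-homo-* k l) ⟨
    fromℤ (k ℤ.* l) ℚ.* t               ∎

  combination : ∀ a b t s (u : Vector ℤ n) → t ≡ fromℤ a ℚ.* q zero ℚ.+ fromℤ b ℚ.* s →
                s ≡ sumℚ (λ i → fromℤ (u i) ℚ.* q (suc i)) →
                t ≡ fromℤ a ℚ.* q zero ℚ.+ sumℚ (λ i → fromℤ (b ℤ.* u i) ℚ.* q (suc i))
  combination a b t s u t≡ s≡ = trans t≡ (cong (fromℤ a ℚ.* q zero ℚ.+_) (begin
    fromℤ b ℚ.* s                                          ≡⟨ cong (fromℤ b ℚ.*_) s≡ ⟩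
    fromℤ b ℚ.* sumℚ (λ i → fromℤ (u i) ℚ.* q (suc i))     ≡⟨ Sumℚ.*-distribˡ-sum (fromℤ b) (λ i → fromℤ (u i) ℚ.* q (suc i)) ⟩
    sumℚ (λ i → fromℤ b ℚ.* (fromℤ (u i) ℚ.* q (suc i)))   ≡⟨ Sumℚ.sum-cong-≋ (λ i → trans (cong (ℚ._* q (suc i)) (fromℤ-homo-* b (u i))) (ℚ.*-assoc (fromℤ b) (fromℤ (u i)) (q (suc i)))) ⟨
    sumℚ (λ i → fromℤ (b ℤ.* u i) ℚ.* q (suc i))           ∎))

-- Determinants: adjacent column operations preserve det, and they clear the first row except for
-- its first entry.

data Adjacent : ∀ {n} → Fin n → Fin n → Set where
  01ᵃ  : ∀ {n} → Adjacent {suc (suc n)} zero (suc zero)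
  10ᵃ  : ∀ {n} → Adjacent {suc (suc n)} (suc zero) zero
  sucᵃ : ∀ {n} {p q : Fin n} → Adjacent p q → Adjacent (suc p) (suc q)

adjacent⇒≢ : ∀ {n} {p q : Fin n} → Adjacent p q → p ≢ q
adjacent⇒≢ (sucᵃ adj) eq = adjacent⇒≢ adj (Fin.suc-injective eq)

-- No third column lies between two neighbours, so they remain neighbours in every minor that
-- contains both. The induction in `det-columnStep` rests on this.
adjacent-punchOut : ∀ {n} {p q l : Fin (suc n)} → Adjacent p q → (l≢p : l ≢ p) (l≢q : l ≢ q) →
                    Adjacent (punchOut l≢p) (punchOut l≢q)
adjacent-punchOut {l = zero}               01ᵃ        l≢p l≢q = contradiction refl l≢p
adjacent-punchOut {l = suc zero}           01ᵃ        l≢p l≢q = contradiction refl l≢q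
adjacent-punchOut {suc (suc _)} {l = suc (suc _)} 01ᵃ l≢p l≢q = 01ᵃ
adjacent-punchOut {l = zero}               10ᵃ        l≢p l≢q = contradiction refl l≢q
adjacent-punchOut {l = suc zero}           10ᵃ        l≢p l≢q = contradiction refl l≢p
adjacent-punchOut {suc (suc _)} {l = suc (suc _)} 10ᵃ l≢p l≢q = 10ᵃ
adjacent-punchOut {l = zero}               (sucᵃ adj) l≢p l≢q = adj
adjacent-punchOut {suc _} {l = suc l}      (sucᵃ adj) l≢p l≢q = sucᵃ (adjacent-punchOut adj (l≢p ∘ cong suc) (l≢q ∘ cong suc))

-- Deleting `p` or deleting `q` leaves the same columns in the same order, except at the place where
-- the survivor of the pair stands.
adjacent-punchIn : ∀ {n} {p q : Fin (suc n)} (adj : Adjacent p q) (p≢q : p ≢ q) → ∀ i →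
                   i ≢ punchOut p≢q → punchIn p i ≡ punchIn q i
adjacent-punchIn 01ᵃ        p≢q zero    i≢ = contradiction refl i≢
adjacent-punchIn 01ᵃ        p≢q (suc i) i≢ = refl
adjacent-punchIn 10ᵃ        p≢q zero    i≢ = contradiction refl i≢
adjacent-punchIn 10ᵃ        p≢q (suc i) i≢ = refl
adjacent-punchIn {suc _} (sucᵃ adj) p≢q zero    i≢ = refl
adjacent-punchIn {suc _} (sucᵃ adj) p≢q (suc i) i≢ = cong suc (adjacent-punchIn adj (p≢q ∘ cong suc) i (i≢ ∘ cong suc))

adjacent-punchIn-swap : ∀ {n} {p q : Fin (suc n)} (adj : Adjacent p q) (p≢q : p ≢ q) →
                        punchIn q (punchOut p≢q) ≡ p
adjacent-punchIn-swap 01ᵃ p≢q = refl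
adjacent-punchIn-swap 10ᵃ p≢q = refl
adjacent-punchIn-swap {suc _} (sucᵃ adj) p≢q = cong suc (adjacent-punchIn-swap adj (p≢q ∘ cong suc))

neg1^ : ℕ → ℚ
neg1^ k = (ℚ.- 1ℚ) ^ℚ k

adjacent-sign : ∀ {n} {p q : Fin n} → Adjacent p q → neg1^ (toℕ p) ≡ ℚ.- neg1^ (toℕ q)
adjacent-sign 01ᵃ = refl
adjacent-sign 10ᵃ = refl
adjacent-sign {p = suc p} {q = suc q} (sucᵃ adj) = trans (cong (ℚ.- 1ℚ ℚ.*_) (adjacent-sign adj)) (sym (ℚ.neg-distribʳ-* (ℚ.- 1ℚ) (neg1^ (toℕ q))))

sum-adjacent : ∀ {n} {p q : Fin n} → Adjacent p q → (s t : Vector ℚ n) →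
               (∀ l → l ≢ p → l ≢ q → s l ≡ t l) → s p ℚ.+ s q ≡ t p ℚ.+ t q → sumℚ s ≡ sumℚ t
sum-adjacent 01ᵃ s t same pair = begin
  s zero ℚ.+ (s (suc zero) ℚ.+ sumℚ (λ i → s (suc (suc i))))    ≡⟨ ℚ.+-assoc (s zero) (s (suc zero)) (sumℚ (λ i → s (suc (suc i)))) ⟨
  s zero ℚ.+ s (suc zero) ℚ.+ sumℚ (λ i → s (suc (suc i)))      ≡⟨ cong₂ ℚ._+_ pair (Sumℚ.sum-cong-≋ λ i → same (suc (suc i)) (λ ()) (λ ())) ⟩
  t zero ℚ.+ t (suc zero) ℚ.+ sumℚ (λ i → t (suc (suc i)))      ≡⟨ ℚ.+-assoc (t zero) (t (suc zero)) (sumℚ (λ i → t (suc (suc i)))) ⟩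
  t zero ℚ.+ (t (suc zero) ℚ.+ sumℚ (λ i → t (suc (suc i))))    ∎
  where open ≡-Reasoning
sum-adjacent 10ᵃ s t same pair = sum-adjacent 01ᵃ s t (λ l l≢0 l≢1 → same l l≢1 l≢0)
  (trans (ℚ.+-comm (s zero) (s (suc zero))) (trans pair (ℚ.+-comm (t (suc zero)) (t zero))))
sum-adjacent (sucᵃ adj) s t same pair = cong₂ ℚ._+_ (same zero (λ ()) (λ ()))
  (sum-adjacent adj (s ∘ suc) (t ∘ suc) (λ l l≢p l≢q → same (suc l) (l≢p ∘ Fin.suc-injective) (l≢q ∘ Fin.suc-injective)) pair)

minor : ∀ {n} → Matrix (suc n) → Fin (suc n) → Matrix n
minor A j i = removeAt (A (suc i)) j

cofactorTerm : ∀ {n} → Matrix (suc n) → Fin (suc n) → ℚ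
cofactorTerm A j = neg1^ (toℕ j) ℚ.* A zero j ℚ.* det (minor A j)

det-cong : ∀ {n} {A B : Matrix n} → (∀ i j → A i j ≡ B i j) → det A ≡ det B
det-cong {zero}  A≗B = refl
det-cong {suc n} A≗B = Sumℚ.sum-cong-≋ λ j →
  cong₂ (λ a d → neg1^ (toℕ j) ℚ.* a ℚ.* d) (A≗B zero j) (det-cong λ i l → A≗B (suc i) (punchIn j l))

-- In the expansion along the first row exactly one factor of each term depends on column `q`: the
-- entry if the term belongs to `q`, the minor otherwise.
det-linear : ∀ {n} (q : Fin n) c (A B C : Matrix n) →
             (∀ i l → l ≢ q → A i l ≡ B i l) → (∀ i l → l ≢ q → A i l ≡ C i l) →
             (∀ i → A i q ≡ B i q ℚ.+ c ℚ.* C i q) → det A ≡ det B ℚ.+ c ℚ.* det C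
det-linear {suc n} q c A B C A≗B A≗C column = begin
  sumℚ (cofactorTerm A)                                            ≡⟨ Sumℚ.sum-cong-≋ term ⟩
  sumℚ (λ l → cofactorTerm B l ℚ.+ c ℚ.* cofactorTerm C l)         ≡⟨ Sumℚ.∑-distrib-+ (cofactorTerm B) (λ l → c ℚ.* cofactorTerm C l) ⟩
  sumℚ (cofactorTerm B) ℚ.+ sumℚ (λ l → c ℚ.* cofactorTerm C l)    ≡⟨ cong (sumℚ (cofactorTerm B) ℚ.+_) (Sumℚ.*-distribˡ-sum c (cofactorTerm C)) ⟨
  sumℚ (cofactorTerm B) ℚ.+ c ℚ.* sumℚ (cofactorTerm C)            ∎
  where
  open ≡-Reasoning
  open ℚSolver.+-*-Solver

  term : ∀ l → cofactorTerm A l ≡ cofactorTerm B l ℚ.+ c ℚ.* cofactorTerm C l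
  term l with l Fin.≟ q
  ... | yes refl = begin
    neg1^ (toℕ l) ℚ.* A zero l ℚ.* det (minor A l)
      ≡⟨ cong (λ a → neg1^ (toℕ l) ℚ.* a ℚ.* det (minor A l)) (column zero) ⟩
    neg1^ (toℕ l) ℚ.* (B zero l ℚ.+ c ℚ.* C zero l) ℚ.* det (minor A l)
      ≡⟨ solve 5 (λ s b k d m → s :* (b :+ k :* d) :* m := s :* b :* m :+ k :* (s :* d :* m)) refl (neg1^ (toℕ l)) (B zero l) c (C zero l) (det (minor A l)) ⟩
    neg1^ (toℕ l) ℚ.* B zero l ℚ.* det (minor A l) ℚ.+ c ℚ.* (neg1^ (toℕ l) ℚ.* C zero l ℚ.* det (minor A l))
      ≡⟨ cong₂ (λ d e → neg1^ (toℕ l) ℚ.* B zero l ℚ.* d ℚ.+ c ℚ.* (neg1^ (toℕ l) ℚ.* C zero l ℚ.* e))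
           (det-cong λ i k → A≗B (suc i) (punchIn l k) (Fin.punchInᵢ≢i l k))
           (det-cong λ i k → A≗C (suc i) (punchIn l k) (Fin.punchInᵢ≢i l k)) ⟩
    cofactorTerm B l ℚ.+ c ℚ.* cofactorTerm C l ∎
  ... | no l≢q = begin
    neg1^ (toℕ l) ℚ.* A zero l ℚ.* det (minor A l)
      ≡⟨ cong (neg1^ (toℕ l) ℚ.* A zero l ℚ.*_) (det-linear (punchOut l≢q) c (minor A l) (minor B l) (minor C l)
           (λ i k k≢ → A≗B (suc i) (punchIn l k) (k≢ ∘ other k))
           (λ i k k≢ → A≗C (suc i) (punchIn l k) (k≢ ∘ other k))
           (λ i → trans (cong (A (suc i)) q≡) (trans (column (suc i)) (cong₂ (λ x y → B (suc i) x ℚ.+ c ℚ.* C (suc i) y) (sym q≡) (sym q≡))))) ⟩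
    neg1^ (toℕ l) ℚ.* A zero l ℚ.* (det (minor B l) ℚ.+ c ℚ.* det (minor C l))
      ≡⟨ solve 5 (λ s a d k e → s :* a :* (d :+ k :* e) := s :* a :* d :+ k :* (s :* a :* e)) refl (neg1^ (toℕ l)) (A zero l) (det (minor B l)) c (det (minor C l)) ⟩
    neg1^ (toℕ l) ℚ.* A zero l ℚ.* det (minor B l) ℚ.+ c ℚ.* (neg1^ (toℕ l) ℚ.* A zero l ℚ.* det (minor C l))
      ≡⟨ cong₂ (λ x y → neg1^ (toℕ l) ℚ.* x ℚ.* det (minor B l) ℚ.+ c ℚ.* (neg1^ (toℕ l) ℚ.* y ℚ.* det (minor C l))) (A≗B zero l l≢q) (A≗C zero l l≢q) ⟩
    cofactorTerm B l ℚ.+ c ℚ.* cofactorTerm C l ∎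
    where
    q≡ : punchIn l (punchOut l≢q) ≡ q
    q≡ = Fin.punchIn-punchOut l≢q
    other : ∀ k → punchIn l k ≡ q → k ≡ punchOut l≢q
    other k eq = Fin.punchIn-injective l k _ (trans eq (sym q≡))

record ColumnStep {m n} (A B : Fin m → Vector ℚ n) : Set where
  field
    {source target} : Fin n
    adjacent        : Adjacent source target
    scale           : ℚ
    unchanged       : ∀ i l → l ≢ target → B i l ≡ A i l
    changed         : ∀ i → B i target ≡ A i target ℚ.+ scale ℚ.* A i source

-- The terms of the two neighbouring columns have opposite signs. The new entry in the target adds
-- `c` times the source entry times the minor without the target; the changed minor without the
-- source adds the same product with the other sign. All remaining terms are covered by induction.
det-columnStep : ∀ {n} (A B : Matrix n) → ColumnStep A B → det B ≡ det A
det-columnStep {suc n} A B step = sum-adjacent adjacent (cofactorTerm B) (cofactorTerm A) generic (begin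
  neg1^ (toℕ p) ℚ.* B zero p ℚ.* det (minor B p) ℚ.+ neg1^ (toℕ q) ℚ.* B zero q ℚ.* det (minor B q)
    ≡⟨ cong₂ (λ x y → neg1^ (toℕ p) ℚ.* x ℚ.* det (minor B p) ℚ.+ neg1^ (toℕ q) ℚ.* y ℚ.* det (minor B q)) (unchanged zero p p≢q) (changed zero) ⟩
  neg1^ (toℕ p) ℚ.* A zero p ℚ.* det (minor B p) ℚ.+ neg1^ (toℕ q) ℚ.* (A zero q ℚ.+ c ℚ.* A zero p) ℚ.* det (minor B q)
    ≡⟨ cong₂ (λ x y → neg1^ (toℕ p) ℚ.* A zero p ℚ.* x ℚ.+ neg1^ (toℕ q) ℚ.* (A zero q ℚ.+ c ℚ.* A zero p) ℚ.* y)
         (det-linear (punchOut p≢q) c (minor B p) (minor A p) (minor A q) outside outside′ column)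
         (det-cong λ i k → unchanged (suc i) (punchIn q k) (Fin.punchInᵢ≢i q k)) ⟩
  neg1^ (toℕ p) ℚ.* A zero p ℚ.* (det (minor A p) ℚ.+ c ℚ.* det (minor A q)) ℚ.+ neg1^ (toℕ q) ℚ.* (A zero q ℚ.+ c ℚ.* A zero p) ℚ.* det (minor A q)
    ≡⟨ cong (λ s → s ℚ.* A zero p ℚ.* (det (minor A p) ℚ.+ c ℚ.* det (minor A q)) ℚ.+ neg1^ (toℕ q) ℚ.* (A zero q ℚ.+ c ℚ.* A zero p) ℚ.* det (minor A q)) (adjacent-sign adjacent) ⟩
  ℚ.- neg1^ (toℕ q) ℚ.* A zero p ℚ.* (det (minor A p) ℚ.+ c ℚ.* det (minor A q)) ℚ.+ neg1^ (toℕ q) ℚ.* (A zero q ℚ.+ c ℚ.* A zero p) ℚ.* det (minor A q)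
    ≡⟨ solve 6 (λ s a d k e b → :- s :* a :* (d :+ k :* e) :+ s :* (b :+ k :* a) :* e := :- s :* a :* d :+ s :* b :* e) refl (neg1^ (toℕ q)) (A zero p) (det (minor A p)) c (det (minor A q)) (A zero q) ⟩
  ℚ.- neg1^ (toℕ q) ℚ.* A zero p ℚ.* det (minor A p) ℚ.+ neg1^ (toℕ q) ℚ.* A zero q ℚ.* det (minor A q)
    ≡⟨ cong (λ s → s ℚ.* A zero p ℚ.* det (minor A p) ℚ.+ neg1^ (toℕ q) ℚ.* A zero q ℚ.* det (minor A q)) (adjacent-sign adjacent) ⟨
  cofactorTerm A p ℚ.+ cofactorTerm A q ∎)
  where
  open ≡-Reasoning
  open ℚSolver.+-*-Solver
  open ColumnStep step renaming (source to p; target to q; scale to c)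
  p≢q = adjacent⇒≢ adjacent

  q≡ : punchIn p (punchOut p≢q) ≡ q
  q≡ = Fin.punchIn-punchOut p≢q

  outside : ∀ i k → k ≢ punchOut p≢q → minor B p i k ≡ minor A p i k
  outside i k k≢ = unchanged (suc i) (punchIn p k)
    (λ eq → k≢ (Fin.punchIn-injective p k _ (trans eq (sym q≡))))

  outside′ : ∀ i k → k ≢ punchOut p≢q → minor B p i k ≡ minor A q i k
  outside′ i k k≢ = trans (outside i k k≢) (cong (A (suc i)) (adjacent-punchIn adjacent p≢q k k≢))

  column : ∀ i → minor B p i (punchOut p≢q) ≡ minor A p i (punchOut p≢q) ℚ.+ c ℚ.* minor A q i (punchOut p≢q)
  column i = trans (cong (B (suc i)) q≡) (trans (changed (suc i))
    (cong₂ (λ x y → A (suc i) x ℚ.+ c ℚ.* A (suc i) y) (sym q≡) (sym (adjacent-punchIn-swap adjacent p≢q))))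

  generic : ∀ l → l ≢ p → l ≢ q → cofactorTerm B l ≡ cofactorTerm A l
  generic l l≢p l≢q = cong₂ (λ a d → neg1^ (toℕ l) ℚ.* a ℚ.* d) (unchanged zero l l≢q)
    (det-columnStep (minor A l) (minor B l) (record
      { adjacent  = adjacent-punchOut adjacent l≢p l≢q
      ; scale     = c
      ; unchanged = λ i k k≢ → unchanged (suc i) (punchIn l k) (λ eq → k≢ (Fin.punchIn-injective l k _ (trans eq (sym (Fin.punchIn-punchOut l≢q)))))
      ; changed   = λ i → trans (cong (B (suc i)) (Fin.punchIn-punchOut l≢q)) (trans (changed (suc i))
          (cong₂ (λ x y → A (suc i) x ℚ.+ c ℚ.* A (suc i) y) (sym (Fin.punchIn-punchOut l≢q)) (sym (Fin.punchIn-punchOut l≢p))))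
      }))

addColumn : ∀ {m n} → Fin n → Fin n → ℚ → (Fin m → Vector ℚ n) → Fin m → Vector ℚ n
addColumn p q c A i l with l Fin.≟ q
... | yes _ = A i l ℚ.+ c ℚ.* A i p
... | no  _ = A i l

addColumn-changed : ∀ {m n} (p q : Fin n) c (A : Fin m → Vector ℚ n) i →
                    addColumn p q c A i q ≡ A i q ℚ.+ c ℚ.* A i p
addColumn-changed p q c A i with q Fin.≟ q
... | yes _   = refl
... | no  q≢q = contradiction refl q≢q

addColumn-unchanged : ∀ {m n} (p q : Fin n) c (A : Fin m → Vector ℚ n) i l → l ≢ q →
                      addColumn p q c A i l ≡ A i l
addColumn-unchanged p q c A i l l≢q with l Fin.≟ q
... | yes l≡q = contradiction l≡q l≢q
... | no  _   = refl

addColumn-step : ∀ {m n} {p q : Fin n} → Adjacent p q → ∀ c (A : Fin m → Vector ℚ n) →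
                 ColumnStep A (addColumn p q c A)
addColumn-step {p = p} {q} adj c A = record
  { adjacent  = adj
  ; scale     = c
  ; unchanged = addColumn-unchanged p q c A
  ; changed   = addColumn-changed p q c A
  }

adjacent-inject₁ : ∀ {n} (i : Fin n) → Adjacent (inject₁ i) (suc i)
adjacent-inject₁ zero    = 01ᵃ
adjacent-inject₁ (suc i) = sucᵃ (adjacent-inject₁ i)

adjacent-sym : ∀ {n} {p q : Fin n} → Adjacent p q → Adjacent q p
adjacent-sym 01ᵃ        = 10ᵃ
adjacent-sym 10ᵃ        = 01ᵃ
adjacent-sym (sucᵃ adj) = sucᵃ (adjacent-sym adj)

ColumnSteps : ∀ {m n} (A B : Fin m → Vector ℚ n) → Set
ColumnSteps = Star ColumnStep

clearEntry : ∀ {m n} {p q : Fin n} → Adjacent p q → (A : Fin (suc m) → Vector ℚ n) →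
             ∃ λ B → ColumnSteps A B × B zero q ≡ 0ℚ × (∀ l → l ≢ p → l ≢ q → B zero l ≡ A zero l)
clearEntry {p = p} {q} adj A with A zero p ℚ.≟ 0ℚ
... | no a≢0 = addColumn p q c A , addColumn-step adj c A ◅ ε ,
  trans (addColumn-changed p q c A zero) cancel , λ l _ → addColumn-unchanged p q c A zero l
  where
  open ≡-Reasoning
  open ℚSolver.+-*-Solver
  c = ℚ.- (A zero q ℚ.* inv (A zero p) a≢0)

  cancel : A zero q ℚ.+ c ℚ.* A zero p ≡ 0ℚ
  cancel = begin
    A zero q ℚ.+ c ℚ.* A zero p                                            ≡⟨ solve 3 (λ b a i → b :+ :- (b :* i) :* a := b :* (con 1ℚ :- a :* i)) refl (A zero q) (A zero p) (inv (A zero p) a≢0) ⟩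
    A zero q ℚ.* (1ℚ ℚ.- A zero p ℚ.* inv (A zero p) a≢0)                  ≡⟨ cong (λ x → A zero q ℚ.* (1ℚ ℚ.- x)) (*-inv (A zero p) a≢0) ⟩
    A zero q ℚ.* 0ℚ                                                        ≡⟨ ℚ.*-zeroʳ (A zero q) ⟩
    0ℚ                                                                     ∎
-- A zero pivot needs no exchange of columns: adding `q` to `p` makes both first-row entries equal,
-- and subtracting `p` from `q` then leaves zero.
... | yes a≡0 = C , addColumn-step (adjacent-sym adj) 1ℚ A ◅ addColumn-step adj (ℚ.- 1ℚ) B ◅ ε , cancel ,
  λ l l≢p l≢q → trans (addColumn-unchanged p q (ℚ.- 1ℚ) B zero l l≢q) (addColumn-unchanged q p 1ℚ A zero l l≢p)
  where
  open ≡-Reasoning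
  open ℚSolver.+-*-Solver
  B = addColumn q p 1ℚ A
  C = addColumn p q (ℚ.- 1ℚ) B

  cancel : C zero q ≡ 0ℚ
  cancel = begin
    C zero q                                                  ≡⟨ addColumn-changed p q (ℚ.- 1ℚ) B zero ⟩
    B zero q ℚ.+ ℚ.- 1ℚ ℚ.* B zero p                          ≡⟨ cong₂ (λ x y → x ℚ.+ ℚ.- 1ℚ ℚ.* y) (addColumn-unchanged q p 1ℚ A zero q (adjacent⇒≢ (adjacent-sym adj))) (addColumn-changed q p 1ℚ A zero) ⟩
    A zero q ℚ.+ ℚ.- 1ℚ ℚ.* (A zero p ℚ.+ 1ℚ ℚ.* A zero q)    ≡⟨ cong (λ x → A zero q ℚ.+ ℚ.- 1ℚ ℚ.* (x ℚ.+ 1ℚ ℚ.* A zero q)) a≡0 ⟩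
    A zero q ℚ.+ ℚ.- 1ℚ ℚ.* (0ℚ ℚ.+ 1ℚ ℚ.* A zero q)          ≡⟨ solve 1 (λ b → b :+ con (ℚ.- 1ℚ) :* (con 0ℚ :+ con 1ℚ :* b) := con 0ℚ) refl (A zero q) ⟩
    0ℚ                                                        ∎

-- The columns are treated from the last one backwards. Clearing an entry with the help of its left
-- neighbour disturbs, in the first row, at most the neighbour's entry, and that is the next to be
-- cleared.
clearRow : ∀ {m n} (A : Fin (suc m) → Vector ℚ (suc n)) →
           ∃ λ B → ColumnSteps A B × (∀ j → B zero (suc j) ≡ 0ℚ)
clearRow {n = n} A =
  let B , steps , clear = Fin.>-weakInduction ClearedBeyond (A , ε , λ j n<j → contradiction (subst (ℕ._< toℕ j) (Fin.toℕ-fromℕ n) n<j) (ℕ.≤⇒≯ (Fin.toℕ≤pred[n] j))) extend zero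
  in B , steps , λ j → clear (suc j) (ℕ.s≤s ℕ.z≤n)
  where
  ClearedBeyond : Fin (suc n) → Set
  ClearedBeyond i = ∃ λ B → ColumnSteps A B × (∀ j → i Fin.< j → B zero j ≡ 0ℚ)

  extend : ∀ i → ClearedBeyond (suc i) → ClearedBeyond (inject₁ i)
  extend i (B , steps , clear) =
    let C , steps′ , Cq≡0 , same = clearEntry (adjacent-inject₁ i) B
    in C , steps ◅◅ steps′ , λ j i<j → cleared C Cq≡0 same j (subst (ℕ._< toℕ j) (Fin.toℕ-inject₁ i) i<j) (j Fin.≟ suc i)
    where
    cleared : ∀ C → C zero (suc i) ≡ 0ℚ → (∀ l → l ≢ inject₁ i → l ≢ suc i → C zero l ≡ B zero l) →
              ∀ j → toℕ i ℕ.< toℕ j → Dec (j ≡ suc i) → C zero j ≡ 0ℚ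
    cleared C Cq≡0 same j i<j (yes refl) = Cq≡0
    cleared C Cq≡0 same j i<j (no j≢)    = trans
      (same j (λ { refl → ℕ.<-irrefl (sym (Fin.toℕ-inject₁ i)) i<j }) j≢)
      (clear j (ℕ.≤∧≢⇒< i<j (j≢ ∘ sym ∘ Fin.toℕ-injective)))

TrivialLeftKernel : ∀ {m n} → (Fin m → Vector ℚ n) → Set
TrivialLeftKernel {m} A = ∀ (w : Vector ℚ m) → (∀ j → sumℚ (λ i → w i ℚ.* A i j) ≡ 0ℚ) → ∀ i → w i ≡ 0ℚ

Solvable : ∀ {m n} → (Fin m → Vector ℚ n) → Set
Solvable {m} {n} A = ∀ (b : Vector ℚ m) → Σ (Vector ℚ n) λ v → ∀ i → sumℚ (λ j → A i j ℚ.* v j) ≡ b i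

trivialLeftKernel-step : ∀ {m n} {A B : Fin m → Vector ℚ n} → ColumnStep A B →
                         TrivialLeftKernel A → TrivialLeftKernel B
trivialLeftKernel-step {A = A} {B} step trivial w wB≡0 = trivial w wA≡0
  where
  open ≡-Reasoning
  open ℚSolver.+-*-Solver
  open ColumnStep step renaming (source to p; target to q; scale to c)

  unchanged-sum : ∀ l → l ≢ q → sumℚ (λ i → w i ℚ.* A i l) ≡ 0ℚ
  unchanged-sum l l≢q = trans (Sumℚ.sum-cong-≋ λ i → cong (w i ℚ.*_) (sym (unchanged i l l≢q))) (wB≡0 l)

  wA≡0 : ∀ l → sumℚ (λ i → w i ℚ.* A i l) ≡ 0ℚ
  wA≡0 l with l Fin.≟ q
  ... | no l≢q = unchanged-sum l l≢q
  ... | yes refl = begin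
    sumℚ (λ i → w i ℚ.* A i q)                                                    ≡⟨ solve 2 (λ x y → x := x :+ y :* con 0ℚ) refl (sumℚ (λ i → w i ℚ.* A i q)) c ⟩
    sumℚ (λ i → w i ℚ.* A i q) ℚ.+ c ℚ.* 0ℚ                                       ≡⟨ cong (λ x → sumℚ (λ i → w i ℚ.* A i q) ℚ.+ c ℚ.* x) (unchanged-sum p (adjacent⇒≢ adjacent)) ⟨
    sumℚ (λ i → w i ℚ.* A i q) ℚ.+ c ℚ.* sumℚ (λ i → w i ℚ.* A i p)               ≡⟨ cong (sumℚ (λ i → w i ℚ.* A i q) ℚ.+_) (Sumℚ.*-distribˡ-sum c (λ i → w i ℚ.* A i p)) ⟩
    sumℚ (λ i → w i ℚ.* A i q) ℚ.+ sumℚ (λ i → c ℚ.* (w i ℚ.* A i p))             ≡⟨ Sumℚ.∑-distrib-+ (λ i → w i ℚ.* A i q) (λ i → c ℚ.* (w i ℚ.* A i p)) ⟨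
    sumℚ (λ i → w i ℚ.* A i q ℚ.+ c ℚ.* (w i ℚ.* A i p))                          ≡⟨ Sumℚ.sum-cong-≋ (λ i → solve 4 (λ x a k b → x :* a :+ k :* (x :* b) := x :* (a :+ k :* b)) refl (w i) (A i q) c (A i p)) ⟩
    sumℚ (λ i → w i ℚ.* (A i q ℚ.+ c ℚ.* A i p))                                  ≡⟨ Sumℚ.sum-cong-≋ (λ i → cong (w i ℚ.*_) (changed i)) ⟨
    sumℚ (λ i → w i ℚ.* B i q)                                                    ≡⟨ wB≡0 q ⟩
    0ℚ                                                                            ∎

-- If `B` is `A` times an elementary matrix E, then `A` applied to E v is `B` applied to v. `shift`
-- is this E; acting on vectors it alters the source entry, not the target.
solvable-step : ∀ {m n} {A B : Fin m → Vector ℚ n} → ColumnStep A B → Solvable B → Solvable A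
solvable-step {n = n} {A} {B} step solvable b =
  let v , Bv≡b = solvable b in shift v , λ i → trans (sym (sums v i)) (Bv≡b i)
  where
  open ≡-Reasoning
  open ℚSolver.+-*-Solver
  open ColumnStep step renaming (source to p; target to q; scale to c)

  shift : Vector ℚ n → Vector ℚ n
  shift v l with l Fin.≟ p
  ... | yes _ = v l ℚ.+ c ℚ.* v q
  ... | no  _ = v l

  shift-p : ∀ v → shift v p ≡ v p ℚ.+ c ℚ.* v q
  shift-p v with p Fin.≟ p
  ... | yes _   = refl
  ... | no  p≢p = contradiction refl p≢p

  shift-other : ∀ v l → l ≢ p → shift v l ≡ v l
  shift-other v l l≢p with l Fin.≟ p
  ... | yes l≡p = contradiction l≡p l≢p
  ... | no  _   = refl

  sums : ∀ v i → sumℚ (λ j → B i j ℚ.* v j) ≡ sumℚ (λ j → A i j ℚ.* shift v j)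
  sums v i = sum-adjacent adjacent _ _
    (λ l l≢p l≢q → cong₂ ℚ._*_ (unchanged i l l≢q) (sym (shift-other v l l≢p)))
    (begin
      B i p ℚ.* v p ℚ.+ B i q ℚ.* v q                                  ≡⟨ cong₂ (λ x y → x ℚ.* v p ℚ.+ y ℚ.* v q) (unchanged i p (adjacent⇒≢ adjacent)) (changed i) ⟩
      A i p ℚ.* v p ℚ.+ (A i q ℚ.+ c ℚ.* A i p) ℚ.* v q                ≡⟨ solve 5 (λ a v b k w → a :* v :+ (b :+ k :* a) :* w := a :* (v :+ k :* w) :+ b :* w) refl (A i p) (v p) (A i q) c (v q) ⟩
      A i p ℚ.* (v p ℚ.+ c ℚ.* v q) ℚ.+ A i q ℚ.* v q                  ≡⟨ cong₂ (λ x y → A i p ℚ.* x ℚ.+ A i q ℚ.* y) (shift-p v) (shift-other v q (adjacent⇒≢ adjacent ∘ sym)) ⟨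
      A i p ℚ.* shift v p ℚ.+ A i q ℚ.* shift v q                      ∎)

sum-zero : ∀ {n} (q : Vector ℚ n) → (∀ i → q i ≡ 0ℚ) → sumℚ q ≡ 0ℚ
sum-zero {n} q q≡0 = trans (Sumℚ.sum-cong-≋ q≡0) (Sumℚ.sum-replicate-zero n)

-- Once the first row is cleared, its pivot is nonzero, since otherwise the first unit vector would
-- be in the left kernel, and the minor inherits the trivial kernel. The determinant is then the
-- pivot times that of the minor, and systems are solved by forward substitution. The first
-- conclusion is used for discriminants, the second for dual bases.
nondegenerate : ∀ {n} (A : Matrix n) → TrivialLeftKernel A → det A ≢ 0ℚ × Solvable A
nondegenerate {zero}  A trivial = (λ ()) , λ b → (λ ()) , λ ()
nondegenerate {suc n} A trivial =
  let B , steps , clear = clearRow A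
      det≢0 , solvable = reduced B clear (kernel steps trivial)
  in det≢0 ∘ trans (dets steps) , solve← steps solvable
  where
  open ≡-Reasoning
  open ℚSolver.+-*-Solver

  kernel : ∀ {A B : Matrix (suc n)} → ColumnSteps A B → TrivialLeftKernel A → TrivialLeftKernel B
  kernel ε              = id
  kernel (step ◅ steps) = kernel steps ∘ trivialLeftKernel-step step

  dets : ∀ {A B : Matrix (suc n)} → ColumnSteps A B → det B ≡ det A
  dets ε                      = refl
  dets (_◅_ {A} {B} step steps) = trans (dets steps) (det-columnStep A B step)

  solve← : ∀ {A B : Matrix (suc n)} → ColumnSteps A B → Solvable B → Solvable A
  solve← ε              = id
  solve← (step ◅ steps) = solvable-step step ∘ solve← steps

  reduced : ∀ B → (∀ j → B zero (suc j) ≡ 0ℚ) → TrivialLeftKernel B → det B ≢ 0ℚ × Solvable B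
  reduced B clear trivial with B zero zero ℚ.≟ 0ℚ
  ... | yes a≡0 = contradiction (trivial e₀ e₀B≡0 zero) λ ()
    where
    e₀ : Vector ℚ (suc n)
    e₀ = 1ℚ ∷ λ _ → 0ℚ

    row≡0 : ∀ j → B zero j ≡ 0ℚ
    row≡0 zero    = a≡0
    row≡0 (suc j) = clear j

    e₀B≡0 : ∀ j → sumℚ (λ i → e₀ i ℚ.* B i j) ≡ 0ℚ
    e₀B≡0 j = sum-zero (λ i → e₀ i ℚ.* B i j) λ
      { zero    → trans (ℚ.*-identityˡ (B zero j)) (row≡0 j)
      ; (suc i) → ℚ.*-zeroˡ (B (suc i) j) }
  ... | no a≢0 = det≢0 , solution
    where
    b₀₀ = B zero zero
    M = minor B zero

    M-trivial : TrivialLeftKernel M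
    M-trivial w wM≡0 i = trivial (t ∷ w) tw≡0 (suc i)
      where
      s = sumℚ (λ i → w i ℚ.* B (suc i) zero)
      -- The first entry that makes column zero vanish as well, so that a kernel vector of the minor
      -- extends to one of `B`.
      t = ℚ.- (s ℚ.* inv b₀₀ a≢0)

      tw≡0 : ∀ j → sumℚ (λ i → (t ∷ w) i ℚ.* B i j) ≡ 0ℚ
      tw≡0 zero    = begin
        ℚ.- (s ℚ.* inv b₀₀ a≢0) ℚ.* b₀₀ ℚ.+ s      ≡⟨ solve 3 (λ s i a → :- (s :* i) :* a :+ s := s :* (con 1ℚ :- a :* i)) refl s (inv b₀₀ a≢0) b₀₀ ⟩
        s ℚ.* (1ℚ ℚ.- b₀₀ ℚ.* inv b₀₀ a≢0)         ≡⟨ cong (λ x → s ℚ.* (1ℚ ℚ.- x)) (*-inv b₀₀ a≢0) ⟩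
        s ℚ.* 0ℚ                               ≡⟨ ℚ.*-zeroʳ s ⟩
        0ℚ                                     ∎
      tw≡0 (suc j) = trans (cong₂ (λ x y → t ℚ.* x ℚ.+ y) (clear j) (wM≡0 j)) (solve 1 (λ t → t :* con 0ℚ :+ con 0ℚ := con 0ℚ) refl t)

    IH = nondegenerate M M-trivial

    det≡ : det B ≡ b₀₀ ℚ.* det M
    det≡ = begin
      1ℚ ℚ.* b₀₀ ℚ.* det M ℚ.+ sumℚ (λ j → cofactorTerm B (suc j))   ≡⟨ cong (1ℚ ℚ.* b₀₀ ℚ.* det M ℚ.+_) (sum-zero _ λ j → trans (cong (λ x → neg1^ (suc (toℕ j)) ℚ.* x ℚ.* det (minor B (suc j))) (clear j)) (solve 2 (λ s d → s :* con 0ℚ :* d := con 0ℚ) refl (neg1^ (suc (toℕ j))) (det (minor B (suc j))))) ⟩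
      1ℚ ℚ.* b₀₀ ℚ.* det M ℚ.+ 0ℚ                                    ≡⟨ solve 2 (λ a d → con 1ℚ :* a :* d :+ con 0ℚ := a :* d) refl b₀₀ (det M) ⟩
      b₀₀ ℚ.* det M                                                  ∎

    det≢0 : det B ≢ 0ℚ
    det≢0 eq = *-≢0 a≢0 (proj₁ IH) (trans (sym det≡) eq)

    solution : Solvable B
    solution b =
      let v₀ = b zero ℚ.* inv b₀₀ a≢0
          v , Mv≡ = proj₂ IH (λ i → b (suc i) ℚ.- B (suc i) zero ℚ.* v₀)
      in v₀ ∷ v , λ
        { zero → begin
            b₀₀ ℚ.* (b zero ℚ.* inv b₀₀ a≢0) ℚ.+ sumℚ (λ j → B zero (suc j) ℚ.* v j)  ≡⟨ cong (b₀₀ ℚ.* (b zero ℚ.* inv b₀₀ a≢0) ℚ.+_) (sum-zero _ λ j → trans (cong (ℚ._* v j) (clear j)) (ℚ.*-zeroˡ (v j))) ⟩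
            b₀₀ ℚ.* (b zero ℚ.* inv b₀₀ a≢0) ℚ.+ 0ℚ                                   ≡⟨ solve 3 (λ a b i → a :* (b :* i) :+ con 0ℚ := b :* (a :* i)) refl b₀₀ (b zero) (inv b₀₀ a≢0) ⟩
            b zero ℚ.* (b₀₀ ℚ.* inv b₀₀ a≢0)                                          ≡⟨ cong (b zero ℚ.*_) (*-inv b₀₀ a≢0) ⟩
            b zero ℚ.* 1ℚ                                                         ≡⟨ ℚ.*-identityʳ (b zero) ⟩
            b zero                                                                ∎
        ; (suc i) → begin
            B (suc i) zero ℚ.* v₀ ℚ.+ sumℚ (λ j → B (suc i) (suc j) ℚ.* v j)      ≡⟨ cong (B (suc i) zero ℚ.* v₀ ℚ.+_) (Mv≡ i) ⟩
            B (suc i) zero ℚ.* v₀ ℚ.+ (b (suc i) ℚ.- B (suc i) zero ℚ.* v₀)       ≡⟨ solve 2 (λ x y → x :+ (y :- x) := y) refl (B (suc i) zero ℚ.* v₀) (b (suc i)) ⟩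
            b (suc i)                                                             ∎ }

det-integer : ∀ {n} (A : Matrix n) → (∀ i j → IsInteger (A i j)) → IsInteger (det A)
det-integer {zero}  A int = ℤ.1ℤ , refl
det-integer {suc n} A int = integer-sum (cofactorTerm A) λ j →
  integer-* (integer-* (sign-integer (toℕ j)) (int zero j)) (det-integer (minor A j) λ i l → int (suc i) (punchIn j l))
  where
  sign-integer : ∀ k → IsInteger (neg1^ k)
  sign-integer zero    = ℤ.1ℤ , refl
  sign-integer (suc k) = integer-* (ℤ.-1ℤ , refl) (sign-integer k)

-- Linear algebra in a number field

module FieldLemmas {n : ℕ} (K : NumberField n) where
  open NumberField K public
    hiding (zero)
    renaming (refl to ≈-refl; sym to ≈-sym; trans to ≈-trans; spanning to basis-spanning; independent to basis-independent)
  open IsRingHomomorphism ι-homomorphism public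
    using () renaming (⟦⟧-cong to ι-cong; +-homo to ι-+; *-homo to ι-*; -‿homo to ι-neg; 0#-homo to ι-0; 1#-homo to ι-1)
  open RingProperties ring public using (-0#≈0#; -‿distribˡ-*; -‿distribʳ-*)
  module SumK = Sum semiring
  module ExpK = Exp semiring

  weaklyDecide : ∀ y z → Maybe (ι (fromℤ y) ≈ ι (fromℤ z))
  weaklyDecide y z with y ℤ.≟ z
  ... | yes refl = just ≈-refl
  ... | no  _    = nothing

  ℤ⟶K : CommutativeRing.rawRing ℤ.+-*-commutativeRing ACR.-Raw-AlmostCommutative⟶ ACR.fromCommutativeRing commutativeRing
  ℤ⟶K = record
    { ⟦_⟧    = ι ∘ fromℤ
    ; +-homo = λ y z → ≈-trans (ι-cong (fromℤ-homo-+ y z)) (ι-+ (fromℤ y) (fromℤ z))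
    ; *-homo = λ y z → ≈-trans (ι-cong (fromℤ-homo-* y z)) (ι-* (fromℤ y) (fromℤ z))
    ; -‿homo = λ z → ≈-trans (ι-cong (fromℤ-homo‿- z)) (ι-neg (fromℤ z))
    ; 0-homo = ι-0
    ; 1-homo = ι-1
    }

  module KSolver = RingSolver (CommutativeRing.rawRing ℤ.+-*-commutativeRing) (ACR.fromCommutativeRing commutativeRing)
    ℤ⟶K weaklyDecide

  open SetoidReasoning setoid

  0≈0*x : ∀ x → 0# ≈ ι 0ℚ * x
  0≈0*x x = ≈-sym (≈-trans (*-congʳ ι-0) (zeroˡ x))

  ι-injective-0 : ∀ {q} → ι q ≈ 0# → q ≡ 0ℚ
  ι-injective-0 {q} ιq≈0 with q ℚ.≟ 0ℚ
  ... | yes q≡0 = q≡0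
  ... | no  q≢0 = contradiction (begin
    0#                       ≈⟨ zeroˡ (ι (inv q q≢0)) ⟨
    0# * ι (inv q q≢0)       ≈⟨ *-congʳ ιq≈0 ⟨
    ι q * ι (inv q q≢0)      ≈⟨ ι-* q (inv q q≢0) ⟨
    ι (q ℚ.* inv q q≢0)      ≈⟨ ι-cong (*-inv q q≢0) ⟩
    ι 1ℚ                     ≈⟨ ι-1 ⟩
    1#                       ∎) 0≉1

  lc : ∀ {m} → Vector ℚ m → Vector Carrier m → Carrier
  lc q g = sum (λ i → ι (q i) * g i)

  lc-cong : ∀ {m} {p q : Vector ℚ m} {g h : Vector Carrier m} →
            (∀ i → p i ≡ q i) → (∀ i → g i ≈ h i) → lc p g ≈ lc q h
  lc-cong p≗q g≈h = SumK.sum-cong-≋ λ i → *-cong (ι-cong (p≗q i)) (g≈h i)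

  lc-congˡ : ∀ {m} {p q : Vector ℚ m} (g : Vector Carrier m) → (∀ i → p i ≡ q i) → lc p g ≈ lc q g
  lc-congˡ g p≗q = lc-cong {g = g} p≗q (λ _ → ≈-refl)

  lc-+ : ∀ {m} (p q : Vector ℚ m) g → lc (λ i → p i ℚ.+ q i) g ≈ lc p g + lc q g
  lc-+ p q g = ≈-trans
    (SumK.sum-cong-≋ λ i → ≈-trans (*-congʳ (ι-+ (p i) (q i))) (distribʳ (g i) (ι (p i)) (ι (q i))))
    (SumK.∑-distrib-+ (λ i → ι (p i) * g i) (λ i → ι (q i) * g i))

  lc-scale : ∀ {m} c (q : Vector ℚ m) g → lc (λ i → c ℚ.* q i) g ≈ ι c * lc q g
  lc-scale c q g = ≈-trans
    (SumK.sum-cong-≋ λ i → ≈-trans (*-congʳ (ι-* c (q i))) (*-assoc (ι c) (ι (q i)) (g i)))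
    (≈-sym (SumK.*-distribˡ-sum (ι c) (λ i → ι (q i) * g i)))

  *-lc : ∀ {m} x (q : Vector ℚ m) g → x * lc q g ≈ lc q (λ i → x * g i)
  *-lc x q g = ≈-trans (SumK.*-distribˡ-sum x (λ i → ι (q i) * g i))
    (SumK.sum-cong-≋ λ i → solve 3 (λ x q g → x :* (q :* g) := q :* (x :* g)) ≈-refl x (ι (q i)) (g i))
    where open KSolver

  sum≈0 : ∀ {m} (g : Vector Carrier m) → (∀ i → g i ≈ 0#) → sum g ≈ 0#
  sum≈0 {m} g g≈0 = ≈-trans (SumK.sum-cong-≋ g≈0) (SumK.sum-replicate-zero m)

  lc-zero : ∀ {m} (q : Vector ℚ m) g → (∀ i → q i ≡ 0ℚ) → lc q g ≈ 0#
  lc-zero q g q≡0 = sum≈0 _ λ i → ≈-trans (*-congʳ (ι-cong (q≡0 i))) (≈-sym (0≈0*x (g i)))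

  -- The Kronecker delta, with integer values so that its rows can serve as coefficient vectors in
  -- `Span`.
  δ : ∀ {m} → Fin m → Vector ℤ m
  δ zero    zero    = ℤ.1ℤ
  δ zero    (suc j) = ℤ.0ℤ
  δ (suc i) zero    = ℤ.0ℤ
  δ (suc i) (suc j) = δ i j

  lc-δ : ∀ {m} (i : Fin m) g → lc (fromℤ ∘ δ i) g ≈ g i
  lc-δ zero    g = ≈-trans (+-cong (≈-trans (*-congʳ ι-1) (*-identityˡ (g zero)))
    (lc-zero _ (g ∘ suc) λ _ → refl)) (+-identityʳ (g zero))
  lc-δ (suc i) g = ≈-trans (+-cong (≈-sym (0≈0*x (g zero))) (lc-δ i (g ∘ suc))) (+-identityˡ (g (suc i)))

  Independent : ∀ {m} → Vector Carrier m → Set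
  Independent {m} g = ∀ (q : Vector ℚ m) → lc q g ≈ 0# → ∀ i → q i ≡ 0ℚ

  lc-injective : ∀ {m} {g : Vector Carrier m} → Independent g → ∀ p q → lc p g ≈ lc q g → ∀ i → p i ≡ q i
  lc-injective {g = g} independent p q eq i = p-q≡0 (independent (λ i → p i ℚ.+ (ℚ.- 1ℚ) ℚ.* q i) (begin
    lc (λ i → p i ℚ.+ (ℚ.- 1ℚ) ℚ.* q i) g        ≈⟨ lc-+ p (λ i → (ℚ.- 1ℚ) ℚ.* q i) g ⟩
    lc p g + lc (λ i → (ℚ.- 1ℚ) ℚ.* q i) g       ≈⟨ +-cong eq (lc-scale (ℚ.- 1ℚ) q g) ⟩
    lc q g + ι (ℚ.- 1ℚ) * lc q g                 ≈⟨ solve 1 (λ x → x :+ con ℤ.-1ℤ :* x := con ℤ.0ℤ) ≈-refl (lc q g) ⟩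
    ι 0ℚ                                         ≈⟨ ι-0 ⟩
    0#                                           ∎) i)
    where
    open KSolver
    p-q≡0 : p i ℚ.+ (ℚ.- 1ℚ) ℚ.* q i ≡ 0ℚ → p i ≡ q i
    p-q≡0 eq = trans (S.solve 2 (λ x y → x S.:= (x S.:+ S.con (ℚ.- 1ℚ) S.:* y) S.:+ y) refl (p i) (q i))
      (trans (cong (ℚ._+ q i) eq) (ℚ.+-identityˡ (q i)))
      where module S = ℚSolver.+-*-Solver

  coordinates-unique : ∀ x q → x ≈ lc q basis → ∀ i → coordinates x i ≡ q i
  coordinates-unique x q eq = lc-injective basis-independent (coordinates x) q (≈-trans (≈-sym (basis-spanning x)) eq)

  coordinates-≡0⇒≈0 : ∀ x → (∀ i → coordinates x i ≡ 0ℚ) → x ≈ 0#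
  coordinates-≡0⇒≈0 x eq = ≈-trans (basis-spanning x) (lc-zero _ basis eq)

  record LinearFunctional : Set where
    field
      ⟦_⟧   : Carrier → ℚ
      ⟦⟧-cong : ∀ {x y} → x ≈ y → ⟦ x ⟧ ≡ ⟦ y ⟧
      ⟦⟧-+    : ∀ x y → ⟦ x + y ⟧ ≡ ⟦ x ⟧ ℚ.+ ⟦ y ⟧
      ⟦⟧-*    : ∀ q x → ⟦ ι q * x ⟧ ≡ q ℚ.* ⟦ x ⟧

    ⟦⟧-0 : ∀ {x} → x ≈ 0# → ⟦ x ⟧ ≡ 0ℚ
    ⟦⟧-0 {x} x≈0 = trans (⟦⟧-cong (≈-trans x≈0 (0≈0*x 0#))) (trans (⟦⟧-* 0ℚ 0#) (ℚ.*-zeroˡ ⟦ 0# ⟧))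

    ⟦⟧-lc : ∀ {m} (q : Vector ℚ m) g → ⟦ lc q g ⟧ ≡ sumℚ (λ i → q i ℚ.* ⟦ g i ⟧)
    ⟦⟧-lc {zero}  q g = ⟦⟧-0 ≈-refl
    ⟦⟧-lc {suc m} q g = trans (⟦⟧-+ _ _) (cong₂ ℚ._+_ (⟦⟧-* (q zero) (g zero)) (⟦⟧-lc (q ∘ suc) (g ∘ suc)))

  coordinate : Fin n → LinearFunctional
  coordinate i = record
    { ⟦_⟧     = λ x → coordinates x i
    ; ⟦⟧-cong = λ {x} {y} x≈y → coordinates-unique x (coordinates y) (≈-trans x≈y (basis-spanning y)) i
    ; ⟦⟧-+    = λ x y → coordinates-unique (x + y) (λ j → coordinates x j ℚ.+ coordinates y j)
        (≈-trans (+-cong (basis-spanning x) (basis-spanning y)) (≈-sym (lc-+ (coordinates x) (coordinates y) basis))) i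
    ; ⟦⟧-*    = λ q x → coordinates-unique (ι q * x) (λ j → q ℚ.* coordinates x j)
        (≈-trans (*-congˡ (basis-spanning x)) (≈-sym (lc-scale q (coordinates x) basis))) i
    }

  -- Subgroups of the additive group

  record IsSubgroup (P : Carrier → Set) : Set where
    field
      resp  : ∀ {x y} → x ≈ y → P x → P y
      0∈    : P 0#
      +-closed   : ∀ {x y} → P x → P y → P (x + y)
      neg-closed : ∀ {x} → P x → P (- x)

    ℕ-closed : ∀ k {x} → P x → P (ι (fromℤ (+ k)) * x)
    ℕ-closed zero    {x} Px = resp (0≈0*x x) 0∈
    ℕ-closed (suc k) {x} Px = resp (begin
      x + ι (fromℤ (+ k)) * x                    ≈⟨ solve 2 (λ x k → x :+ k :* x := (con ℤ.1ℤ :+ k) :* x) ≈-refl x (ι (fromℤ (+ k))) ⟩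
      (ι 1ℚ + ι (fromℤ (+ k))) * x               ≈⟨ *-congʳ (ι-+ 1ℚ (fromℤ (+ k))) ⟨
      ι (1ℚ ℚ.+ fromℤ (+ k)) * x                 ≈⟨ *-congʳ (ι-cong (fromℤ-homo-+ ℤ.1ℤ (+ k))) ⟨
      ι (fromℤ (+ suc k)) * x                    ∎) (+-closed Px (ℕ-closed k Px))
      where open KSolver

    ℤ-closed : ∀ z {x} → P x → P (ι (fromℤ z) * x)
    ℤ-closed (+ k)    Px = ℕ-closed k Px
    ℤ-closed -[1+ k ] {x} Px = resp (begin
      - (ι (fromℤ (+ suc k)) * x)                ≈⟨ -‿distribˡ-* _ x ⟩
      - ι (fromℤ (+ suc k)) * x                  ≈⟨ *-congʳ (ι-neg (fromℤ (+ suc k))) ⟨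
      ι (ℚ.- fromℤ (+ suc k)) * x                ≈⟨ *-congʳ (ι-cong (fromℤ-homo‿- (+ suc k))) ⟨
      ι (fromℤ -[1+ k ]) * x                     ∎) (neg-closed (ℕ-closed (suc k) Px))

    sum-closed : ∀ {m} (g : Vector Carrier m) → (∀ i → P (g i)) → P (sum g)
    sum-closed {zero}  g Pg = 0∈
    sum-closed {suc m} g Pg = +-closed (Pg zero) (sum-closed (g ∘ suc) (Pg ∘ suc))

    lc-closed : ∀ {m} (z : Vector ℤ m) g → (∀ i → P (g i)) → P (lc (fromℤ ∘ z) g)
    lc-closed z g Pg = sum-closed _ λ i → ℤ-closed (z i) (Pg i)

    minus-closed : ∀ {x y} → P x → P y → P (x - y)
    minus-closed Px Py = +-closed Px (neg-closed Py)

  preimage-isSubgroup : ∀ {P} y → IsSubgroup P → IsSubgroup (λ x → P (y * x))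
  preimage-isSubgroup y isSubgroup = record
    { resp       = λ x≈y → resp (*-congˡ x≈y)
    ; 0∈         = resp (≈-sym (zeroʳ y)) 0∈
    ; +-closed   = λ Px Px′ → resp (≈-sym (distribˡ y _ _)) (+-closed Px Px′)
    ; neg-closed = λ Px → resp (-‿distribʳ-* y _) (neg-closed Px)
    }
    where open IsSubgroup isSubgroup

  Span : ∀ {m} → Vector Carrier m → Carrier → Set
  Span {m} g x = Σ (Vector ℤ m) λ z → x ≈ lc (fromℤ ∘ z) g

  span-isSubgroup : ∀ {m} (g : Vector Carrier m) → IsSubgroup (Span g)
  span-isSubgroup g = record
    { resp       = λ { x≈y (z , x≈) → z , ≈-trans (≈-sym x≈y) x≈ }
    ; 0∈         = (λ _ → ℤ.0ℤ) , ≈-sym (lc-zero _ g λ _ → refl)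
    ; +-closed   = λ { (y , x≈) (z , x′≈) → (λ i → y i ℤ.+ z i) , ≈-trans (+-cong x≈ x′≈) (≈-trans (≈-sym (lc-+ (fromℤ ∘ y) (fromℤ ∘ z) g)) (lc-cong (λ i → sym (fromℤ-homo-+ (y i) (z i))) (λ i → ≈-refl))) }
    ; neg-closed = λ { {x} (z , x≈) → (λ i → ℤ.-1ℤ ℤ.* z i) , (begin
        - x                                          ≈⟨ -‿cong x≈ ⟩
        - lc (fromℤ ∘ z) g                           ≈⟨ solve 1 (λ x → :- x := con ℤ.-1ℤ :* x) ≈-refl (lc (fromℤ ∘ z) g) ⟩
        ι (fromℤ ℤ.-1ℤ) * lc (fromℤ ∘ z) g           ≈⟨ lc-scale (fromℤ ℤ.-1ℤ) (fromℤ ∘ z) g ⟨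
        lc (λ i → fromℤ ℤ.-1ℤ ℚ.* fromℤ (z i)) g     ≈⟨ lc-cong (λ i → fromℤ-homo-* ℤ.-1ℤ (z i)) (λ i → ≈-refl) ⟨
        lc (λ i → fromℤ (ℤ.-1ℤ ℤ.* z i)) g           ∎) }
    }
    where open KSolver

  generator : ∀ {m} (g : Vector Carrier m) i → Span g (g i)
  generator g i = δ i , ≈-sym (lc-δ i g)

  -- Serves as the induction principle for spans: a property is packaged as a subgroup and then
  -- checked on generators.
  span-minimal : ∀ {m} {g : Vector Carrier m} {P} → IsSubgroup P → (∀ i → P (g i)) → ∀ {x} → Span g x → P x
  span-minimal isSubgroup Pg (z , x≈) = resp (≈-sym x≈) (lc-closed z _ Pg)
    where open IsSubgroup isSubgroup

  span-minimal-* : ∀ {m} {g : Vector Carrier m} {P} → IsSubgroup P → ∀ y → (∀ i → P (y * g i)) → ∀ {x} → Span g x → P (y * x)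
  span-minimal-* isSubgroup y = span-minimal (preimage-isSubgroup y isSubgroup)

  -- Integrality

  powers : ∀ m → Carrier → Vector Carrier m
  powers m x i = x ^ toℕ i

  module Elimination (x : Carrier) where
    -- The values at `x` of integer polynomials of degree less than `d`, and of monic ones of degree
    -- `d`. Working with values alone suffices, as integrality asks only for some monic expression
    -- that vanishes.
    Low Monic : ℕ → Carrier → Set
    Low d = Span (powers d x)
    Monic d y = Low d (y - x ^ d)

    low-isSubgroup : ∀ d → IsSubgroup (Low d)
    low-isSubgroup d = span-isSubgroup (powers d x)
    module Low {d} = IsSubgroup (low-isSubgroup d)

    low-power : ∀ {d} k → k ℕ.< d → Low d (x ^ k)
    low-power {d} k k<d = Low.resp (ExpK.^-congʳ x (Fin.toℕ-fromℕ< k<d)) (generator (powers d x) (Fin.fromℕ< k<d))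

    low-*-power : ∀ {d} e {y} → Low d y → Low (d ℕ.+ e) (x ^ e * y)
    low-*-power {d} e = span-minimal-* (low-isSubgroup (d ℕ.+ e)) (x ^ e) λ i →
      Low.resp (ExpK.^-homo-* x e (toℕ i)) (low-power (e ℕ.+ toℕ i)
        (subst (e ℕ.+ toℕ i ℕ.<_) (ℕ.+-comm e d) (ℕ.+-monoʳ-< e (Fin.toℕ<n i))))

    low-*-low : ∀ {d e y z} → Low d y → Low e z → Low (d ℕ.+ e) (y * z)
    low-*-low {d} {e} {y} {z} y∈ z∈ = Low.resp (*-comm z y) (span-minimal-* (low-isSubgroup (d ℕ.+ e)) z
      (λ i → Low.resp (*-comm (x ^ toℕ i) z) (subst (λ f → Low f (x ^ toℕ i * z)) (ℕ.+-comm e d)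
        (low-mono e (Fin.toℕ<n i) (low-*-power (toℕ i) z∈)))) y∈)
      where
      low-mono : ∀ e {i d w} → i ℕ.< d → Low (e ℕ.+ i) w → Low (e ℕ.+ d) w
      low-mono e {i} {d} i<d = span-minimal (low-isSubgroup (e ℕ.+ d)) λ j →
        low-power (toℕ j) (ℕ.<-trans (Fin.toℕ<n j) (ℕ.+-monoʳ-< e i<d))

    monic-*-low : ∀ {d e y z} → Monic d y → Low e z → Low (d ℕ.+ e) (y * z)
    monic-*-low {d} {e} {y} {z} y∈ z∈ = Low.resp
      (solve 3 (λ y z p → (y :- p) :* z :+ p :* z := y :* z) ≈-refl y z (x ^ d))
      (Low.+-closed (low-*-low y∈ z∈) (subst (λ f → Low f (x ^ d * z)) (ℕ.+-comm e d) (low-*-power d z∈)))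
      where open KSolver

    monic-*-monic : ∀ {d e y z} → Monic d y → Monic e z → Monic (d ℕ.+ e) (y * z)
    monic-*-monic {d} {e} {y} {z} y∈ z∈ = Low.resp (≈-trans
      (solve 4 (λ y z p q → y :* (z :- q) :+ q :* (y :- p) := y :* z :- p :* q) ≈-refl y z (x ^ d) (x ^ e))
      (+-congˡ (-‿cong (≈-sym (ExpK.^-homo-* x d e)))))
      (Low.+-closed (monic-*-low y∈ z∈) (low-*-power e y∈))
      where open KSolver

    monic-minus-low : ∀ {d y z} → Monic d y → Low d z → Monic d (y - z)
    monic-minus-low {d} {y} {z} y∈ z∈ = Low.resp
      (solve 3 (λ y z p → (y :- p) :- z := (y :- z) :- p) ≈-refl y z (x ^ d))
      (Low.minus-closed y∈ z∈)
      where open KSolver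

    -- Eliminating g zero from the other equations keeps the diagonal monic and of larger degree
    -- than the remaining entries.
    annihilator : ∀ {m} (g : Vector Carrier m) d (P : Fin m → Fin m → Carrier) →
                  (∀ i → Monic d (P i i)) → (∀ i j → i ≢ j → Low d (P i j)) →
                  (∀ i → sum (λ j → P i j * g j) ≈ 0#) →
                  ∃₂ λ e y → Monic e y × (∀ i → y * g i ≈ 0#)
    annihilator {zero}  g d P diagonal off-diagonal Pg≈0 = 0 , 1# ,
      Low.resp (≈-sym (-‿inverseʳ 1#)) Low.0∈ , λ ()
    annihilator {suc m} g d P diagonal off-diagonal Pg≈0 =
      let e , y , y∈ , yg≈0 = annihilator (g ∘ suc) (d ℕ.+ d) Q Q-diagonal Q-off-diagonal Qg≈0
      -- `y` kills the tail of `g`. The extra factor `P zero zero` turns `g zero` into a combination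
      -- of the tail, so the product kills that entry too.
      in e ℕ.+ d , y * P zero zero , monic-*-monic y∈ (diagonal zero) , λ
         { zero    → begin
             y * P zero zero * g zero               ≈⟨ *-assoc y (P zero zero) (g zero) ⟩
             y * (P zero zero * g zero)             ≈⟨ *-congˡ (first zero) ⟩
             y * - rest zero                        ≈⟨ -‿distribʳ-* y (rest zero) ⟨
             - (y * rest zero)                      ≈⟨ -‿cong (SumK.*-distribˡ-sum y (λ j → P zero (suc j) * g (suc j))) ⟩
             - sum (λ j → y * (P zero (suc j) * g (suc j))) ≈⟨ -‿cong (sum≈0 _ λ j → ≈-trans (swap y (P zero (suc j)) (g (suc j))) (≈-trans (*-congˡ (yg≈0 j)) (zeroʳ (P zero (suc j))))) ⟩
             - 0#                                   ≈⟨ -0#≈0# ⟩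
             0#                                     ∎
         ; (suc i) → begin
             y * P zero zero * g (suc i)            ≈⟨ ≈-trans (*-assoc y (P zero zero) (g (suc i))) (swap y (P zero zero) (g (suc i))) ⟩
             P zero zero * (y * g (suc i))          ≈⟨ *-congˡ (yg≈0 i) ⟩
             P zero zero * 0#                       ≈⟨ zeroʳ (P zero zero) ⟩
             0#                                     ∎ }
      where
      open KSolver
      rest : Fin (suc m) → Carrier
      rest i = sum (λ j → P i (suc j) * g (suc j))

      swap : ∀ x y z → x * (y * z) ≈ y * (x * z)
      swap = solve 3 (λ x y z → x :* (y :* z) := y :* (x :* z)) ≈-refl

      first : ∀ i → P i zero * g zero ≈ - rest i
      first i = begin
        P i zero * g zero                        ≈⟨ solve 2 (λ x y → x := (x :+ y) :- y) ≈-refl (P i zero * g zero) (rest i) ⟩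
        (P i zero * g zero + rest i) - rest i    ≈⟨ +-congʳ (Pg≈0 i) ⟩
        0# - rest i                              ≈⟨ +-identityˡ _ ⟩
        - rest i                                 ∎

      -- Cross multiplication instead of division keeps the entries integer polynomials in `x`.
      Q : Fin m → Fin m → Carrier
      Q i j = P zero zero * P (suc i) (suc j) - P (suc i) zero * P zero (suc j)

      Q-diagonal : ∀ i → Monic (d ℕ.+ d) (Q i i)
      Q-diagonal i = monic-minus-low (monic-*-monic (diagonal zero) (diagonal (suc i)))
        (low-*-low (off-diagonal (suc i) zero λ ()) (off-diagonal zero (suc i) λ ()))

      Q-off-diagonal : ∀ i j → i ≢ j → Low (d ℕ.+ d) (Q i j)
      Q-off-diagonal i j i≢j = Low.minus-closed
        (monic-*-low (diagonal zero) (off-diagonal (suc i) (suc j) (i≢j ∘ Fin.suc-injective)))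
        (low-*-low (off-diagonal (suc i) zero λ ()) (off-diagonal zero (suc j) λ ()))

      Qg≈0 : ∀ i → sum (λ j → Q i j * g (suc j)) ≈ 0#
      Qg≈0 i = begin
        sum (λ j → Q i j * g (suc j))
          ≈⟨ SumK.sum-cong-≋ (λ j → solve 5 (λ a b c d x → (a :* b :- c :* d) :* x := a :* (b :* x) :+ (:- c) :* (d :* x)) ≈-refl (P zero zero) (P (suc i) (suc j)) (P (suc i) zero) (P zero (suc j)) (g (suc j))) ⟩
        sum (λ j → P zero zero * (P (suc i) (suc j) * g (suc j)) + - P (suc i) zero * (P zero (suc j) * g (suc j)))
          ≈⟨ SumK.∑-distrib-+ (λ j → P zero zero * (P (suc i) (suc j) * g (suc j))) (λ j → - P (suc i) zero * (P zero (suc j) * g (suc j))) ⟩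
        sum (λ j → P zero zero * (P (suc i) (suc j) * g (suc j))) + sum (λ j → - P (suc i) zero * (P zero (suc j) * g (suc j)))
          ≈⟨ +-cong (SumK.*-distribˡ-sum (P zero zero) (λ j → P (suc i) (suc j) * g (suc j))) (SumK.*-distribˡ-sum (- P (suc i) zero) (λ j → P zero (suc j) * g (suc j))) ⟨
        P zero zero * rest (suc i) + - P (suc i) zero * rest zero
          ≈⟨ solve 4 (λ a r c s → a :* r :+ (:- c) :* s := (:- (a :* (:- r))) :+ c :* (:- s)) ≈-refl (P zero zero) (rest (suc i)) (P (suc i) zero) (rest zero) ⟩
        - (P zero zero * - rest (suc i)) + P (suc i) zero * - rest zero
          ≈⟨ +-cong (-‿cong (*-congˡ (first (suc i)))) (*-congˡ (first zero)) ⟨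
        - (P zero zero * (P (suc i) zero * g zero)) + P (suc i) zero * (P zero zero * g zero)
          ≈⟨ solve 3 (λ a c x → (:- (a :* (c :* x))) :+ c :* (a :* x) := con ℤ.0ℤ) ≈-refl (P zero zero) (P (suc i) zero) (g zero) ⟩
        ι 0ℚ
          ≈⟨ ι-0 ⟩
        0# ∎

-- Integral elements form a ring whose rational elements are the integers

module Integrality {n : ℕ} (K : NumberField n) where
  open FieldLemmas K public
  open SetoidReasoning setoid

  ≈0-isSubgroup : IsSubgroup (_≈ 0#)
  ≈0-isSubgroup = record
    { resp       = λ x≈y x≈0 → ≈-trans (≈-sym x≈y) x≈0
    ; 0∈         = ≈-refl
    ; +-closed   = λ x≈0 y≈0 → ≈-trans (+-cong x≈0 y≈0) (+-identityʳ 0#)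
    ; neg-closed = λ x≈0 → ≈-trans (-‿cong x≈0) -0#≈0#
    }

  δ-diagonal : ∀ {m} (i : Fin m) → δ i i ≡ ℤ.1ℤ
  δ-diagonal zero    = refl
  δ-diagonal (suc i) = δ-diagonal i

  δ-off-diagonal : ∀ {m} {i j : Fin m} → i ≢ j → δ i j ≡ ℤ.0ℤ
  δ-off-diagonal {i = zero}  {zero}  i≢j = contradiction refl i≢j
  δ-off-diagonal {i = zero}  {suc j} i≢j = refl
  δ-off-diagonal {i = suc i} {zero}  i≢j = refl
  δ-off-diagonal {i = suc i} {suc j} i≢j = δ-off-diagonal (i≢j ∘ cong suc)

  Stabilises : Carrier → ∀ {m} → Vector Carrier m → Set
  Stabilises x g = ∀ i → Span g (x * g i)

  stabilises-span : ∀ {x m} {g : Vector Carrier m} → Stabilises x g → ∀ {y} → Span g y → Span g (x * y)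
  stabilises-span {x} {g = g} = span-minimal-* (span-isSubgroup g) x

  -- With `A` the matrix of multiplication by `x` on the generators, the matrix x - `A` kills `g`.
  -- `annihilator` stands in for the theorem of Cayley and Hamilton: its monic expression `y` kills
  -- every generator, hence also `1#`, and so is zero.
  stable⇒integral : ∀ {m} (g : Vector Carrier m) → Span g 1# → ∀ {x} → Stabilises x g → x ∈ 𝓞 K
  stable⇒integral {m} g 1∈ {x} stable =
    let e , y , (c , y-xᵉ≈) , yg≈0 = annihilator g 1 P diagonal off-diagonal Pg≈0
        y≈0 = ≈-trans (≈-sym (*-identityʳ y)) (span-minimal-* ≈0-isSubgroup y yg≈0 1∈)
    in e , c , (begin
      x ^ e + lc (fromℤ ∘ c) (powers e x)      ≈⟨ +-congˡ y-xᵉ≈ ⟨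
      x ^ e + (y - x ^ e)                      ≈⟨ solve 2 (λ p y → p :+ (y :- p) := y) ≈-refl (x ^ e) y ⟩
      y                                        ≈⟨ y≈0 ⟩
      0#                                       ∎)
    where
    open Elimination x
    open KSolver

    A : Fin m → Vector ℤ m
    A i = proj₁ (stable i)

    P : Fin m → Fin m → Carrier
    P i j = ι (fromℤ (δ i j)) * x - ι (fromℤ (A i j))

    constant : ∀ z → Low 1 (ι (fromℤ z))
    constant z = Low.resp (*-identityʳ (ι (fromℤ z))) (Low.ℤ-closed z (low-power 0 (ℕ.s≤s ℕ.z≤n)))

    diagonal : ∀ i → Monic 1 (P i i)
    diagonal i = Low.resp (begin
      - ι (fromℤ (A i i))                                           ≈⟨ solve 2 (λ x a → :- a := (con ℤ.1ℤ :* x :- a) :- x :* con ℤ.1ℤ) ≈-refl x (ι (fromℤ (A i i))) ⟩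
      (ι 1ℚ * x - ι (fromℤ (A i i))) - x * ι 1ℚ                     ≈⟨ +-cong (+-congʳ (*-congʳ (ι-cong (cong fromℤ (sym (δ-diagonal i)))))) (-‿cong (*-congˡ ι-1)) ⟩
      P i i - x ^ 1                                                 ∎)
      (Low.neg-closed (constant (A i i)))

    off-diagonal : ∀ i j → i ≢ j → Low 1 (P i j)
    off-diagonal i j i≢j = Low.resp (begin
      - ι (fromℤ (A i j))                    ≈⟨ +-identityˡ _ ⟨
      0# - ι (fromℤ (A i j))                 ≈⟨ +-congʳ (0≈0*x x) ⟩
      ι 0ℚ * x - ι (fromℤ (A i j))           ≈⟨ +-congʳ (*-congʳ (ι-cong (cong fromℤ (δ-off-diagonal i≢j)))) ⟨
      P i j                                  ∎)
      (Low.neg-closed (constant (A i j)))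

    Pg≈0 : ∀ i → sum (λ j → P i j * g j) ≈ 0#
    Pg≈0 i = begin
      sum (λ j → P i j * g j)
        ≈⟨ SumK.sum-cong-≋ (λ j → solve 4 (λ d x a g → (d :* x :- a) :* g := d :* (x :* g) :+ con ℤ.-1ℤ :* (a :* g)) ≈-refl (ι (fromℤ (δ i j))) x (ι (fromℤ (A i j))) (g j)) ⟩
      sum (λ j → ι (fromℤ (δ i j)) * (x * g j) + ι (fromℤ ℤ.-1ℤ) * (ι (fromℤ (A i j)) * g j))
        ≈⟨ SumK.∑-distrib-+ (λ j → ι (fromℤ (δ i j)) * (x * g j)) (λ j → ι (fromℤ ℤ.-1ℤ) * (ι (fromℤ (A i j)) * g j)) ⟩
      lc (fromℤ ∘ δ i) (λ j → x * g j) + sum (λ j → ι (fromℤ ℤ.-1ℤ) * (ι (fromℤ (A i j)) * g j))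
        ≈⟨ +-cong (lc-δ i (λ j → x * g j)) (≈-sym (SumK.*-distribˡ-sum (ι (fromℤ ℤ.-1ℤ)) (λ j → ι (fromℤ (A i j)) * g j))) ⟩
      x * g i + ι (fromℤ ℤ.-1ℤ) * lc (fromℤ ∘ A i) g
        ≈⟨ +-congˡ (*-congˡ (proj₂ (stable i))) ⟨
      x * g i + ι (fromℤ ℤ.-1ℤ) * (x * g i)
        ≈⟨ solve 1 (λ y → y :+ con ℤ.-1ℤ :* y := con ℤ.0ℤ) ≈-refl (x * g i) ⟩
      ι 0ℚ
        ≈⟨ ι-0 ⟩
      0# ∎

  integral⇒stable : ∀ {x} → x ∈ 𝓞 K → ∃ λ m → Σ (Vector Carrier m) λ g → Span g 1# × Stabilises x g
  -- A monic equation of degree zero would read 1 = 0. In positive degree `1#` is among the listed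
  -- powers.
  integral⇒stable     (zero  , c , eq) = contradiction (≈-sym (≈-trans (≈-sym (+-identityʳ 1#)) eq)) 0≉1
  integral⇒stable {x} (suc m , c , eq) = suc m , g , generator g zero , stable
    where
    open IsSubgroup (span-isSubgroup (powers (suc m) x))
    g = powers (suc m) x

    xᵐ∈ : Span g (x ^ suc m)
    xᵐ∈ = resp (begin
      - lc (fromℤ ∘ c) g                                ≈⟨ +-identityˡ _ ⟨
      0# - lc (fromℤ ∘ c) g                             ≈⟨ +-congʳ eq ⟨
      (x ^ suc m + lc (fromℤ ∘ c) g) - lc (fromℤ ∘ c) g ≈⟨ solve 2 (λ p s → (p :+ s) :- s := p) ≈-refl (x ^ suc m) (lc (fromℤ ∘ c) g) ⟩
      x ^ suc m                                         ∎)
      (neg-closed (c , ≈-refl))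
      where open KSolver

    stable : Stabilises x g
    stable i with suc (toℕ i) ℕ.≟ suc m
    ... | yes eq = resp (ExpK.^-congʳ x (sym eq)) xᵐ∈
    ... | no  ≢m = Elimination.low-power x (suc (toℕ i)) (ℕ.≤∧≢⇒< (Fin.toℕ<n i) ≢m)

  _⊗_ : ∀ {l m} → Vector Carrier l → Vector Carrier m → Vector Carrier (l ℕ.* m)
  _⊗_ {l} {m} g h k = g (Fin.quotient m k) * h (Fin.remainder {l} m k)

  ⊗-∈ : ∀ {l m} {g : Vector Carrier l} {h : Vector Carrier m} {x y} → Span g x → Span h y → Span (g ⊗ h) (x * y)
  ⊗-∈ {l} {m} {g} {h} {x} x∈ = span-minimal-* S x λ j →
    resp (*-comm (h j) x) (span-minimal-* S (h j) (λ i →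
      resp (≈-trans (reflexive (cong (λ (i , j) → g i * h j) (Fin.remQuot-combine i j))) (*-comm (g i) (h j)))
        (generator (g ⊗ h) (Fin.combine i j))) x∈)
    where
    S = span-isSubgroup (g ⊗ h)
    open IsSubgroup S

  ⊗-stabilisesˡ : ∀ {l m} {g : Vector Carrier l} {h : Vector Carrier m} {x} → Stabilises x g → Stabilises x (g ⊗ h)
  ⊗-stabilisesˡ {g = g} {h} stable k = resp (*-assoc _ _ _) (⊗-∈ {g = g} {h} (stable _) (generator h _))
    where open IsSubgroup (span-isSubgroup (g ⊗ h))

  ⊗-stabilisesʳ : ∀ {l m} {g : Vector Carrier l} {h : Vector Carrier m} {x} → Stabilises x h → Stabilises x (g ⊗ h)
  ⊗-stabilisesʳ {g = g} {h} {x} stable k = resp (solve 3 (λ g x h → g :* (x :* h) := x :* (g :* h)) ≈-refl _ x _)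
    (⊗-∈ {g = g} {h} (generator g _) (stable _))
    where
    open IsSubgroup (span-isSubgroup (g ⊗ h))
    open KSolver

  -- The products of generators of the two subgroups generate one that is stable under both
  -- elements, and therefore under their sum and product.
  jointly-stable : ∀ {x y} → x ∈ 𝓞 K → y ∈ 𝓞 K →
                   ∃ λ m → Σ (Vector Carrier m) λ g → Span g 1# × Stabilises x g × Stabilises y g
  jointly-stable x∈ y∈ =
    let l , g , 1∈g , xg = integral⇒stable x∈
        m , h , 1∈h , yh = integral⇒stable y∈
    in l ℕ.* m , g ⊗ h ,
       IsSubgroup.resp (span-isSubgroup (g ⊗ h)) (*-identityʳ 1#) (⊗-∈ {g = g} {h} 1∈g 1∈h) ,
       ⊗-stabilisesˡ {g = g} {h} xg , ⊗-stabilisesʳ {g = g} {h} yh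

  integral-resp : ∀ {x y} → x ≈ y → x ∈ 𝓞 K → y ∈ 𝓞 K
  integral-resp x≈y x∈ =
    let m , g , 1∈ , stable = integral⇒stable x∈
    in stable⇒integral g 1∈ λ i → IsSubgroup.resp (span-isSubgroup g) (*-congʳ x≈y) (stable i)

  integral-ℤ : ∀ z → ι (fromℤ z) ∈ 𝓞 K
  integral-ℤ z = stable⇒integral g (generator g zero) λ i → ℤ-closed z (generator g i)
    where
    g : Vector Carrier 1
    g _ = 1#
    open IsSubgroup (span-isSubgroup g)

  integral-K-* : ∀ {x y} → x ∈ 𝓞 K → y ∈ 𝓞 K → x * y ∈ 𝓞 K
  integral-K-* {x} {y} x∈ y∈ =
    let m , g , 1∈ , xg , yg = jointly-stable x∈ y∈
    in stable⇒integral g 1∈ λ i → IsSubgroup.resp (span-isSubgroup g) (≈-sym (*-assoc x y (g i)))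
         (stabilises-span xg (yg i))

  𝓞-isSubgroup : IsSubgroup (𝓞 K)
  𝓞-isSubgroup = record
    { resp       = integral-resp
    ; 0∈         = integral-resp ι-0 (integral-ℤ ℤ.0ℤ)
    ; +-closed   = λ {x} {y} x∈ y∈ →
        let m , g , 1∈ , xg , yg = jointly-stable x∈ y∈
        in stable⇒integral g 1∈ λ i → IsSubgroup.resp (span-isSubgroup g) (≈-sym (distribʳ (g i) x y))
             (IsSubgroup.+-closed (span-isSubgroup g) (xg i) (yg i))
    ; neg-closed = λ {x} x∈ →
        let m , g , 1∈ , stable = integral⇒stable x∈
        in stable⇒integral g 1∈ λ i → IsSubgroup.resp (span-isSubgroup g) (-‿distribˡ-* x (g i))
             (IsSubgroup.neg-closed (span-isSubgroup g) (stable i))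
    }

  1∈𝓞 : 1# ∈ 𝓞 K
  1∈𝓞 = integral-resp ι-1 (integral-ℤ ℤ.1ℤ)

  functional-multiple : ∀ (f : LinearFunctional) {m} {g : Vector Carrier m} {t} →
    (∀ i → ∃ λ k → LinearFunctional.⟦_⟧ f (g i) ≡ fromℤ k ℚ.* t) →
    ∀ {x} → Span g x → ∃ λ k → LinearFunctional.⟦_⟧ f x ≡ fromℤ k ℚ.* t
  functional-multiple f {t = t} = span-minimal record
    { resp       = λ { x≈y (k , eq) → k , trans (sym (⟦⟧-cong x≈y)) eq }
    ; 0∈         = ℤ.0ℤ , trans (⟦⟧-0 ≈-refl) (sym (ℚ.*-zeroˡ t))
    ; +-closed   = λ { {x} {y} (k , eq) (l , eq′) → k ℤ.+ l , trans (⟦⟧-+ x y) (trans (cong₂ ℚ._+_ eq eq′)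
        (trans (sym (ℚ.*-distribʳ-+ t (fromℤ k) (fromℤ l))) (cong (ℚ._* t) (sym (fromℤ-homo-+ k l))))) }
    ; neg-closed = λ { {x} (k , eq) → ℤ.-1ℤ ℤ.* k , trans (⟦⟧-cong (solve 1 (λ x → :- x := con ℤ.-1ℤ :* x) ≈-refl x))
        (trans (⟦⟧-* (ℚ.- 1ℚ) x) (trans (cong (ℚ.- 1ℚ ℚ.*_) eq) (trans (sym (ℚ.*-assoc (ℚ.- 1ℚ) (fromℤ k) t))
          (cong (ℚ._* t) (sym (fromℤ-homo-* ℤ.-1ℤ k)))))) }
    }
    where
    open LinearFunctional f
    open KSolver hiding (⟦_⟧)

  -- Replaces the rational root theorem. The values of `f` on a finitely generated subgroup stable
  -- under `q` form a group generated by some `t`, nonzero because `f` does not vanish at `1#`.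
  -- Stability makes `q` times `t` an integer multiple of `t`.
  integral∩ℚ : ∀ (f : LinearFunctional) → LinearFunctional.⟦_⟧ f 1# ≢ 0ℚ → ∀ {q} → ι q ∈ 𝓞 K → IsInteger q
  integral∩ℚ f f1≢0 {q} q∈ = conclude (integral⇒stable q∈)
    where
    open LinearFunctional f
    open ℚSolver.+-*-Solver hiding (⟦_⟧)

    conclude : (∃ λ m → Σ (Vector Carrier m) λ g → Span g 1# × Stabilises (ι q) g) → IsInteger q
    conclude (m , g , 1∈ , stable) =
      let t , (u , t≡) , (k , multiples) = cyclic (⟦_⟧ ∘ g)
          multiple = functional-multiple f {g = g} {t} (λ i → k i , multiples i)
          l , f1≡ = multiple 1∈
          j , qt≡ = multiple (stabilises-span {g = g} stable (u , ≈-refl {lc (fromℤ ∘ u) g}))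
      in j , divide t j
        (λ t≡0 → f1≢0 (trans f1≡ (trans (cong (fromℤ l ℚ.*_) t≡0) (ℚ.*-zeroʳ (fromℤ l)))))
        (trans (cong (q ℚ.*_) (trans t≡ (sym (⟦⟧-lc (fromℤ ∘ u) g)))) (trans (sym (⟦⟧-* q (lc (fromℤ ∘ u) g))) qt≡))
      where
      divide : ∀ t j → t ≢ 0ℚ → q ℚ.* t ≡ fromℤ j ℚ.* t → q ≡ fromℤ j
      divide t j t≢0 eq = trans (solve 2 (λ x y → x := (x :- y) :+ y) refl q (fromℤ j))
        (trans (cong (ℚ._+ fromℤ j) (*-cancel-0 t≢0
          (trans (solve 3 (λ t x y → t :* (x :- y) := x :* t :- y :* t) refl t q (fromℤ j))
            (trans (cong (ℚ._- fromℤ j ℚ.* t) eq) (ℚ.+-inverseʳ (fromℤ j ℚ.* t))))))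
        (ℚ.+-identityˡ (fromℤ j)))

-- Triangular bases of finitely generated subgroups; the trace form

module Lattices {n : ℕ} (K : NumberField n) where
  open Integrality K public
  open SetoidReasoning setoid

  ker-isSubgroup : ∀ f → IsSubgroup (λ x → LinearFunctional.⟦_⟧ f x ≡ 0ℚ)
  ker-isSubgroup f = record
    { resp       = λ x≈y eq → trans (sym (⟦⟧-cong x≈y)) eq
    ; 0∈         = ⟦⟧-0 ≈-refl
    ; +-closed   = λ {x} {y} fx≡0 fy≡0 → trans (⟦⟧-+ x y) (trans (cong₂ ℚ._+_ fx≡0 fy≡0) (ℚ.+-identityˡ 0ℚ))
    ; neg-closed = λ {x} fx≡0 → trans (⟦⟧-cong (KSolver.solve 1 (λ x → KSolver.:- x KSolver.:= KSolver.con ℤ.-1ℤ KSolver.:* x) ≈-refl x))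
        (trans (⟦⟧-* (ℚ.- 1ℚ) x) (trans (cong (ℚ.- 1ℚ ℚ.*_) fx≡0) (ℚ.*-zeroʳ (ℚ.- 1ℚ))))
    }
    where open LinearFunctional f

  infix 5 _$_
  _$_ : LinearFunctional → Carrier → ℚ
  f $ x = LinearFunctional.⟦_⟧ f x

  Kernel : ∀ {r} → (Fin r → LinearFunctional) → Carrier → Set
  Kernel f x = ∀ i → f i $ x ≡ 0ℚ

  -- A Hermite normal form relative to the functionals. The remainder `y` in the common kernel is
  -- kept because later functionals vanish on ℚ. There are always `r` reduced vectors, even if the
  -- span has smaller rank, so independence is conditional on a triangular family `e` in the span.
  record Reduction {r m} (f : Fin r → LinearFunctional) (g : Vector Carrier m) : Set where
    field
      reduced   : Vector Carrier r
      reduced∈  : ∀ i → Span g (reduced i)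
      decompose : ∀ {x} → Span g x → Σ (Vector ℤ r) λ z → ∃ λ y →
                  Span g y × Kernel f y × x ≈ lc (fromℤ ∘ z) reduced + y
      independent : ∀ (e : Vector Carrier r) → (∀ i → Span g (e i)) →
                    (∀ i j → j Fin.< i → f j $ e i ≡ 0ℚ) → (∀ i → f i $ e i ≢ 0ℚ) →
                    ∀ (q : Vector ℚ r) y → Kernel f y → lc q reduced + y ≈ 0# → ∀ i → q i ≡ 0ℚ

  module ReductionStep {r m} (f : Fin (suc r) → LinearFunctional) (g : Vector Carrier m)
                       (t : ℚ) (u k : Vector ℤ m)
                       (t≡ : t ≡ sumℚ (λ i → fromℤ (u i) ℚ.* (f zero $ g i)))
                       (fg≡ : ∀ i → f zero $ g i ≡ fromℤ (k i) ℚ.* t) where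
    module F₀ = LinearFunctional (f zero)
    open KSolver

    h₀ : Carrier
    h₀ = lc (fromℤ ∘ u) g

    h₀∈ : Span g h₀
    h₀∈ = u , ≈-refl

    f₀h₀≡t : f zero $ h₀ ≡ t
    f₀h₀≡t = trans (F₀.⟦⟧-lc (fromℤ ∘ u) g) (sym t≡)

    -- Removing `k i` copies of `h₀` moves each generator into the kernel of `f zero`.
    g′ : Vector Carrier m
    g′ i = g i - ι (fromℤ (k i)) * h₀

    module S = IsSubgroup (span-isSubgroup g)
    module S′ = IsSubgroup (span-isSubgroup g′)

    g′⊆ : ∀ {x} → Span g′ x → Span g x
    g′⊆ = span-minimal (span-isSubgroup g) λ i → S.minus-closed (generator g i) (S.ℤ-closed (k i) h₀∈)

    f₀g′≡0 : ∀ {x} → Span g′ x → f zero $ x ≡ 0ℚ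
    f₀g′≡0 = span-minimal (ker-isSubgroup (f zero)) λ i →
      trans (F₀.⟦⟧-cong (solve 3 (λ g z h → g :- z :* h := g :+ con ℤ.-1ℤ :* (z :* h)) ≈-refl (g i) (ι (fromℤ (k i))) h₀))
      (trans (F₀.⟦⟧-+ _ _) (trans (cong₂ ℚ._+_ (fg≡ i) (trans (F₀.⟦⟧-* (ℚ.- 1ℚ) _) (cong (ℚ.- 1ℚ ℚ.*_)
        (trans (F₀.⟦⟧-* (fromℤ (k i)) h₀) (cong (fromℤ (k i) ℚ.*_) f₀h₀≡t)))))
      (Q.solve 1 (λ x → x Q.:+ Q.con (ℚ.- 1ℚ) Q.:* x Q.:= Q.con 0ℚ) refl (fromℤ (k i) ℚ.* t))))
      where module Q = ℚSolver.+-*-Solver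

    split : ∀ {x} → Span g x → ∃₂ λ z w → Span g′ w × x ≈ ι (fromℤ z) * h₀ + w
    split = span-minimal (record
      { resp       = λ { x≈y (z , w , w∈ , eq) → z , w , w∈ , ≈-trans (≈-sym x≈y) eq }
      ; 0∈         = ℤ.0ℤ , 0# , S′.0∈ , ≈-trans (0≈0*x h₀) (≈-sym (+-identityʳ _))
      ; +-closed   = λ { (y , v , v∈ , eq) (z , w , w∈ , eq′) → y ℤ.+ z , v + w , S′.+-closed v∈ w∈ ,
          ≈-trans (+-cong eq eq′) (≈-trans
            (solve 5 (λ y z h v w → (y :* h :+ v) :+ (z :* h :+ w) := (y :+ z) :* h :+ (v :+ w)) ≈-refl (ι (fromℤ y)) (ι (fromℤ z)) h₀ v w)
            (+-congʳ (*-congʳ (≈-sym (≈-trans (ι-cong (fromℤ-homo-+ y z)) (ι-+ (fromℤ y) (fromℤ z))))))) }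
      ; neg-closed = λ { (z , w , w∈ , eq) → ℤ.- z , - w , S′.neg-closed w∈ ,
          ≈-trans (-‿cong eq) (≈-trans
            (solve 3 (λ z h w → :- (z :* h :+ w) := (:- z) :* h :+ :- w) ≈-refl (ι (fromℤ z)) h₀ w)
            (+-congʳ (*-congʳ (≈-sym (≈-trans (ι-cong (fromℤ-homo‿- z)) (ι-neg (fromℤ z))))))) }
      }) λ i → k i , g′ i , generator g′ i ,
        solve 2 (λ g z → g := z :+ (g :- z)) ≈-refl (g i) (ι (fromℤ (k i)) * h₀)

    f₀-split : ∀ {x} z w → Span g′ w → x ≈ ι (fromℤ z) * h₀ + w → f zero $ x ≡ fromℤ z ℚ.* t
    f₀-split z w w∈ x≈ = trans (F₀.⟦⟧-cong x≈) (trans (F₀.⟦⟧-+ _ w) (trans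
      (cong₂ ℚ._+_ (trans (F₀.⟦⟧-* (fromℤ z) h₀) (cong (fromℤ z ℚ.*_) f₀h₀≡t)) (f₀g′≡0 w∈))
      (ℚ.+-identityʳ (fromℤ z ℚ.* t))))

    reduction : Reduction (f ∘ suc) g′ → Reduction f g
    reduction R = record
      { reduced     = h₀ ∷ R.reduced
      ; reduced∈    = λ { zero → h₀∈ ; (suc i) → g′⊆ (R.reduced∈ i) }
      ; decompose   = λ {x} x∈ →
          let z₀ , w , w∈ , x≈ = split x∈
              z , y , y∈ , fy≡0 , w≈ = R.decompose w∈
          in (z₀ ∷ z) , y , g′⊆ y∈ , (λ { zero → f₀g′≡0 y∈ ; (suc i) → fy≡0 i }) , (begin
               x                                                           ≈⟨ x≈ ⟩
               ι (fromℤ z₀) * h₀ + w                                       ≈⟨ +-congˡ w≈ ⟩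
               ι (fromℤ z₀) * h₀ + (lc (fromℤ ∘ z) R.reduced + y)          ≈⟨ +-assoc _ _ y ⟨
               ι (fromℤ z₀) * h₀ + lc (fromℤ ∘ z) R.reduced + y            ∎)
      ; independent = independent
      }
      where
      module R = Reduction R

      independent : ∀ (e : Vector Carrier (suc r)) → (∀ i → Span g (e i)) →
                    (∀ i j → j Fin.< i → f j $ e i ≡ 0ℚ) → (∀ i → f i $ e i ≢ 0ℚ) →
                    ∀ (q : Vector ℚ (suc r)) y → Kernel f y → lc q (h₀ ∷ R.reduced) + y ≈ 0# → ∀ i → q i ≡ 0ℚ
      independent e e∈ triangular diagonal q y fy≡0 eq = λ
        { zero    → q₀≡0
        ; (suc i) → R.independent (e ∘ suc) e′∈ (λ i j j<i → triangular (suc i) (suc j) (ℕ.s≤s j<i)) (diagonal ∘ suc)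
                      (q ∘ suc) y (fy≡0 ∘ suc) eq′ i }
        where
        t≢0 : t ≢ 0ℚ
        t≢0 t≡0 =
          let z , w , w∈ , e≈ = split (e∈ zero)
          in diagonal zero (trans (f₀-split z w w∈ e≈) (trans (cong (fromℤ z ℚ.*_) t≡0) (ℚ.*-zeroʳ (fromℤ z))))

        -- The later `e` are killed by `f zero`. As `t` is nonzero, their coefficient at `h₀`
        -- vanishes and they lie in the smaller span.
        e′∈ : ∀ i → Span g′ (e (suc i))
        e′∈ i =
          let z , w , w∈ , e≈ = split (e∈ (suc i))
              z≡0 = *-cancel-0 t≢0 (trans (ℚ.*-comm t (fromℤ z)) (trans (sym (f₀-split z w w∈ e≈)) (triangular (suc i) zero (ℕ.s≤s ℕ.z≤n))))
          in S′.resp (≈-sym (≈-trans e≈ (≈-trans (+-congʳ (≈-trans (*-congʳ (ι-cong z≡0)) (≈-sym (0≈0*x h₀)))) (+-identityˡ w)))) w∈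

        -- Applying `f zero` to the relation leaves only the multiple of `h₀`.
        q₀≡0 : q zero ≡ 0ℚ
        q₀≡0 = *-cancel-0 t≢0 (P.begin
          t ℚ.* q zero                                                             P.≡⟨ Q.solve 2 (λ t q → t Q.:* q Q.:= q Q.:* t Q.:+ Q.con 0ℚ Q.:+ Q.con 0ℚ) refl t (q zero) ⟩
          q zero ℚ.* t ℚ.+ 0ℚ ℚ.+ 0ℚ                                               P.≡⟨ cong₂ (λ a b → q zero ℚ.* a ℚ.+ b ℚ.+ 0ℚ) (sym f₀h₀≡t) (sym rest≡0) ⟩
          q zero ℚ.* (f zero $ h₀) ℚ.+ sumℚ (λ i → q (suc i) ℚ.* (f zero $ R.reduced i)) ℚ.+ 0ℚ  P.≡⟨ cong₂ ℚ._+_ (sym (F₀.⟦⟧-lc q (h₀ ∷ R.reduced))) (sym (fy≡0 zero)) ⟩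
          (f zero $ lc q (h₀ ∷ R.reduced)) ℚ.+ (f zero $ y)                        P.≡⟨ F₀.⟦⟧-+ _ y ⟨
          f zero $ (lc q (h₀ ∷ R.reduced) + y)                                     P.≡⟨ F₀.⟦⟧-0 eq ⟩
          0ℚ                                                                       P.∎)
          where
          module P = ≡-Reasoning
          module Q = ℚSolver.+-*-Solver
          rest≡0 : sumℚ (λ i → q (suc i) ℚ.* (f zero $ R.reduced i)) ≡ 0ℚ
          rest≡0 = sum-zero _ λ i → trans (cong (q (suc i) ℚ.*_) (f₀g′≡0 (R.reduced∈ i))) (ℚ.*-zeroʳ (q (suc i)))

        eq′ : lc (q ∘ suc) R.reduced + y ≈ 0#
        eq′ = begin
          lc (q ∘ suc) R.reduced + y                     ≈⟨ +-congʳ (+-identityˡ _) ⟨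
          0# + lc (q ∘ suc) R.reduced + y                ≈⟨ +-congʳ (+-congʳ (≈-trans (0≈0*x h₀) (*-congʳ (ι-cong (sym q₀≡0))))) ⟩
          ι (q zero) * h₀ + lc (q ∘ suc) R.reduced + y   ≈⟨ eq ⟩
          0#                                             ∎

  -- Each functional in turn takes a cyclic group of values on the span; a preimage of a generator
  -- splits off, and the kernel is again finitely generated.
  reduce : ∀ {r m} (f : Fin r → LinearFunctional) (g : Vector Carrier m) → Reduction f g
  reduce {zero} f g = record
    { reduced     = λ ()
    ; reduced∈    = λ ()
    ; decompose   = λ {x} x∈ → (λ ()) , x , x∈ , (λ ()) , ≈-sym (+-identityˡ x)
    ; independent = λ _ _ _ _ _ _ _ _ ()
    }
  reduce {suc r} f g =
    let t , (u , t≡) , (k , fg≡) = cyclic (λ i → f zero $ g i)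
    in ReductionStep.reduction f g t u k t≡ fg≡ (reduce (f ∘ suc) (ReductionStep.g′ f g t u k t≡ fg≡))

  -- The trace

  trace : LinearFunctional
  trace = record
    { ⟦_⟧     = Tr K
    ; ⟦⟧-cong = λ x≈y → Sumℚ.sum-cong-≋ λ i → ⟦⟧-cong (coordinate i) (*-congʳ x≈y)
    ; ⟦⟧-+    = λ x y → trans (Sumℚ.sum-cong-≋ λ i → trans (⟦⟧-cong (coordinate i) (distribʳ (basis i) x y)) (⟦⟧-+ (coordinate i) (x * basis i) (y * basis i)))
        (Sumℚ.∑-distrib-+ (λ i → coordinates (x * basis i) i) (λ i → coordinates (y * basis i) i))
    ; ⟦⟧-*    = λ q x → trans (Sumℚ.sum-cong-≋ λ i → trans (⟦⟧-cong (coordinate i) (*-assoc (ι q) x (basis i))) (⟦⟧-* (coordinate i) q (x * basis i)))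
        (sym (Sumℚ.*-distribˡ-sum q (λ i → coordinates (x * basis i) i)))
    }
    where open LinearFunctional

  -- An instance of tr (AB) = tr (BA): expanding `basis` through `ω` on one side and the products
  -- with `ω` through `basis` on the other gives the same double sum.
  trace-change : ∀ {m} (ω : Vector Carrier m) (φ : Fin m → LinearFunctional) →
                 (∀ x → x ≈ lc (λ j → φ j $ x) ω) → ∀ x → Tr K x ≡ sumℚ (λ j → φ j $ (x * ω j))
  trace-change ω φ expand x = P.begin
    sumℚ (λ i → coordinates (x * basis i) i)
      P.≡⟨ Sumℚ.sum-cong-≋ (λ i → trans
             (⟦⟧-cong (coordinate i) (≈-trans (*-congˡ (expand (basis i))) (*-lc x (λ j → φ j $ basis i) ω)))
             (⟦⟧-lc (coordinate i) (λ j → φ j $ basis i) (λ j → x * ω j))) ⟩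
    sumℚ (λ i → sumℚ (λ j → (φ j $ basis i) ℚ.* coordinates (x * ω j) i))
      P.≡⟨ Sumℚ.∑-comm (λ i j → (φ j $ basis i) ℚ.* coordinates (x * ω j) i) ⟩
    sumℚ (λ j → sumℚ (λ i → (φ j $ basis i) ℚ.* coordinates (x * ω j) i))
      P.≡⟨ Sumℚ.sum-cong-≋ (λ j → trans
             (⟦⟧-cong (φ j) (basis-spanning (x * ω j)))
             (trans (⟦⟧-lc (φ j) (coordinates (x * ω j)) basis)
                    (Sumℚ.sum-cong-≋ λ i → ℚ.*-comm (coordinates (x * ω j) i) (φ j $ basis i)))) ⟨
    sumℚ (λ j → φ j $ (x * ω j))
      P.∎
    where
    open LinearFunctional
    module P = ≡-Reasoning

  linearCombination : ∀ {m} → Vector ℚ m → (Fin m → LinearFunctional) → LinearFunctional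
  linearCombination c f = record
    { ⟦_⟧     = λ x → sumℚ (λ i → c i ℚ.* (f i $ x))
    ; ⟦⟧-cong = λ x≈y → Sumℚ.sum-cong-≋ λ i → cong (c i ℚ.*_) (⟦⟧-cong (f i) x≈y)
    ; ⟦⟧-+    = λ x y → trans (Sumℚ.sum-cong-≋ λ i → trans (cong (c i ℚ.*_) (⟦⟧-+ (f i) x y)) (ℚ.*-distribˡ-+ (c i) (f i $ x) (f i $ y)))
        (Sumℚ.∑-distrib-+ (λ i → c i ℚ.* (f i $ x)) (λ i → c i ℚ.* (f i $ y)))
    ; ⟦⟧-*    = λ q x → trans (Sumℚ.sum-cong-≋ λ i → trans (cong (c i ℚ.*_) (⟦⟧-* (f i) q x))
          (solve 3 (λ c q y → c :* (q :* y) := q :* (c :* y)) refl (c i) q (f i $ x)))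
        (sym (Sumℚ.*-distribˡ-sum q (λ i → c i ℚ.* (f i $ x))))
    }
    where
    open LinearFunctional
    open ℚSolver.+-*-Solver using (solve; _:*_; _:=_)

  lc-lc : ∀ {l m} (q : Vector ℚ l) (P : Fin l → Vector ℚ m) (g : Vector Carrier m) →
          lc q (λ i → lc (P i) g) ≈ lc (λ j → sumℚ (λ i → P i j ℚ.* q i)) g
  lc-lc {zero}  q P g = ≈-sym (lc-zero _ g λ _ → refl)
  lc-lc {suc l} q P g = ≈-trans (+-cong
      (≈-trans (≈-sym (lc-scale (q zero) (P zero) g)) (lc-cong (λ j → ℚ.*-comm (q zero) (P zero j)) (λ _ → ≈-refl)))
      (lc-lc (q ∘ suc) (P ∘ suc) g))
    (≈-sym (lc-+ (λ j → P zero j ℚ.* q zero) _ g))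

  coordinates-basis : ∀ i j → coordinates (basis i) j ≡ fromℤ (δ i j)
  coordinates-basis i = coordinates-unique (basis i) (fromℤ ∘ δ i) (≈-sym (lc-δ i basis))

  -- The products of a stable family with `basis` generate a lattice that spans `K` and is stable
  -- under `x`. In a ℤ-basis `ω` of this lattice multiplication by `x` has an integer matrix, and
  -- `trace-change` computes the trace there.
  trace-integral : ∀ {x} → x ∈ 𝓞 K → IsInteger (Tr K x)
  trace-integral {x} x∈ = conclude (integral⇒stable x∈)
    where
    conclude : (∃ λ m → Σ (Vector Carrier m) λ g → Span g 1# × Stabilises x g) → IsInteger (Tr K x)
    conclude (m , g , 1∈ , stable) = subst IsInteger (sym (trace-change ω φ expand x))
        (integer-sum _ λ j → let z , eq = coordinate-vector (stabilises-span {g = G} G-stable (R.reduced∈ j))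
          in z j , lc-injective {g = ω} ω-independent (λ k → φ k $ (x * ω j)) (fromℤ ∘ z) (≈-trans (≈-sym (expand (x * ω j))) eq) j)
      where
      G = g ⊗ basis
      G-stable : Stabilises x G
      G-stable = ⊗-stabilisesˡ {g = g} {basis} stable

      module R = Reduction (reduce coordinate G)
      ω = R.reduced

      coordinate-vector : ∀ {y} → Span G y → Σ (Vector ℤ n) λ z → y ≈ lc (fromℤ ∘ z) ω
      coordinate-vector y∈ =
        let z , w , _ , kernel , y≈ = R.decompose y∈
        in z , ≈-trans y≈ (≈-trans (+-congˡ (coordinates-≡0⇒≈0 w kernel)) (+-identityʳ _))

      basis∈ : ∀ i → Span G (basis i)
      basis∈ i = IsSubgroup.resp (span-isSubgroup G) (*-identityˡ (basis i)) (⊗-∈ {g = g} {basis} 1∈ (generator basis i))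

      -- The given basis is the triangular witness: its coordinates form the identity matrix.
      ω-independent : Independent ω
      ω-independent q eq = R.independent basis basis∈
        (λ i j j<i → trans (coordinates-basis i j) (cong fromℤ (δ-off-diagonal λ i≡j → ℕ.<-irrefl (cong toℕ (sym i≡j)) j<i)))
        (λ i eq → fromℤ-≢0 {ℤ.1ℤ} (λ ()) (trans (cong fromℤ (sym (δ-diagonal i))) (trans (sym (coordinates-basis i i)) eq)))
        q 0# (λ i → LinearFunctional.⟦⟧-0 (coordinate i) ≈-refl) (≈-trans (+-identityʳ _) eq)

      P : Fin n → Vector ℤ n
      P i = proj₁ (coordinate-vector (basis∈ i))

      φ : Fin n → LinearFunctional
      φ j = linearCombination (λ i → fromℤ (P i j)) coordinate

      expand : ∀ y → y ≈ lc (λ j → φ j $ y) ω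
      expand y = ≈-trans (basis-spanning y) (≈-trans
        (lc-cong (λ _ → refl) (λ i → proj₂ (coordinate-vector (basis∈ i))))
        (lc-lc (coordinates y) (λ i → fromℤ ∘ P i) ω))

  trace-1 : n ≢ 0 → Tr K 1# ≢ 0ℚ
  trace-1 n≢0 eq = fromℤ-≢0 {+ n} (λ { refl → n≢0 refl }) (trans (sym (ones n)) (trans (sym diagonal) eq))
    where
    ones : ∀ m → sumℚ {m} (λ _ → 1ℚ) ≡ fromℕ m
    ones zero    = refl
    ones (suc m) = trans (cong (1ℚ ℚ.+_) (ones m)) (sym (fromℤ-homo-+ ℤ.1ℤ (+ m)))

    diagonal : Tr K 1# ≡ sumℚ {n} (λ _ → 1ℚ)
    diagonal = Sumℚ.sum-cong-≋ λ i → trans (LinearFunctional.⟦⟧-cong (coordinate i) (*-identityˡ (basis i)))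
      (trans (coordinates-basis i i) (cong fromℤ (δ-diagonal i)))

  -- A nonzero `x` is tested against its inverse: the trace of `1#` is `n`, which is nonzero in ℚ.
  trace-nondegenerate : n ≢ 0 → ∀ x → (∀ y → Tr K (x * y) ≡ 0ℚ) → x ≈ 0#
  trace-nondegenerate n≢0 x Txy≡0 with Fin.all? (λ i → coordinates x i ℚ.≟ 0ℚ)
  ... | yes x≡0 = coordinates-≡0⇒≈0 x x≡0
  ... | no  x≢0 =
    let y , _ , xy≈1 = invertible x (λ x≈0 → x≢0 (λ i → LinearFunctional.⟦⟧-0 (coordinate i) x≈0))
    in contradiction (trans (LinearFunctional.⟦⟧-cong trace (≈-sym xy≈1)) (Txy≡0 y)) (trace-1 n≢0)

  traceMatrix : ∀ {m} → Vector Carrier m → Matrix m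
  traceMatrix ω i j = Tr K (ω i * ω j)

  -- A kernel vector `w` is the coefficient vector of an element orthogonal to every `ω j`, hence to
  -- all of `K`.
  traceMatrix-trivialKernel : n ≢ 0 → ∀ {m} (ω : Vector Carrier m) → Independent ω →
                              (∀ y → Σ (Vector ℚ m) λ q → y ≈ lc q ω) → TrivialLeftKernel (traceMatrix ω)
  traceMatrix-trivialKernel n≢0 ω independent spanning w wT≡0 =
    independent w (trace-nondegenerate n≢0 x λ y →
      let q , y≈ = spanning y
      in trans (⟦⟧-cong (≈-trans (*-congˡ y≈) (*-lc x q ω)))
         (trans (⟦⟧-lc q (λ j → x * ω j)) (sum-zero _ λ j → trans (cong (q j ℚ.*_) (Txω≡0 j)) (ℚ.*-zeroʳ (q j)))))
    where
    open LinearFunctional trace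
    x = lc w ω

    Txω≡0 : ∀ j → Tr K (x * ω j) ≡ 0ℚ
    Txω≡0 j = trans (⟦⟧-cong (≈-trans (*-comm x (ω j)) (≈-trans (*-lc (ω j) w ω) (lc-cong (λ _ → refl) (λ i → *-comm (ω j) (ω i))))))
      (trans (⟦⟧-lc w (λ i → ω i * ω j)) (wT≡0 j))

-- Up to double negation an integral basis exists, with a discriminant bounded in advance.

commonDenominator₂ : ∀ {l m} (q : Fin l → Vector ℚ m) → ∃ λ M → M ≢ ℤ.0ℤ × ∀ i j → IsInteger (fromℤ M ℚ.* q i j)
commonDenominator₂ {l} {m} q =
  let M , M≢0 , clears = commonDenominator (λ k → q (Fin.quotient m k) (Fin.remainder {l} m k))
  in M , M≢0 , λ i j → subst (λ (i′ , j′) → IsInteger (fromℤ M ℚ.* q i′ j′)) (Fin.remQuot-combine i j) (clears (Fin.combine i j))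

boundOnSubsets : ∀ {m} (f : Vec Bool m → ℕ) → ∃ λ U → ∀ S → f S ℕ.≤ U
boundOnSubsets {zero}  f = f Vec.[] , λ { Vec.[] → ℕ.≤-refl }
boundOnSubsets {suc m} f =
  let U , f≤U = boundOnSubsets (f ∘ (true Vec.∷_))
      V , f≤V = boundOnSubsets (f ∘ (false Vec.∷_))
  in U ℕ.⊔ V , λ { (true Vec.∷ S) → ℕ.≤-trans (f≤U S) (ℕ.m≤m⊔n U V) ; (false Vec.∷ S) → ℕ.≤-trans (f≤V S) (ℕ.m≤n⊔m U V) }

Decides : ∀ {m} → Vec Bool m → (Fin m → Set) → Set
Decides S P = ∀ i → (Vec.lookup S i ≡ true → P i) × (P i → Vec.lookup S i ≡ true)

-- Excluded middle is available under double negation for finitely many propositions at once. It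
-- will be applied to the integrality of the class representatives.
¬¬-decides : ∀ {m} (P : Fin m → Set) → ¬ ¬ (∃ λ S → Decides S P)
¬¬-decides {zero}  P ¬S = ¬S (Vec.[] , λ ())
¬¬-decides {suc m} P ¬S = ¬¬-decides (P ∘ suc) λ { (S , S-decides) →
  let ¬P₀ = λ p → ¬S (true Vec.∷ S , λ { zero → (λ _ → p) , (λ _ → refl) ; (suc i) → S-decides i })
  in ¬S (false Vec.∷ S , λ { zero → (λ ()) , (λ p → contradiction p ¬P₀) ; (suc i) → S-decides i }) }

signed-abs : ∀ z → ∃ λ s → + ∣ z ∣ ≡ s ℤ.* z
signed-abs (+ k)      = ℤ.1ℤ , sym (ℤ.*-identityˡ (+ k))
signed-abs (-[1+ k ]) = ℤ.-1ℤ , sym (ℤ.-1*i≡-i -[1+ k ])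

module IntegralBasis {r : ℕ} (K : NumberField (suc r)) where
  open Lattices K public
  open SetoidReasoning setoid

  n : ℕ
  n = suc r

  functional-ext : ∀ f g → (∀ i → f $ basis i ≡ g $ basis i) → ∀ x → f $ x ≡ g $ x
  functional-ext f g eq x = trans (F.⟦⟧-cong (basis-spanning x)) (trans (F.⟦⟧-lc (coordinates x) basis)
    (trans (Sumℚ.sum-cong-≋ λ i → cong (coordinates x i ℚ.*_) (eq i))
    (trans (sym (G.⟦⟧-lc (coordinates x) basis)) (sym (G.⟦⟧-cong (basis-spanning x))))))
    where
    module F = LinearFunctional f
    module G = LinearFunctional g

  abstract
    structureDenominator : ∃ λ M → M ≢ ℤ.0ℤ × ∀ i j k → IsInteger (fromℤ M ℚ.* coordinates (basis i * basis j) k)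
    structureDenominator =
      let M , M≢0 , clears = commonDenominator₂ (λ k → coordinates (basis (Fin.quotient n k) * basis (Fin.remainder {n} n k)))
      in M , M≢0 , λ i j k → subst (λ (i′ , j′) → IsInteger (fromℤ M ℚ.* coordinates (basis i′ * basis j′) k)) (Fin.remQuot-combine i j) (clears (Fin.combine i j) k)

  M : ℤ
  M = proj₁ structureDenominator

  M≢0 : fromℤ M ≢ 0ℚ
  M≢0 = fromℤ-≢0 (proj₁ (proj₂ structureDenominator))

  -- The lower lattice. After scaling by `M` the structure constants are integers, so the span of
  -- `β` is closed under multiplication, which makes each `β i` integral.
  β : Vector Carrier n
  β i = ι (fromℤ M) * basis i

  β*β∈ : ∀ i j → Span β (β i * β j)
  β*β∈ i j = z , (begin
    ι m * basis i * (ι m * basis j)            ≈⟨ solve 3 (λ m b c → m :* b :* (m :* c) := m :* (m :* (b :* c))) ≈-refl (ι m) (basis i) (basis j) ⟩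
    ι m * (ι m * (basis i * basis j))          ≈⟨ *-congˡ (*-congˡ (basis-spanning (basis i * basis j))) ⟩
    ι m * (ι m * lc c basis)                   ≈⟨ *-congˡ (lc-scale m c basis) ⟨
    ι m * lc (λ k → m ℚ.* c k) basis           ≈⟨ *-lc (ι m) (λ k → m ℚ.* c k) basis ⟩
    lc (λ k → m ℚ.* c k) β                     ≈⟨ lc-congˡ β (λ k → proj₂ (proj₂ (proj₂ structureDenominator) i j k)) ⟩
    lc (fromℤ ∘ z) β                           ∎)
    where
    open KSolver
    m = fromℤ M
    c = coordinates (basis i * basis j)
    z : Vector ℤ n
    z k = proj₁ (proj₂ (proj₂ structureDenominator) i j k)

  β∈𝓞 : ∀ i → β i ∈ 𝓞 K
  β∈𝓞 i = stable⇒integral g (generator g zero) λ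
    { zero    → IsSubgroup.resp (span-isSubgroup g) (≈-sym (*-identityʳ (β i))) (generator g (suc i))
    ; (suc j) → span-minimal (span-isSubgroup g) (λ k → generator g (suc k)) (β*β∈ i j) }
    where
    g : Vector Carrier (suc n)
    g = 1# ∷ β

  abstract
    -- The coefficients of the dual basis for the trace form: with them the k-th coordinate becomes
    -- a combination of traces against `basis`.
    dual : ∀ k → Σ (Vector ℚ n) λ s → ∀ i → sumℚ (λ j → Tr K (basis i * basis j) ℚ.* s j) ≡ coordinates (basis i) k
    dual k = proj₂ (nondegenerate (traceMatrix basis)
      (traceMatrix-trivialKernel (λ ()) basis basis-independent λ y → coordinates y , basis-spanning y))
      (λ i → coordinates (basis i) k)

  traceAgainst : Carrier → LinearFunctional
  traceAgainst y = record
    { ⟦_⟧     = λ x → Tr K (y * x)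
    ; ⟦⟧-cong = λ eq → ⟦⟧-cong (*-congˡ eq)
    ; ⟦⟧-+    = λ x x′ → trans (⟦⟧-cong (distribˡ y x x′)) (⟦⟧-+ (y * x) (y * x′))
    ; ⟦⟧-*    = λ q x → trans (⟦⟧-cong (solve 3 (λ y q x → y :* (q :* x) := q :* (y :* x)) ≈-refl y (ι q) x)) (⟦⟧-* q (y * x))
    }
    where
    open LinearFunctional trace
    open KSolver hiding (⟦_⟧)

  coordinate-dual : ∀ k x → coordinates x k ≡ sumℚ (λ j → proj₁ (dual k) j ℚ.* Tr K (basis j * x))
  coordinate-dual k = functional-ext (coordinate k) (linearCombination (proj₁ (dual k)) (λ j → traceAgainst (basis j))) λ i →
    trans (sym (proj₂ (dual k) i)) (Sumℚ.sum-cong-≋ λ j →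
      trans (ℚ.*-comm _ (proj₁ (dual k) j)) (cong (proj₁ (dual k) j ℚ.*_) (LinearFunctional.⟦⟧-cong trace (*-comm (basis i) (basis j)))))

  abstract
    -- The upper lattice. For integral x the products `β j` x are integral and have integer traces;
    -- the k-th coordinate of x is a combination of these traces whose coefficients have
    -- denominators clearing to `N` and `M`.
    integral-denominator : ∃ λ Δ → Δ ≢ ℤ.0ℤ × ∀ {x} → x ∈ 𝓞 K → ∀ k → IsInteger (fromℤ Δ ℚ.* coordinates x k)
    integral-denominator =
      let N , N≢0 , clears = commonDenominator₂ (λ k → proj₁ (dual k))
      in N ℤ.* M , (λ eq → *-≢0 (fromℤ-≢0 N≢0) M≢0 (trans (sym (fromℤ-homo-* N M)) (cong fromℤ eq))) , λ {x} x∈ k →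
         subst IsInteger (sym (identity N x k)) (integer-sum _ λ j →
           integer-* (clears k j) (trace-integral (integral-K-* (β∈𝓞 j) x∈)))
      where
      open LinearFunctional trace
      open ℚSolver.+-*-Solver using (solve; _:*_; _:=_)

      identity : ∀ N x k → fromℤ (N ℤ.* M) ℚ.* coordinates x k ≡
                 sumℚ (λ j → fromℤ N ℚ.* proj₁ (dual k) j ℚ.* Tr K (β j * x))
      identity N x k = trans (cong₂ ℚ._*_ (fromℤ-homo-* N M) (coordinate-dual k x))
        (trans (Sumℚ.*-distribˡ-sum (fromℤ N ℚ.* fromℤ M) (λ j → proj₁ (dual k) j ℚ.* Tr K (basis j * x))) (Sumℚ.sum-cong-≋ λ j →
          trans (solve 4 (λ n m s t → n :* m :* (s :* t) := n :* s :* (m :* t)) refl (fromℤ N) (fromℤ M) (proj₁ (dual k) j) (Tr K (basis j * x)))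
          (cong (fromℤ N ℚ.* proj₁ (dual k) j ℚ.*_) (sym (trans (⟦⟧-cong (*-assoc (ι (fromℤ M)) (basis j) x)) (⟦⟧-* (fromℤ M) (basis j * x)))))))

  Δ : ℤ
  Δ = proj₁ integral-denominator

  Δ≢0 : fromℤ Δ ≢ 0ℚ
  Δ≢0 = fromℤ-≢0 (proj₁ (proj₂ integral-denominator))

  -- Coordinates of integral elements lie in ℤ divided by `Δ`, those of the span of `β` in multiples
  -- of `M`. The modulus counts the classes in each coordinate.
  modulus : ℕ
  modulus = ∣ Δ ℤ.* M ∣

  modulus≢0 : modulus ≢ 0
  modulus≢0 eq = *-≢0 Δ≢0 M≢0 (trans (sym (fromℤ-homo-* Δ M)) (cong fromℤ (ℤ.∣i∣≡0⇒i≡0 {Δ ℤ.* M} eq)))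

  #reps : ℕ
  #reps = modulus ℕ.^ n

  representative : Fin #reps → Carrier
  representative a = lc (λ i → inv (fromℤ Δ) Δ≢0 ℚ.* fromℤ (+ toℕ (Fin.finToFun {modulus} {n} a i))) basis

  reduceModβ : ∀ {x} → x ∈ 𝓞 K → ∃ λ a → Σ (Vector ℤ n) λ z → x ≈ representative a + lc (fromℤ ∘ z) β
  reduceModβ {x} x∈ = digits , z , (begin
    x                                                                ≈⟨ basis-spanning x ⟩
    lc (coordinates x) basis                                         ≈⟨ lc-congˡ basis coordinate≡ ⟩
    lc (λ i → p i ℚ.+ fromℤ (z i) ℚ.* fromℤ M) basis                 ≈⟨ lc-+ p (λ i → fromℤ (z i) ℚ.* fromℤ M) basis ⟩
    lc p basis + lc (λ i → fromℤ (z i) ℚ.* fromℤ M) basis            ≈⟨ +-congˡ (SumK.sum-cong-≋ λ i → ≈-trans (*-congʳ (ι-* (fromℤ (z i)) (fromℤ M))) (*-assoc (ι (fromℤ (z i))) (ι (fromℤ M)) (basis i))) ⟩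
    lc p basis + lc (fromℤ ∘ z) β                                    ∎)
    where
    instance
      modulus-nonZero : ℕ.NonZero modulus
      modulus-nonZero = ℕ.≢-nonZero modulus≢0

    A : Vector ℤ n
    A i = proj₁ (proj₂ (proj₂ integral-denominator) x∈ i)

    residue : Fin n → Fin modulus
    residue i = Fin.fromℕ< (ℤ.n%ℕd<d (A i) modulus)

    s : ℤ
    s = proj₁ (signed-abs (Δ ℤ.* M))

    digits : Fin #reps
    digits = Fin.funToFin residue

    -- The factor `s` undoes the absolute value taken in `modulus`.
    z : Vector ℤ n
    z i = (A i ℤ./ℕ modulus) ℤ.* s

    p : Vector ℚ n
    p i = inv (fromℤ Δ) Δ≢0 ℚ.* fromℤ (+ toℕ (Fin.finToFun digits i))

    A≡ : ∀ i → A i ≡ + toℕ (Fin.finToFun digits i) ℤ.+ (z i ℤ.* M) ℤ.* Δ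
    A≡ i = trans (ℤ.a≡a%ℕn+[a/ℕn]*n (A i) modulus) (cong₂ ℤ._+_
      (cong +_ (sym (trans (cong toℕ (Fin.finToFun-funToFin residue i)) (Fin.toℕ-fromℕ< (ℤ.n%ℕd<d (A i) modulus)))))
      (trans (cong (A i ℤ./ℕ modulus ℤ.*_) (proj₂ (signed-abs (Δ ℤ.* M))))
        (solve 4 (λ q s d m → q :* (s :* (d :* m)) := q :* s :* m :* d) refl (A i ℤ./ℕ modulus) s Δ M)))
      where open ℤSolver.+-*-Solver

    coordinate≡ : ∀ i → coordinates x i ≡ p i ℚ.+ fromℤ (z i) ℚ.* fromℤ M
    coordinate≡ i = divide (fromℤ Δ) (inv (fromℤ Δ) Δ≢0) (coordinates x i) (fromℤ (+ toℕ (Fin.finToFun digits i))) (fromℤ (z i)) (fromℤ M)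
      (*-inv (fromℤ Δ) Δ≢0)
      (trans (proj₂ (proj₂ (proj₂ integral-denominator) x∈ i)) (trans (cong fromℤ (A≡ i))
        (trans (fromℤ-homo-+ (+ toℕ (Fin.finToFun digits i)) ((z i ℤ.* M) ℤ.* Δ)) (cong (fromℤ (+ toℕ (Fin.finToFun digits i)) ℚ.+_)
          (trans (fromℤ-homo-* (z i ℤ.* M) Δ) (cong (ℚ._* fromℤ Δ) (fromℤ-homo-* (z i) M)))))))
      where
      divide : ∀ d d⁻¹ x a z m → d ℚ.* d⁻¹ ≡ 1ℚ → d ℚ.* x ≡ a ℚ.+ z ℚ.* m ℚ.* d → x ≡ d⁻¹ ℚ.* a ℚ.+ z ℚ.* m
      divide d d⁻¹ x a z m dd⁻¹ eq = P.begin
        x                                     P.≡⟨ ℚ.*-identityˡ x ⟨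
        1ℚ ℚ.* x                              P.≡⟨ cong (ℚ._* x) dd⁻¹ ⟨
        d ℚ.* d⁻¹ ℚ.* x                       P.≡⟨ solve 3 (λ d e x → d :* e :* x := e :* (d :* x)) refl d d⁻¹ x ⟩
        d⁻¹ ℚ.* (d ℚ.* x)                     P.≡⟨ cong (d⁻¹ ℚ.*_) eq ⟩
        d⁻¹ ℚ.* (a ℚ.+ z ℚ.* m ℚ.* d)         P.≡⟨ solve 5 (λ d e a z m → e :* (a :+ z :* m :* d) := e :* a :+ z :* m :* (d :* e)) refl d d⁻¹ a z m ⟩
        d⁻¹ ℚ.* a ℚ.+ z ℚ.* m ℚ.* (d ℚ.* d⁻¹) P.≡⟨ cong (λ w → d⁻¹ ℚ.* a ℚ.+ z ℚ.* m ℚ.* w) dd⁻¹ ⟩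
        d⁻¹ ℚ.* a ℚ.+ z ℚ.* m ℚ.* 1ℚ          P.≡⟨ cong (d⁻¹ ℚ.* a ℚ.+_) (ℚ.*-identityʳ (z ℚ.* m)) ⟩
        d⁻¹ ℚ.* a ℚ.+ z ℚ.* m                 P.∎
        where
        module P = ≡-Reasoning
        open ℚSolver.+-*-Solver

  -- Functionals whose common kernel is ι ℚ

  abstract
    pivot : ∃ λ k → coordinates 1# k ≢ 0ℚ
    pivot = Fin.¬∀⟶∃¬ n (λ k → coordinates 1# k ≡ 0ℚ) (λ k → coordinates 1# k ℚ.≟ 0ℚ)
      (λ 1≡0 → 0≉1 (≈-sym (coordinates-≡0⇒≈0 1# 1≡0)))

  k₀ : Fin n
  k₀ = proj₁ pivot

  ratio : Fin r → ℚ
  ratio i = coordinates 1# (punchIn k₀ i) ℚ.* inv (coordinates 1# k₀) (proj₂ pivot)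

  -- From every coordinate other than the pivot, the share coming from `1#` is subtracted, as
  -- measured by the pivot coordinate. This makes the functional vanish on rational multiples of
  -- `1#`.
  transversal : Fin r → LinearFunctional
  transversal i = linearCombination (1ℚ ∷ (ℚ.- ratio i ∷ [])) (coordinate (punchIn k₀ i) ∷ (coordinate k₀ ∷ []))

  transversal≡ : ∀ i x → transversal i $ x ≡ coordinates x (punchIn k₀ i) ℚ.- ratio i ℚ.* coordinates x k₀
  transversal≡ i x = solve 3 (λ a r b → con 1ℚ :* a :+ (:- r :* b :+ con 0ℚ) := a :- r :* b) refl
    (coordinates x (punchIn k₀ i)) (ratio i) (coordinates x k₀)
    where open ℚSolver.+-*-Solver

  kernel⇒rational : ∀ {x} → Kernel transversal x → ∃ λ q → x ≈ ι q
  kernel⇒rational {x} fx≡0 = q , (begin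
    x                                          ≈⟨ basis-spanning x ⟩
    lc (coordinates x) basis                   ≈⟨ lc-congˡ basis proportional ⟩
    lc (λ i → q ℚ.* coordinates 1# i) basis    ≈⟨ lc-scale q (coordinates 1#) basis ⟩
    ι q * lc (coordinates 1#) basis            ≈⟨ *-congˡ (basis-spanning 1#) ⟨
    ι q * 1#                                   ≈⟨ *-identityʳ (ι q) ⟩
    ι q                                        ∎)
    where
    open ℚSolver.+-*-Solver
    c⁻¹ = inv (coordinates 1# k₀) (proj₂ pivot)
    q = coordinates x k₀ ℚ.* c⁻¹

    proportional : ∀ i → coordinates x i ≡ q ℚ.* coordinates 1# i
    proportional i = cases (k₀ Fin.≟ i)
      where
      cases : Dec (k₀ ≡ i) → coordinates x i ≡ q ℚ.* coordinates 1# i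
      cases (yes refl) = trans (sym (ℚ.*-identityʳ (coordinates x i))) (trans (cong (coordinates x i ℚ.*_) (sym (*-inv (coordinates 1# k₀) (proj₂ pivot))))
        (solve 3 (λ x c d → x :* (c :* d) := x :* d :* c) refl (coordinates x i) (coordinates 1# k₀) c⁻¹))
      cases (no k₀≢i) = subst (λ i → coordinates x i ≡ q ℚ.* coordinates 1# i) (Fin.punchIn-punchOut k₀≢i)
        (trans (solve 2 (λ a b → a := (a :- b) :+ b) refl (coordinates x (punchIn k₀ j)) (ratio j ℚ.* coordinates x k₀))
        (trans (cong (ℚ._+ ratio j ℚ.* coordinates x k₀) (trans (sym (transversal≡ j x)) (fx≡0 j)))
          (solve 3 (λ a d x → con 0ℚ :+ a :* d :* x := x :* d :* a) refl (coordinates 1# (punchIn k₀ j)) c⁻¹ (coordinates x k₀))))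
        where j = punchOut k₀≢i

  transversal-rational : ∀ q → Kernel transversal (ι q * 1#)
  transversal-rational q i = trans (⟦⟧-* (transversal i) q 1#) (trans (cong (q ℚ.*_) (trans (transversal≡ i 1#) cancel)) (ℚ.*-zeroʳ q))
    where
    open LinearFunctional
    open ℚSolver.+-*-Solver using (solve; _:*_; _:-_; _:=_; con)
    c = coordinates 1# k₀
    c⁻¹ = inv c (proj₂ pivot)
    a′ = coordinates 1# (punchIn k₀ i)

    cancel : a′ ℚ.- a′ ℚ.* c⁻¹ ℚ.* c ≡ 0ℚ
    cancel = trans (solve 3 (λ a d c → a :- a :* d :* c := a :* (con 1ℚ :- c :* d)) refl a′ c⁻¹ c)
      (trans (cong (λ w → a′ ℚ.* (1ℚ ℚ.- w)) (*-inv c (proj₂ pivot))) (ℚ.*-zeroʳ a′))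

  -- The values form `M` times the identity matrix, so these `β` provide the triangular family that
  -- `Reduction.independent` asks for.
  transversal-β : ∀ i j → transversal j $ β (punchIn k₀ i) ≡ fromℤ M ℚ.* fromℤ (δ (punchIn k₀ i) (punchIn k₀ j))
  transversal-β i j = trans (⟦⟧-* (transversal j) (fromℤ M) (basis (punchIn k₀ i))) (cong (fromℤ M ℚ.*_)
    (trans (transversal≡ j (basis (punchIn k₀ i))) (trans
      (cong₂ (λ a b → a ℚ.- ratio j ℚ.* b) (coordinates-basis (punchIn k₀ i) (punchIn k₀ j))
        (trans (coordinates-basis (punchIn k₀ i) k₀) (cong fromℤ (δ-off-diagonal (Fin.punchInᵢ≢i k₀ i)))))
      (solve 2 (λ a r → a :- r :* con 0ℚ := a) refl (fromℤ (δ (punchIn k₀ i) (punchIn k₀ j))) (ratio j)))))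
    where
    open LinearFunctional
    open ℚSolver.+-*-Solver using (solve; _:*_; _:-_; _:=_; con)

  rational-span : ∀ {m} (ω : Vector Carrier m) → (∀ i → Span ω (β i)) → ∀ y → Σ (Vector ℚ m) λ q → y ≈ lc q ω
  rational-span {m} ω β∈ y = combine (λ i → proj₁ (β∈ i)) (λ i → proj₂ (β∈ i))
    where
    M⁻¹ = inv (fromℤ M) M≢0

    combine : (z : Fin n → Vector ℤ m) → (∀ i → β i ≈ lc (fromℤ ∘ z i) ω) → Σ (Vector ℚ m) λ q → y ≈ lc q ω
    combine z β≈ = (λ j → sumℚ (λ i → M⁻¹ ℚ.* fromℤ (z i j) ℚ.* coordinates y i)) , (begin
      y                                                                              ≈⟨ basis-spanning y ⟩
      lc (coordinates y) basis                                                       ≈⟨ lc-cong {p = coordinates y} {g = basis} (λ _ → refl) basis≈ ⟩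
      lc (coordinates y) (λ i → lc (λ j → M⁻¹ ℚ.* fromℤ (z i j)) ω)                  ≈⟨ lc-lc (coordinates y) (λ i j → M⁻¹ ℚ.* fromℤ (z i j)) ω ⟩
      lc (λ j → sumℚ (λ i → M⁻¹ ℚ.* fromℤ (z i j) ℚ.* coordinates y i)) ω            ∎)
      where
      basis≈ : ∀ i → basis i ≈ lc (λ j → M⁻¹ ℚ.* fromℤ (z i j)) ω
      basis≈ i = begin
        basis i                                      ≈⟨ *-identityˡ _ ⟨
        1# * basis i                                 ≈⟨ *-congʳ ι-1 ⟨
        ι 1ℚ * basis i                               ≈⟨ *-congʳ (ι-cong (trans (ℚ.*-comm M⁻¹ (fromℤ M)) (*-inv (fromℤ M) M≢0))) ⟨
        ι (M⁻¹ ℚ.* fromℤ M) * basis i                ≈⟨ *-congʳ (ι-* M⁻¹ (fromℤ M)) ⟩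
        ι M⁻¹ * ι (fromℤ M) * basis i                ≈⟨ *-assoc _ _ _ ⟩
        ι M⁻¹ * β i                                  ≈⟨ *-congˡ (β≈ i) ⟩
        ι M⁻¹ * lc (fromℤ ∘ z i) ω                   ≈⟨ lc-scale M⁻¹ (fromℤ ∘ z i) ω ⟨
        lc (λ j → M⁻¹ ℚ.* fromℤ (z i j)) ω           ∎

  -- Everything up to `discriminant` makes sense for any selection `S`, right or wrong, so a bound
  -- over all selections can be computed. Only the part after it assumes that `S` picks exactly the
  -- integral representatives.
  module Candidate {N : ℕ} (representative : Vector Carrier N)
      (covering : ∀ {x} → x ∈ 𝓞 K → ∃ λ a → Σ (Vector ℤ n) λ z → x ≈ representative a + lc (fromℤ ∘ z) β)
      (S : Vec Bool N) where
    -- The default `0#` keeps the length of the generating family independent of `S` without adding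
    -- to its span.
    selected : Fin N → Carrier
    selected a = if Vec.lookup S a then representative a else 0#

    g : Vector Carrier (n ℕ.+ N)
    g = β ++ selected

    β∈ : ∀ i → Span g (β i)
    β∈ i = IsSubgroup.resp (span-isSubgroup g) (reflexive (cong (λ s → [ β , selected ]′ s) (Fin.splitAt-↑ˡ n i N))) (generator g (i Fin.↑ˡ N))

    selected∈ : ∀ a → Span g (selected a)
    selected∈ a = IsSubgroup.resp (span-isSubgroup g) (reflexive (cong (λ s → [ β , selected ]′ s) (Fin.splitAt-↑ʳ n N a))) (generator g (n Fin.↑ʳ a))

    module R = Reduction (reduce transversal g)

    ω : Vector Carrier n
    ω = 1# ∷ R.reduced

    ω-independent : Independent ω
    ω-independent q eq = λ { zero → q₀≡0 ; (suc i) → rest≡0 i }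
      where
      rest≡0 : ∀ i → q (suc i) ≡ 0ℚ
      rest≡0 = R.independent (λ i → β (punchIn k₀ i)) (λ i → β∈ (punchIn k₀ i))
        (λ i j j<i → trans (transversal-β i j) (trans (cong (λ z → fromℤ M ℚ.* fromℤ z)
          (δ-off-diagonal λ eq → ℕ.<-irrefl (cong toℕ (sym (Fin.punchIn-injective k₀ i j eq))) j<i)) (ℚ.*-zeroʳ (fromℤ M))))
        (λ i eq → M≢0 (trans (sym (ℚ.*-identityʳ (fromℤ M))) (trans (cong (λ z → fromℤ M ℚ.* fromℤ z) (sym (δ-diagonal (punchIn k₀ i)))) (trans (sym (transversal-β i i)) eq))))
        (q ∘ suc) (ι (q zero) * 1#) (transversal-rational (q zero))
        (≈-trans (+-comm _ _) eq)

      q₀≡0 : q zero ≡ 0ℚ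
      q₀≡0 = ι-injective-0 (begin
        ι (q zero)                                  ≈⟨ *-identityʳ _ ⟨
        ι (q zero) * 1#                             ≈⟨ +-identityʳ _ ⟨
        ι (q zero) * 1# + 0#                        ≈⟨ +-congˡ (lc-zero (q ∘ suc) R.reduced rest≡0) ⟨
        ι (q zero) * 1# + lc (q ∘ suc) R.reduced    ≈⟨ eq ⟩
        0#                                          ∎)

    discriminant : ℚ
    discriminant = det (traceMatrix ω)

    module _ (S-decides : Decides S (λ a → representative a ∈ 𝓞 K)) where
      g⊆𝓞 : ∀ {x} → Span g x → x ∈ 𝓞 K
      g⊆𝓞 = span-minimal 𝓞-isSubgroup λ i → cases (Fin.splitAt n i)
        where
        selected∈𝓞 : ∀ a b → (b ≡ true → representative a ∈ 𝓞 K) → (if b then representative a else 0#) ∈ 𝓞 K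
        selected∈𝓞 a true  p = p refl
        selected∈𝓞 a false p = IsSubgroup.0∈ 𝓞-isSubgroup

        cases : ∀ s → [ β , selected ]′ s ∈ 𝓞 K
        cases (inj₁ i) = β∈𝓞 i
        cases (inj₂ a) = selected∈𝓞 a (Vec.lookup S a) (proj₁ (S-decides a))

      -- The representative of the class of `x` differs from `x` by an element of the span of `β`.
      -- It is therefore integral, and so it was selected.
      𝓞⊆g : ∀ {x} → x ∈ 𝓞 K → Span g x
      𝓞⊆g {x} x∈ =
        let a , z , x≈ = covering x∈
            rep∈ = IsSubgroup.resp 𝓞-isSubgroup
              (≈-trans (+-congʳ x≈) (solve 2 (λ r l → (r :+ l) :- l := r) ≈-refl (representative a) (lc (fromℤ ∘ z) β)))
              (IsSubgroup.minus-closed 𝓞-isSubgroup x∈ (IsSubgroup.lc-closed 𝓞-isSubgroup z β β∈𝓞))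
        in S.resp (≈-sym x≈) (S.+-closed
             (S.resp (reflexive (cong (λ b → if b then representative a else 0#) (proj₂ (S-decides a) rep∈))) (selected∈ a))
             (S.lc-closed z β β∈))
        where
        module S = IsSubgroup (span-isSubgroup g)
        open KSolver

      -- The remainder of the reduction is killed by the transversals, hence rational. Being
      -- integral as well, it is an ordinary integer, that is, a multiple of the first basis vector
      -- `1#`.
      𝓞⊆ω : ∀ {x} → x ∈ 𝓞 K → Span ω x
      𝓞⊆ω {x} x∈ = assemble (R.decompose (𝓞⊆g x∈))
        where
        rational : ∀ {y} (z : Vector ℤ r) → x ≈ lc (fromℤ ∘ z) R.reduced + y → ∀ {q} → y ≈ ι q → IsInteger q → Span ω x
        rational {y} z x≈ {q} y≈ (z₀ , q≡) = (z₀ ∷ z) , (begin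
          x                                                      ≈⟨ x≈ ⟩
          lc (fromℤ ∘ z) R.reduced + y                           ≈⟨ +-comm (lc (fromℤ ∘ z) R.reduced) y ⟩
          y + lc (fromℤ ∘ z) R.reduced                           ≈⟨ +-congʳ y≈ ⟩
          ι q + lc (fromℤ ∘ z) R.reduced                         ≈⟨ +-congʳ (ι-cong q≡) ⟩
          ι (fromℤ z₀) + lc (fromℤ ∘ z) R.reduced                ≈⟨ +-congʳ (*-identityʳ (ι (fromℤ z₀))) ⟨
          ι (fromℤ z₀) * 1# + lc (fromℤ ∘ z) R.reduced           ∎)

        assemble : (Σ (Vector ℤ r) λ z → ∃ λ y → Span g y × Kernel transversal y × x ≈ lc (fromℤ ∘ z) R.reduced + y) → Span ω x
        assemble (z , y , y∈ , kernel , x≈) =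
          let q , y≈ = kernel⇒rational kernel
          in rational z x≈ y≈ (integral∩ℚ (coordinate k₀) (proj₂ pivot) {q} (integral-resp y≈ (g⊆𝓞 y∈)))

      ω-ℤ-independent : ∀ (z : Vector ℤ n) → lc (fromℤ ∘ z) ω ≈ 0# → ∀ i → z i ≡ ℤ.0ℤ
      ω-ℤ-independent z eq i = fromℤ-injective {z i} {ℤ.0ℤ} (ω-independent (fromℤ ∘ z) eq i)

      ω⊆𝓞 : ∀ i → ω i ∈ 𝓞 K
      ω⊆𝓞 zero    = 1∈𝓞
      ω⊆𝓞 (suc i) = g⊆𝓞 (R.reduced∈ i)

      isIntegralBasis : IsIntegralBasis K ω
      isIntegralBasis = record
        { integral    = ω⊆𝓞
        ; spanning    = 𝓞⊆ω
        ; independent = ω-ℤ-independent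
        }

      ω-spanning : ∀ y → Σ (Vector ℚ n) λ q → y ≈ lc q ω
      ω-spanning = rational-span ω λ i → 𝓞⊆ω (β∈𝓞 i)

      discriminant-integer : IsInteger discriminant
      discriminant-integer = det-integer (traceMatrix ω) λ i j →
        trace-integral (integral-K-* (integral i) (integral j))
        where open IsIntegralBasis isIntegralBasis using (integral)

      discriminant≢0 : discriminant ≢ 0ℚ
      discriminant≢0 = proj₁ (nondegenerate (traceMatrix ω)
        (traceMatrix-trivialKernel (λ ()) ω ω-independent ω-spanning))

  -- With `1#` as first basis vector, the orders built later can leave the first coordinate free and
  -- so contain ℤ.
  record UnitalIntegralBasis (U : ℕ) : Set where
    field
      ω               : Vector Carrier r
      isIntegralBasis : IsIntegralBasis K (1# ∷ ω)
      D               : ℤ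
      D≢0             : D ≢ ℤ.0ℤ
      ∣D∣≤U           : ∣ D ∣ ℕ.≤ U
      discriminant    : det (traceMatrix (1# ∷ ω)) ≡ fromℤ D

  ∣z∣≤∣↥z∣ : ∀ {q} z → q ≡ fromℤ z → ∣ z ∣ ℕ.≤ ∣ ℚ.↥ q ∣
  ∣z∣≤∣↥z∣ {q@(ℚ.mkℚ _ d _)} z q≡z = ℕ.≤-trans (ℕ.m≤m*n ∣ z ∣ (suc d)) (ℕ.≤-reflexive (trans (sym (ℤ.abs-* z (ℚ.↧ q)))
    (cong ∣_∣ (fromℤ-injective {z ℤ.* ℚ.↧ q} {ℚ.↥ q} (trans (fromℤ-homo-* z (ℚ.↧ q)) (trans (cong (ℚ._* fromℤ (ℚ.↧ q)) (sym q≡z)) (*-denominator q)))))))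

  -- `U` stands outside the double negation, being a maximum over all selections; only which
  -- selection is the right one stays undecided. It is taken over numerators because a wrong
  -- selection may have a fractional discriminant.
  integralBasis : ∃ λ U → ¬ ¬ UnitalIntegralBasis U
  integralBasis =
    let U , bound = boundOnSubsets (λ S → ∣ ℚ.↥ (Candidate.discriminant representative reduceModβ S) ∣)
    in U , λ none → ¬¬-decides (λ a → representative a ∈ 𝓞 K) λ { (S , S-decides) →
      let open Candidate representative reduceModβ S
          D , disc≡ = discriminant-integer S-decides
      in none record
        { ω               = R.reduced
        ; isIntegralBasis = isIntegralBasis S-decides
        ; D               = D
        ; D≢0             = λ D≡0 → discriminant≢0 S-decides (trans disc≡ (cong fromℤ D≡0))
        ; ∣D∣≤U           = ℕ.≤-trans (∣z∣≤∣↥z∣ D disc≡) (bound S)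
        ; discriminant    = disc≡
        } }

-- Residues

residue : ∀ N → .{{ℕ.NonZero N}} → ℤ → Fin N
residue N z = Fin.fromℕ< (ℤ.n%ℕd<d z N)

toℕ-residue : ∀ N .{{_ : ℕ.NonZero N}} z → toℕ (residue N z) ≡ z ℤ.%ℕ N
toℕ-residue N z = Fin.toℕ-fromℕ< (ℤ.n%ℕd<d z N)

residue-toℕ : ∀ {N} .{{_ : ℕ.NonZero N}} (k : Fin N) → residue N (+ toℕ k) ≡ k
residue-toℕ {N} k = Fin.toℕ-injective (trans (toℕ-residue N (+ toℕ k)) (ℕ.m<n⇒m%n≡m (Fin.toℕ<n k)))

residue-≡⇒∣ : ∀ N .{{_ : ℕ.NonZero N}} y z → residue N y ≡ residue N z → + N ℤ.∣ y ℤ.- z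
residue-≡⇒∣ N y z eq = ℤ.divides (y ℤ./ℕ N ℤ.- z ℤ./ℕ N) (begin
  y ℤ.- z
    ≡⟨ cong₂ ℤ._-_ (ℤ.a≡a%ℕn+[a/ℕn]*n y N) (ℤ.a≡a%ℕn+[a/ℕn]*n z N) ⟩
  (+ (y ℤ.%ℕ N) ℤ.+ y ℤ./ℕ N ℤ.* + N) ℤ.- (+ (z ℤ.%ℕ N) ℤ.+ z ℤ./ℕ N ℤ.* + N)
    ≡⟨ cong (λ r → (+ r ℤ.+ y ℤ./ℕ N ℤ.* + N) ℤ.- (+ (z ℤ.%ℕ N) ℤ.+ z ℤ./ℕ N ℤ.* + N)) %≡ ⟩
  (+ (z ℤ.%ℕ N) ℤ.+ y ℤ./ℕ N ℤ.* + N) ℤ.- (+ (z ℤ.%ℕ N) ℤ.+ z ℤ./ℕ N ℤ.* + N)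
    ≡⟨ solve 4 (λ r a b n → (r :+ a :* n) :- (r :+ b :* n) := (a :- b) :* n) refl (+ (z ℤ.%ℕ N)) (y ℤ./ℕ N) (z ℤ./ℕ N) (+ N) ⟩
  (y ℤ./ℕ N ℤ.- z ℤ./ℕ N) ℤ.* + N ∎)
  where
  open ≡-Reasoning
  open ℤSolver.+-*-Solver
  %≡ : y ℤ.%ℕ N ≡ z ℤ.%ℕ N
  %≡ = trans (sym (toℕ-residue N y)) (trans (cong toℕ eq) (toℕ-residue N z))

toℕ-∣⇒≡ : ∀ {N} (i j : Fin N) → + N ℤ.∣ + toℕ i ℤ.- + toℕ j → i ≡ j
toℕ-∣⇒≡ {N} i j N∣ = Fin.toℕ-injective (ℤ.+-injective (ℤ.i-j≡0⇒i≡j (+ toℕ i) (+ toℕ j)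
  (ℤ.∣i∣≡0⇒i≡0 {+ toℕ i ℤ.- + toℕ j} (small ∣ + toℕ i ℤ.- + toℕ j ∣ bound (ℤ.∣⇒∣ᵤ N∣)))))
  where
  small : ∀ k → k ℕ.< N → N ℕ.∣ k → k ≡ 0
  small zero    _   _   = refl
  small (suc k) k<N N∣k = contradiction N∣k (ℕ.>⇒∤ k<N)

  bound : ∣ + toℕ i ℤ.- + toℕ j ∣ ℕ.< N
  bound = ℕ.≤-<-trans (subst (λ z → ∣ z ∣ ℕ.≤ toℕ i ℕ.⊔ toℕ j) (sym (ℤ.m-n≡m⊖n (toℕ i) (toℕ j))) (ℤ.∣m⊝n∣≤m⊔n (toℕ i) (toℕ j)))
    (ℕ.⊔-lub (Fin.toℕ<n i) (Fin.toℕ<n j))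

∣⇒residue-≡ : ∀ N .{{_ : ℕ.NonZero N}} y z → + N ℤ.∣ y ℤ.- z → residue N y ≡ residue N z
∣⇒residue-≡ N y z N∣ = toℕ-∣⇒≡ _ _ (subst₂ (λ r s → + N ℤ.∣ + r ℤ.- + s) (sym (toℕ-residue N y)) (sym (toℕ-residue N z))
  (subst (+ N ℤ.∣_) eq (ℤ.∣m∣n⇒∣m-n N∣ (ℤ.divides (y ℤ./ℕ N ℤ.- z ℤ./ℕ N) refl))))
  where
  open ≡-Reasoning
  open ℤSolver.+-*-Solver
  eq : (y ℤ.- z) ℤ.- (y ℤ./ℕ N ℤ.- z ℤ./ℕ N) ℤ.* + N ≡ + (y ℤ.%ℕ N) ℤ.- + (z ℤ.%ℕ N)
  eq = begin
    (y ℤ.- z) ℤ.- (y ℤ./ℕ N ℤ.- z ℤ./ℕ N) ℤ.* + N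
      ≡⟨ cong₂ (λ a b → (a ℤ.- b) ℤ.- (y ℤ./ℕ N ℤ.- z ℤ./ℕ N) ℤ.* + N) (ℤ.a≡a%ℕn+[a/ℕn]*n y N) (ℤ.a≡a%ℕn+[a/ℕn]*n z N) ⟩
    ((+ (y ℤ.%ℕ N) ℤ.+ y ℤ./ℕ N ℤ.* + N) ℤ.- (+ (z ℤ.%ℕ N) ℤ.+ z ℤ./ℕ N ℤ.* + N)) ℤ.- (y ℤ./ℕ N ℤ.- z ℤ./ℕ N) ℤ.* + N
      ≡⟨ solve 5 (λ r s a b n → ((r :+ a :* n) :- (s :+ b :* n)) :- (a :- b) :* n := r :- s) refl (+ (y ℤ.%ℕ N)) (+ (z ℤ.%ℕ N)) (y ℤ./ℕ N) (z ℤ./ℕ N) (+ N) ⟩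
    + (y ℤ.%ℕ N) ℤ.- + (z ℤ.%ℕ N) ∎

funToFin-cong : ∀ {l m} {f g : Fin l → Fin m} → (∀ i → f i ≡ g i) → Fin.funToFin f ≡ Fin.funToFin g
funToFin-cong {zero}  f≗g = refl
funToFin-cong {suc l} f≗g = cong₂ Fin.combine (f≗g zero) (funToFin-cong (f≗g ∘ suc))

funToFin-injective : ∀ {l m} {f g : Fin l → Fin m} → Fin.funToFin f ≡ Fin.funToFin g → ∀ i → f i ≡ g i
funToFin-injective {f = f} {g} eq i = trans (sym (Fin.finToFun-funToFin f i)) (trans (cong (λ k → Fin.finToFun k i) eq) (Fin.finToFun-funToFin g i))

finToFun-injective : ∀ {l m} (j k : Fin (m ℕ.^ l)) → (∀ i → Fin.finToFun {m} {l} j i ≡ Fin.finToFun k i) → j ≡ k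
finToFun-injective {l} {m} j k eq = trans (sym (Fin.funToFin-finToFin {l} {m} j)) (trans (funToFin-cong eq) (Fin.funToFin-finToFin {l} {m} k))

module Sumℤ = Sum (CommutativeRing.semiring ℤ.+-*-commutativeRing)
open Sumℤ using () renaming (sum to sumℤ)

-- The order attached to m and c consists of the elements with coordinates z such that m divides
-- z i for i in the first block and m² divides z j - ∑ c j i * z i for j in the second block.
-- With p prime in place of m this is ℤ + L for the lattice p²𝓞 ⊆ L ⊆ p𝓞 given by the graph of c.

module LatticeOrders (e d : ℕ) (K : NumberField (suc (e ℕ.+ d))) where
  open IntegralBasis K hiding (n)
  open SetoidReasoning setoid

  module WithBasis (ω : Vector Carrier (e ℕ.+ d))
      (ω⊆𝓞 : ∀ i → (1# ∷ ω) i ∈ 𝓞 K)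
      (𝓞⊆ω : ∀ {x} → x ∈ 𝓞 K → Span (1# ∷ ω) x)
      (ω-independent : ∀ z → lc (fromℤ ∘ z) (1# ∷ ω) ≈ 0# → ∀ i → z i ≡ ℤ.0ℤ)
    where

    Coordinates : Set
    Coordinates = Vector ℤ (suc (e ℕ.+ d))

    element : Coordinates → Carrier
    element z = lc (fromℤ ∘ z) (1# ∷ ω)

    element∈𝓞 : ∀ z → element z ∈ 𝓞 K
    element∈𝓞 z = IsSubgroup.lc-closed 𝓞-isSubgroup z (1# ∷ ω) ω⊆𝓞

    element-+ : ∀ y z → element (λ i → y i ℤ.+ z i) ≈ element y + element z
    element-+ y z = ≈-trans (lc-congˡ (1# ∷ ω) (λ i → fromℤ-homo-+ (y i) (z i))) (lc-+ (fromℤ ∘ y) (fromℤ ∘ z) (1# ∷ ω))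

    element-* : ∀ k z → element (λ i → k ℤ.* z i) ≈ ι (fromℤ k) * element z
    element-* k z = ≈-trans (lc-congˡ (1# ∷ ω) (λ i → fromℤ-homo-* k (z i))) (lc-scale (fromℤ k) (fromℤ ∘ z) (1# ∷ ω))

    element-neg : ∀ z → element (λ i → ℤ.-1ℤ ℤ.* z i) ≈ - element z
    element-neg z = ≈-trans (element-* ℤ.-1ℤ z) (solve 1 (λ x → con ℤ.-1ℤ :* x := :- x) ≈-refl (element z))
      where open KSolver

    element-minus : ∀ y z → element (λ i → y i ℤ.+ ℤ.-1ℤ ℤ.* z i) ≈ element y - element z
    element-minus y z = ≈-trans (element-+ y (λ i → ℤ.-1ℤ ℤ.* z i)) (+-congˡ (element-neg z))

    element-injective : ∀ y z → element y ≈ element z → ∀ i → y i ≡ z i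
    element-injective y z eq i = trans (solve 2 (λ a b → a := (a :+ con ℤ.-1ℤ :* b) :+ b) refl (y i) (z i))
      (trans (cong (ℤ._+ z i) (ω-independent (λ i → y i ℤ.+ ℤ.-1ℤ ℤ.* z i)
        (≈-trans (element-minus y z) (≈-trans (+-congʳ eq) (-‿inverseʳ (element z)))) i)) (ℤ.+-identityˡ (z i)))
      where open ℤSolver.+-*-Solver

    -- The `suc` skips the coordinate of `1#`, on which the orders impose no condition.
    first : Coordinates → Vector ℤ e
    first z i = z (suc (i Fin.↑ˡ d))

    second : Coordinates → Vector ℤ d
    second z j = z (suc (e Fin.↑ʳ j))

    glue : Vector ℤ e → Vector ℤ d → Coordinates
    glue y w = ℤ.0ℤ ∷ (y ++ w)

    first-glue : ∀ (y : Vector ℤ e) (w : Vector ℤ d) i → first (glue y w) i ≡ y i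
    first-glue y w i = cong [ y , w ]′ (Fin.splitAt-↑ˡ e i d)

    second-glue : ∀ (y : Vector ℤ e) (w : Vector ℤ d) j → second (glue y w) j ≡ w j
    second-glue y w j = cong [ y , w ]′ (Fin.splitAt-↑ʳ e d j)

    module _ (m : ℕ) .{{m-nonZero : ℕ.NonZero m}} (c : Fin d → Fin e → ℤ) where
      instance
        m²-nonZero : ℕ.NonZero (m ℕ.* m)
        m²-nonZero = ℕ.m*n≢0 m m

      slope : Vector ℤ e → Vector ℤ d
      slope y j = sumℤ (λ i → c j i ℤ.* y i)

      defect : Coordinates → Vector ℤ d
      defect z j = second z j ℤ.- slope (first z) j

      slope-linear : ∀ k x y j → slope (λ i → x i ℤ.+ k ℤ.* y i) j ≡ slope x j ℤ.+ k ℤ.* slope y j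
      slope-linear k x y j = trans
        (Sumℤ.sum-cong-≋ λ i → solve 4 (λ c x k y → c :* (x :+ k :* y) := c :* x :+ k :* (c :* y)) refl (c j i) (x i) k (y i))
        (trans (Sumℤ.∑-distrib-+ (λ i → c j i ℤ.* x i) (λ i → k ℤ.* (c j i ℤ.* y i)))
          (cong (λ w → slope x j ℤ.+ w) (sym (Sumℤ.*-distribˡ-sum k (λ i → c j i ℤ.* y i)))))
        where open ℤSolver.+-*-Solver

      defect-linear : ∀ k x y j → defect (λ i → x i ℤ.+ k ℤ.* y i) j ≡ defect x j ℤ.+ k ℤ.* defect y j
      defect-linear k x y j = trans (cong (λ w → second x j ℤ.+ k ℤ.* second y j ℤ.- w) (slope-linear k (first x) (first y) j))
        (solve 5 (λ a k b s t → (a :+ k :* b) :- (s :+ k :* t) := (a :- s) :+ k :* (b :- t)) refl (second x j) k (second y j) (slope (first x) j) (slope (first y) j))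
        where open ℤSolver.+-*-Solver

      InOrder : Coordinates → Set
      InOrder z = (∀ i → + m ℤ.∣ first z i) × (∀ j → + (m ℕ.* m) ℤ.∣ defect z j)

      inOrder-linear : ∀ k x y → InOrder x → InOrder y → InOrder (λ i → x i ℤ.+ k ℤ.* y i)
      inOrder-linear k x y (m∣x , m²∣x) (m∣y , m²∣y) =
        (λ i → ℤ.∣m∣n⇒∣m+n (m∣x i) (ℤ.∣n⇒∣m*n k (m∣y i))) ,
        (λ j → subst (+ (m ℕ.* m) ℤ.∣_) (sym (defect-linear k x y j)) (ℤ.∣m∣n⇒∣m+n (m²∣x j) (ℤ.∣n⇒∣m*n k (m²∣y j))))

      inOrder-resp : ∀ x y → (∀ i → x i ≡ y i) → InOrder x → InOrder y
      inOrder-resp x y x≗y (m∣x , m²∣x) =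
        (λ i → subst (+ m ℤ.∣_) (x≗y _) (m∣x i)) ,
        (λ j → subst (+ (m ℕ.* m) ℤ.∣_) (cong₂ ℤ._-_ (x≗y _) (Sumℤ.sum-cong-≋ λ i → cong (c j i ℤ.*_) (x≗y _))) (m²∣x j))

      slope-zero : ∀ y → (∀ i → y i ≡ ℤ.0ℤ) → ∀ j → slope y j ≡ ℤ.0ℤ
      slope-zero y y≡0 j = trans (Sumℤ.sum-cong-≋ λ i → trans (cong (c j i ℤ.*_) (y≡0 i)) (ℤ.*-zeroʳ (c j i)))
        (Sumℤ.sum-replicate-zero e)

      inOrder-zero : ∀ z → (∀ i → z (suc i) ≡ ℤ.0ℤ) → InOrder z
      inOrder-zero z z≡0 =
        (λ i → subst (+ m ℤ.∣_) (sym (z≡0 _)) (ℤ.divides ℤ.0ℤ refl)) ,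
        (λ j → subst (+ (m ℕ.* m) ℤ.∣_) (sym (cong₂ ℤ._-_ (z≡0 _) (slope-zero (first z) (λ i → z≡0 _) j))) (ℤ.divides ℤ.0ℤ refl))

      Member : Carrier → Set
      Member x = ∃ λ z → x ≈ element z × InOrder z

      member-isSubgroup : IsSubgroup Member
      member-isSubgroup = record
        { resp       = λ { x≈y (z , x≈ , z∈) → z , ≈-trans (≈-sym x≈y) x≈ , z∈ }
        ; 0∈         = (λ _ → ℤ.0ℤ) , ≈-sym (lc-zero _ (1# ∷ ω) λ _ → refl) , inOrder-zero (λ _ → ℤ.0ℤ) (λ _ → refl)
        ; +-closed   = λ { (y , x≈ , y∈) (z , x′≈ , z∈) →
            (λ i → y i ℤ.+ ℤ.1ℤ ℤ.* z i) ,
            ≈-trans (+-cong x≈ (≈-trans x′≈ (lc-congˡ (1# ∷ ω) λ i → cong fromℤ (sym (ℤ.*-identityˡ (z i)))))) (≈-sym (element-+ y (λ i → ℤ.1ℤ ℤ.* z i))) ,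
            inOrder-linear ℤ.1ℤ y z y∈ z∈ }
        ; neg-closed = λ { (z , x≈ , z∈) →
            (λ i → ℤ.0ℤ ℤ.+ ℤ.-1ℤ ℤ.* z i) ,
            ≈-trans (-‿cong x≈) (≈-trans (≈-sym (element-neg z)) (lc-congˡ (1# ∷ ω) λ i → cong fromℤ (sym (ℤ.+-identityˡ (ℤ.-1ℤ ℤ.* z i))))) ,
            inOrder-linear ℤ.-1ℤ (λ _ → ℤ.0ℤ) z (inOrder-zero (λ _ → ℤ.0ℤ) (λ _ → refl)) z∈ }
        }
      module Member = IsSubgroup member-isSubgroup

      1∈member : Member 1#
      1∈member = δ zero , ≈-sym (lc-δ zero (1# ∷ ω)) , inOrder-zero (δ zero) (λ _ → refl)

      member⊆𝓞 : ∀ {x} → Member x → x ∈ 𝓞 K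
      member⊆𝓞 (z , x≈ , _) = integral-resp (≈-sym x≈) (element∈𝓞 z)

      m²𝓞⊆member : ∀ {x} → x ∈ 𝓞 K → Member (ι (fromℤ (+ (m ℕ.* m))) * x)
      m²𝓞⊆member {x} x∈ = scaled (𝓞⊆ω x∈)
        where
        m² = + (m ℕ.* m)
        scaled : Span (1# ∷ ω) x → Member (ι (fromℤ m²) * x)
        scaled (z , x≈) = (λ i → m² ℤ.* z i) , ≈-trans (*-congˡ x≈) (≈-sym (element-* m² z)) ,
          inOrder-resp (λ i → ℤ.0ℤ ℤ.+ m² ℤ.* z i) (λ i → m² ℤ.* z i) (λ i → ℤ.+-identityˡ (m² ℤ.* z i))
            ( (λ i → ℤ.∣m∣n⇒∣m+n (ℤ.divides ℤ.0ℤ refl) (ℤ.∣m⇒∣m*n (first z i) (ℤ.divides (+ m) (ℤ.pos-* m m))))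
            , (λ j → subst (m² ℤ.∣_) (sym (defect-linear m² (λ _ → ℤ.0ℤ) z j))
                (ℤ.∣m∣n⇒∣m+n (proj₂ (inOrder-zero (λ _ → ℤ.0ℤ) (λ _ → refl)) j) (ℤ.∣m⇒∣m*n (defect z j) ℤ.∣-refl))))

      -- The second block is also divisible by `m`: it is the slope of the first block, a
      -- combination of multiples of `m`, up to a multiple of m².
      member⊆ℤ+m𝓞 : ∀ {x} → Member x → ∃₂ λ k y → y ∈ 𝓞 K × x ≈ ι (fromℤ k) + ι (fromℤ (+ m)) * y
      member⊆ℤ+m𝓞 {x} (z , x≈ , m∣ , m²∣) = z zero , element w , element∈𝓞 w , (begin
        x                                                          ≈⟨ x≈ ⟩
        ι (fromℤ (z zero)) * 1# + lc (fromℤ ∘ z ∘ suc) ω           ≈⟨ +-cong (*-identityʳ _) (≈-sym (+-identityˡ _)) ⟩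
        ι (fromℤ (z zero)) + (0# + lc (fromℤ ∘ z ∘ suc) ω)         ≈⟨ +-congˡ (+-cong (0≈0*x 1#) (lc-congˡ ω λ i → cong fromℤ (trans (ℤ._∣_.equality (m∣z i)) (ℤ.*-comm _ (+ m))))) ⟩
        ι (fromℤ (z zero)) + (ι 0ℚ * 1# + lc (λ i → fromℤ (+ m ℤ.* w (suc i))) ω)  ≈⟨ +-congˡ (+-congʳ (*-congʳ (ι-cong (cong fromℤ (sym (ℤ.*-zeroʳ (+ m))))))) ⟩
        ι (fromℤ (z zero)) + element (λ i → + m ℤ.* w i)           ≈⟨ +-congˡ (element-* (+ m) w) ⟩
        ι (fromℤ (z zero)) + ι (fromℤ (+ m)) * element w           ∎)
        where
        m∣slope : ∀ j → + m ℤ.∣ slope (first z) j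
        m∣slope j = ∣sum (λ i → c j i ℤ.* first z i) λ i → ℤ.∣n⇒∣m*n (c j i) (m∣ i)
          where
          ∣sum : ∀ {l} (y : Vector ℤ l) → (∀ i → + m ℤ.∣ y i) → + m ℤ.∣ sumℤ y
          ∣sum {zero}  y m∣y = ℤ.divides ℤ.0ℤ refl
          ∣sum {suc l} y m∣y = ℤ.∣m∣n⇒∣m+n (m∣y zero) (∣sum (y ∘ suc) (m∣y ∘ suc))

        m∣second : ∀ j → + m ℤ.∣ second z j
        m∣second j = subst (+ m ℤ.∣_) (solve 2 (λ a b → (a :- b) :+ b := a) refl (second z j) (slope (first z) j))
          (ℤ.∣m∣n⇒∣m+n (ℤ.∣-trans (ℤ.divides (+ m) (ℤ.pos-* m m)) (m²∣ j)) (m∣slope j))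
          where open ℤSolver.+-*-Solver

        m∣z : ∀ i → + m ℤ.∣ z (suc i)
        m∣z i = cases (Fin.splitAt e i) (Fin.join-splitAt e d i)
          where
          cases : ∀ s → Fin.join e d s ≡ i → + m ℤ.∣ z (suc i)
          cases (inj₁ i) refl = m∣ i
          cases (inj₂ j) refl = m∣second j

        w : Coordinates
        w = ℤ.0ℤ ∷ λ i → ℤ.quotient (m∣z i)

      -- Write x = k + m x′ and y = l + m y′. Then x y = k y + l (x - k) + m² x′ y′, where the first
      -- two terms are integer multiples of members and the last lies in m²𝓞.
      member-* : ∀ {x y} → Member x → Member y → Member (x * y)
      member-* {x} {y} x∈ y∈ =
        let k , x′ , x′∈ , x≈ = member⊆ℤ+m𝓞 x∈
            l , y′ , y′∈ , y≈ = member⊆ℤ+m𝓞 y∈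
        in product k l x′∈ y′∈ x≈ y≈
        where
        constant : ∀ k → Member (ι (fromℤ k))
        constant k = Member.resp (*-identityʳ (ι (fromℤ k))) (Member.ℤ-closed k 1∈member)

        product : ∀ k l {x′ y′} → x′ ∈ 𝓞 K → y′ ∈ 𝓞 K → x ≈ ι (fromℤ k) + ι (fromℤ (+ m)) * x′ →
                  y ≈ ι (fromℤ l) + ι (fromℤ (+ m)) * y′ → Member (x * y)
        product k l {x′} {y′} x′∈ y′∈ x≈ y≈ = Member.resp (begin
          ι (fromℤ k) * y + ι (fromℤ l) * (x - ι (fromℤ k)) + ι (fromℤ (+ (m ℕ.* m))) * (x′ * y′)
            ≈⟨ +-congˡ (*-congʳ (≈-trans (ι-cong (trans (cong fromℤ (ℤ.pos-* m m)) (fromℤ-homo-* (+ m) (+ m)))) (ι-* (fromℤ (+ m)) (fromℤ (+ m))))) ⟩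
          ι (fromℤ k) * y + ι (fromℤ l) * (x - ι (fromℤ k)) + ι (fromℤ (+ m)) * ι (fromℤ (+ m)) * (x′ * y′)
            ≈⟨ +-congʳ (+-cong (*-congˡ y≈) (*-congˡ (+-congʳ x≈))) ⟩
          ι (fromℤ k) * (ι (fromℤ l) + ι (fromℤ (+ m)) * y′) + ι (fromℤ l) * ((ι (fromℤ k) + ι (fromℤ (+ m)) * x′) - ι (fromℤ k)) + ι (fromℤ (+ m)) * ι (fromℤ (+ m)) * (x′ * y′)
            ≈⟨ solve 5 (λ k l m x y → k :* (l :+ m :* y) :+ l :* ((k :+ m :* x) :- k) :+ m :* m :* (x :* y) := (k :+ m :* x) :* (l :+ m :* y)) ≈-refl (ι (fromℤ k)) (ι (fromℤ l)) (ι (fromℤ (+ m))) x′ y′ ⟩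
          (ι (fromℤ k) + ι (fromℤ (+ m)) * x′) * (ι (fromℤ l) + ι (fromℤ (+ m)) * y′)
            ≈⟨ *-cong x≈ y≈ ⟨
          x * y ∎)
          (Member.+-closed (Member.+-closed (Member.ℤ-closed k y∈) (Member.ℤ-closed l (Member.minus-closed x∈ (constant k))))
            (m²𝓞⊆member (integral-K-* x′∈ y′∈)))
          where open KSolver

      isSubring : IsSubring K Member
      isSubring = record
        { resp       = Member.resp
        ; 1-closed   = 1∈member
        ; +-closed   = Member.+-closed
        ; neg-closed = Member.neg-closed
        ; *-closed   = member-*
        }

      latticeIndex : ℕ
      latticeIndex = m ℕ.^ e ℕ.* (m ℕ.* m) ℕ.^ d

      -- A class of 𝓞 modulo the order is determined by the first block modulo `m` and the defects
      -- modulo m². Taking defects instead of the second block makes the range independent of `c`.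
      code : Coordinates → Fin latticeIndex
      code z = Fin.combine (Fin.funToFin (residue m ∘ first z)) (Fin.funToFin (residue (m ℕ.* m) ∘ defect z))

      digits₁ : Fin latticeIndex → Vector ℤ e
      digits₁ k i = + toℕ (Fin.finToFun {m} {e} (Fin.quotient ((m ℕ.* m) ℕ.^ d) k) i)

      digits₂ : Fin latticeIndex → Vector ℤ d
      digits₂ k j = + toℕ (Fin.finToFun {m ℕ.* m} {d} (Fin.remainder {m ℕ.^ e} ((m ℕ.* m) ℕ.^ d) k) j)

      -- Adding the slope makes the defects equal to `digits₂`.
      decode : Fin latticeIndex → Coordinates
      decode k = glue (digits₁ k) (λ j → digits₂ k j ℤ.+ slope (digits₁ k) j)

      defect-glue : ∀ (y : Vector ℤ e) (w : Vector ℤ d) j → defect (glue y (λ j → w j ℤ.+ slope y j)) j ≡ w j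
      defect-glue y w j = trans (cong₂ ℤ._-_ (second-glue y _ j) (Sumℤ.sum-cong-≋ λ i → cong (c j i ℤ.*_) (first-glue y (λ j → w j ℤ.+ slope y j) i)))
        (solve 2 (λ a b → (a :+ b) :- b := a) refl (w j) (slope y j))
        where open ℤSolver.+-*-Solver

      code-decode : ∀ k → code (decode k) ≡ k
      code-decode k = trans (cong₂ Fin.combine
          (trans (funToFin-cong λ i → trans (cong (residue m) (first-glue (digits₁ k) (λ j → digits₂ k j ℤ.+ slope (digits₁ k) j) i)) (residue-toℕ (Fin.finToFun {m} {e} p i))) (Fin.funToFin-finToFin {e} {m} p))
          (trans (funToFin-cong λ j → trans (cong (residue (m ℕ.* m)) (defect-glue (digits₁ k) (digits₂ k) j)) (residue-toℕ (Fin.finToFun {m ℕ.* m} {d} q j))) (Fin.funToFin-finToFin {d} {m ℕ.* m} q)))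
        (Fin.combine-remQuot {m ℕ.^ e} ((m ℕ.* m) ℕ.^ d) k)
        where
        p = Fin.quotient {m ℕ.^ e} ((m ℕ.* m) ℕ.^ d) k
        q = Fin.remainder {m ℕ.^ e} ((m ℕ.* m) ℕ.^ d) k

      defect-minus : ∀ y z j → defect (λ i → y i ℤ.+ ℤ.-1ℤ ℤ.* z i) j ≡ defect y j ℤ.- defect z j
      defect-minus y z j = trans (defect-linear ℤ.-1ℤ y z j) (cong (λ w → defect y j ℤ.+ w) (ℤ.-1*i≡-i (defect z j)))

      code-≡⇒inOrder : ∀ y z → code y ≡ code z → InOrder (λ i → y i ℤ.+ ℤ.-1ℤ ℤ.* z i)
      code-≡⇒inOrder y z eq =
        (λ i → subst (+ m ℤ.∣_) (cong (λ w → first y i ℤ.+ w) (sym (ℤ.-1*i≡-i (first z i)))) (residue-≡⇒∣ m (first y i) (first z i) (funToFin-injective (proj₁ parts) i))) ,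
        (λ j → subst (+ (m ℕ.* m) ℤ.∣_) (sym (defect-minus y z j)) (residue-≡⇒∣ (m ℕ.* m) (defect y j) (defect z j) (funToFin-injective (proj₂ parts) j)))
        where parts = Fin.combine-injective (Fin.funToFin (residue m ∘ first y)) (Fin.funToFin (residue (m ℕ.* m) ∘ defect y)) (Fin.funToFin (residue m ∘ first z)) (Fin.funToFin (residue (m ℕ.* m) ∘ defect z)) eq

      inOrder⇒code-≡ : ∀ y z → InOrder (λ i → y i ℤ.+ ℤ.-1ℤ ℤ.* z i) → code y ≡ code z
      inOrder⇒code-≡ y z (m∣ , m²∣) = cong₂ Fin.combine
        (funToFin-cong λ i → ∣⇒residue-≡ m (first y i) (first z i) (subst (+ m ℤ.∣_) (cong (λ w → first y i ℤ.+ w) (ℤ.-1*i≡-i (first z i))) (m∣ i)))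
        (funToFin-cong λ j → ∣⇒residue-≡ (m ℕ.* m) (defect y j) (defect z j) (subst (+ (m ℕ.* m) ℤ.∣_) (defect-minus y z j) (m²∣ j)))

      equivalent⇒code-≡ : ∀ {x x′} y z → x ≈ element y → x′ ≈ element z → Member (x - x′) → code y ≡ code z
      equivalent⇒code-≡ y z x≈ x′≈ (w , x-x′≈ , w∈) = inOrder⇒code-≡ y z (inOrder-resp w (λ i → y i ℤ.+ ℤ.-1ℤ ℤ.* z i)
        (element-injective w (λ i → y i ℤ.+ ℤ.-1ℤ ℤ.* z i) (≈-trans (≈-sym x-x′≈) (≈-trans (+-cong x≈ (-‿cong x′≈)) (≈-sym (element-minus y z))))) w∈)

      code-≡⇒equivalent : ∀ {x x′} y z → x ≈ element y → x′ ≈ element z → code y ≡ code z → Member (x - x′)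
      code-≡⇒equivalent y z x≈ x′≈ eq = (λ i → y i ℤ.+ ℤ.-1ℤ ℤ.* z i) , ≈-trans (+-cong x≈ (-‿cong x′≈)) (≈-sym (element-minus y z)) , code-≡⇒inOrder y z eq

      index-correct : HasCardinality (quotient K isSubring) latticeIndex
      index-correct = record
        { to        = λ k → element (decode k) , element∈𝓞 (decode k)
        ; from      = λ (x , x∈) → code (proj₁ (𝓞⊆ω x∈))
        ; to-cong   = λ { {k} refl → Member.resp (≈-sym (-‿inverseʳ (element (decode k)))) Member.0∈ }
        ; from-cong = λ { {x , x∈} {y , y∈} → equivalent⇒code-≡ (proj₁ (𝓞⊆ω x∈)) (proj₁ (𝓞⊆ω y∈)) (proj₂ (𝓞⊆ω x∈)) (proj₂ (𝓞⊆ω y∈)) }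
        ; inverse   =
            (λ { {x , x∈} {k} refl → code-≡⇒equivalent (decode (code (proj₁ (𝓞⊆ω x∈)))) (proj₁ (𝓞⊆ω x∈)) ≈-refl (proj₂ (𝓞⊆ω x∈)) (code-decode (code (proj₁ (𝓞⊆ω x∈)))) }) ,
            (λ { {k} {y , y∈} y~ → trans (equivalent⇒code-≡ (proj₁ (𝓞⊆ω y∈)) (decode k) (proj₂ (𝓞⊆ω y∈)) ≈-refl y~) (code-decode k) })
        }

      latticeOrder : Order K
      latticeOrder = record
        { member        = Member
        ; isSubring     = isSubring
        ; integral      = member⊆𝓞
        ; index         = latticeIndex
        ; index-correct = index-correct
        }

    sum-δ : ∀ {l} (y : Vector ℤ l) k i → sumℤ (λ j → y j ℤ.* (k ℤ.* δ i j)) ≡ k ℤ.* y i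
    sum-δ {suc l} y k zero = trans (cong₂ ℤ._+_
        (trans (cong (y zero ℤ.*_) (ℤ.*-identityʳ k)) (ℤ.*-comm (y zero) k))
        (trans (Sumℤ.sum-cong-≋ λ j → trans (cong (y (suc j) ℤ.*_) (ℤ.*-zeroʳ k)) (ℤ.*-zeroʳ (y (suc j)))) (Sumℤ.sum-replicate-zero l)))
      (ℤ.+-identityʳ (k ℤ.* y zero))
    sum-δ {suc l} y k (suc i) = trans (cong₂ ℤ._+_
        (trans (cong (y zero ℤ.*_) (ℤ.*-zeroʳ k)) (ℤ.*-zeroʳ (y zero)))
        (sum-δ (y ∘ suc) k i))
      (ℤ.+-identityˡ (k ℤ.* y (suc i)))

    -- The test element is `m` times the i-th vector of the first block, completed so that its
    -- defects for `c` vanish. Its j-th defect for `c′` is `m` times the difference of the two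
    -- entries. If m² divides this, then `m` divides the difference of two numbers below `m`, which
    -- must be zero.
    member-determines-slope : ∀ (m : ℕ) .{{_ : ℕ.NonZero m}} (c c′ : Fin d → Fin e → Fin m) →
      (∀ {x} → Member m (λ j i → + toℕ (c j i)) x → Member m (λ j i → + toℕ (c′ j i)) x) → ∀ j i → c j i ≡ c′ j i
    member-determines-slope m c c′ c⊆c′ j i = compare (c⊆c′ (z , ≈-refl , z∈))
      where
      C C′ : Fin d → Fin e → ℤ
      C j i = + toℕ (c j i)
      C′ j i = + toℕ (c′ j i)

      y : Vector ℤ e
      y i′ = + m ℤ.* δ i i′

      z : Coordinates
      z = glue y (λ j → ℤ.0ℤ ℤ.+ slope m C y j)

      z∈ : InOrder m C z
      z∈ = (λ i′ → subst (+ m ℤ.∣_) (sym (first-glue y (λ j → ℤ.0ℤ ℤ.+ slope m C y j) i′)) (ℤ.∣m⇒∣m*n {+ m} {+ m} (δ i i′) ℤ.∣-refl)) ,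
           (λ j′ → subst (+ (m ℕ.* m) ℤ.∣_) (sym (defect-glue m C y (λ _ → ℤ.0ℤ) j′)) (ℤ.divides ℤ.0ℤ refl))

      defect′≡ : defect m C′ z j ≡ + m ℤ.* (C j i ℤ.- C′ j i)
      defect′≡ = trans (cong₂ ℤ._-_
          (trans (second-glue y (λ j → ℤ.0ℤ ℤ.+ slope m C y j) j) (trans (ℤ.+-identityˡ _) (sum-δ (C j) (+ m) i)))
          (trans (Sumℤ.sum-cong-≋ λ i′ → cong (C′ j i′ ℤ.*_) (first-glue y (λ j → ℤ.0ℤ ℤ.+ slope m C y j) i′)) (sum-δ (C′ j) (+ m) i)))
        (solve 3 (λ m a b → m :* a :- m :* b := m :* (a :- b)) refl (+ m) (C j i) (C′ j i))
        where open ℤSolver.+-*-Solver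

      compare : Member m C′ (element z) → c j i ≡ c′ j i
      compare (w , z≈w , w∈) = toℕ-∣⇒≡ (c j i) (c′ j i) (ℤ.*-cancelˡ-∣ (+ m)
        (subst₂ ℤ._∣_ (ℤ.pos-* m m) defect′≡ (proj₂ (inOrder-resp m C′ w z (element-injective w z (≈-sym z≈w)) w∈) j)))
        where
        instance
          +m-nonZero : ℤ.NonZero (+ m)
          +m-nonZero = ℕ.≢-nonZero (ℕ.≢-nonZero⁻¹ m)

-- Counting

powerSum : ℕ → ℕ → ℕ
powerSum s zero    = 0
powerSum s (suc M) = powerSum s M ℕ.+ suc M ℕ.^ s

^-suc-≤ : ∀ s M → suc M ℕ.^ suc s ℕ.≤ M ℕ.^ suc s ℕ.+ suc s ℕ.* suc M ℕ.^ s
^-suc-≤ zero    M = ℕ.≤-reflexive (solve 1 (λ M → (con 1 :+ M) :* con 1 := M :* con 1 :+ con 1 :* con 1) refl M)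
  where open ℕSolver.+-*-Solver
^-suc-≤ (suc s) M = begin
  suc M ℕ.* X                                              ≡⟨⟩
  X ℕ.+ M ℕ.* X                                            ≤⟨ ℕ.+-monoʳ-≤ X (ℕ.*-monoʳ-≤ M (^-suc-≤ s M)) ⟩
  X ℕ.+ M ℕ.* (M ℕ.^ suc s ℕ.+ suc s ℕ.* suc M ℕ.^ s)      ≤⟨ ℕ.m≤m+n _ (suc s ℕ.* suc M ℕ.^ s) ⟩
  X ℕ.+ M ℕ.* (M ℕ.^ suc s ℕ.+ suc s ℕ.* suc M ℕ.^ s) ℕ.+ suc s ℕ.* suc M ℕ.^ s
    ≡⟨ solve 5 (λ x m y k z → x :+ m :* (y :+ k :* z) :+ k :* z := m :* y :+ (x :+ k :* ((con 1 :+ m) :* z))) refl X M (M ℕ.^ suc s) (suc s) (suc M ℕ.^ s) ⟩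
  M ℕ.* M ℕ.^ suc s ℕ.+ (X ℕ.+ suc s ℕ.* X)                ∎
  where
  open ℕ.≤-Reasoning
  open ℕSolver.+-*-Solver
  X = suc M ℕ.^ suc s

-- Telescoping `^-suc-≤` takes the place of a comparison with the integral of t ^ s.
^≤powerSum : ∀ s M → M ℕ.^ suc s ℕ.≤ suc s ℕ.* powerSum s M
^≤powerSum s zero    = ℕ.z≤n
^≤powerSum s (suc M) = begin
  suc M ℕ.^ suc s                                      ≤⟨ ^-suc-≤ s M ⟩
  M ℕ.^ suc s ℕ.+ suc s ℕ.* suc M ℕ.^ s                ≤⟨ ℕ.+-monoˡ-≤ _ (^≤powerSum s M) ⟩
  suc s ℕ.* powerSum s M ℕ.+ suc s ℕ.* suc M ℕ.^ s     ≡⟨ ℕ.*-distribˡ-+ (suc s) (powerSum s M) (suc M ℕ.^ s) ⟨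
  suc s ℕ.* powerSum s (suc M)                         ∎
  where open ℕ.≤-Reasoning

cumulative-suc : ∀ F B → cumulative F (suc B) ≡ cumulative F B ℕ.+ F (suc B)
cumulative-suc F B = begin
  ListAction.sum (List.applyUpTo (F ∘ suc) (suc B))                        ≡⟨ cong ListAction.sum (List.applyUpTo-∷ʳ (F ∘ suc) B) ⟨
  ListAction.sum (List.applyUpTo (F ∘ suc) B List.∷ʳ F (suc B))            ≡⟨ ListAction.sum-++ (List.applyUpTo (F ∘ suc) B) (F (suc B) List.∷ List.[]) ⟩
  cumulative F B ℕ.+ (F (suc B) ℕ.+ 0)                                     ≡⟨ cong (cumulative F B ℕ.+_) (ℕ.+-identityʳ (F (suc B))) ⟩
  cumulative F B ℕ.+ F (suc B)                                             ∎
  where open ≡-Reasoning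

cumulative-mono : ∀ F {A B} → A ℕ.≤ B → cumulative F A ℕ.≤ cumulative F B
cumulative-mono F {A} {B} A≤B with ℕ.m≤n⇒∃[o]m+o≡n A≤B
... | o , refl = go o
  where
  go : ∀ o → cumulative F A ℕ.≤ cumulative F (A ℕ.+ o)
  go zero    = ℕ.≤-reflexive (cong (cumulative F) (sym (ℕ.+-identityʳ A)))
  go (suc o) = ℕ.≤-trans (go o) (ℕ.≤-trans (ℕ.m≤m+n _ (F (suc (A ℕ.+ o))))
    (ℕ.≤-reflexive (trans (sym (cumulative-suc F (A ℕ.+ o))) (cong (cumulative F) (sym (ℕ.+-suc A o))))))

-- Strict growth of `κ` keeps its values apart, so the contributions `F (κ (suc m))` are different
-- summands of the cumulative sum.
powerSum≤cumulative : ∀ F s (κ : ℕ → ℕ) → (∀ m → κ m ℕ.< κ (suc m)) → (∀ m → suc m ℕ.^ s ℕ.≤ F (κ (suc m))) →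
                      ∀ M → powerSum s M ℕ.≤ cumulative F (κ M)
powerSum≤cumulative F s κ increasing many zero    = ℕ.z≤n
powerSum≤cumulative F s κ increasing many (suc M) =
  next (κ (suc M)) (increasing M) (many M)
  where
  next : ∀ k → κ M ℕ.< k → suc M ℕ.^ s ℕ.≤ F k → powerSum s M ℕ.+ suc M ℕ.^ s ℕ.≤ cumulative F k
  -- `κ (suc M)` is positive because it exceeds `κ M`; its term splits off as the last summand, and
  -- all earlier ones are counted up to `k`.
  next (suc k) (ℕ.s≤s κM≤k) last = ℕ.≤-trans
    (ℕ.+-mono-≤ (ℕ.≤-trans (powerSum≤cumulative F s κ increasing many M) (cumulative-mono F κM≤k)) last)
    (ℕ.≤-reflexive (sym (cumulative-suc F k)))

^-distribʳ-* : ∀ k a b → (a ℕ.* b) ℕ.^ k ≡ a ℕ.^ k ℕ.* b ℕ.^ k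
^-distribʳ-* zero    a b = refl
^-distribʳ-* (suc k) a b = trans (cong (a ℕ.* b ℕ.*_) (^-distribʳ-* k a b))
  (solve 4 (λ a b x y → a :* b :* (x :* y) := a :* x :* (b :* y)) refl a b (a ℕ.^ k) (b ℕ.^ k))
  where open ℕSolver.+-*-Solver

-- A downward search from an overshoot for a place where `f` crosses `B`. For `f` k = U k ^ Q with
-- U, Q ≥ 1 the number `suc M` is the integer part of the Q-th root of B / U.
largest : ∀ (f : ℕ → ℕ) B → f 1 ℕ.≤ B → ∀ k → B ℕ.< f (suc k) → ∃ λ M → f (suc M) ℕ.≤ B × B ℕ.< f (suc (suc M))
largest f B f1≤B zero    B<f = contradiction f1≤B (ℕ.<⇒≱ B<f)
largest f B f1≤B (suc k) B<f with f (suc k) ℕ.≤? B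
... | yes fk≤B = k , fk≤B , B<f
... | no  fk≰B = largest f B f1≤B k (ℕ.≰⇒> fk≰B)

-- B < U (M + 1) ^ Q ≤ U (2 M) ^ Q and M ^ P ≤ P N, where p / q = P / Q.
growth : ∀ {U B M N P Q p q} .{{_ : ℕ.NonZero U}} .{{_ : ℕ.NonZero q}} → B ℕ.< U ℕ.* suc (suc M) ℕ.^ Q →
         suc M ℕ.^ P ℕ.≤ P ℕ.* N → p ℕ.* Q ≡ q ℕ.* P →
         B ℕ.^ p ℕ.≤ (U ℕ.^ p ℕ.* 2 ℕ.^ P ℕ.* P ℕ.* N) ℕ.^ q
growth {U} {B} {M} {N} {P} {Q} {p} {q} B< M^P≤ pQ≡qP = begin
  B ℕ.^ p                                                  ≤⟨ ℕ.^-monoˡ-≤ p (ℕ.<⇒≤ B<) ⟩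
  (U ℕ.* suc (suc M) ℕ.^ Q) ℕ.^ p                          ≤⟨ ℕ.^-monoˡ-≤ p (ℕ.*-monoʳ-≤ U (ℕ.^-monoˡ-≤ Q M+1≤2M)) ⟩
  (U ℕ.* (2 ℕ.* suc M) ℕ.^ Q) ℕ.^ p                        ≡⟨ ^-distribʳ-* p U ((2 ℕ.* suc M) ℕ.^ Q) ⟩
  U ℕ.^ p ℕ.* ((2 ℕ.* suc M) ℕ.^ Q) ℕ.^ p                  ≡⟨ cong (U ℕ.^ p ℕ.*_) exponents ⟩
  U ℕ.^ p ℕ.* ((2 ℕ.* suc M) ℕ.^ P) ℕ.^ q                  ≤⟨ ℕ.*-monoˡ-≤ (((2 ℕ.* suc M) ℕ.^ P) ℕ.^ q) U^p≤ ⟩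
  (U ℕ.^ p) ℕ.^ q ℕ.* ((2 ℕ.* suc M) ℕ.^ P) ℕ.^ q          ≡⟨ ^-distribʳ-* q (U ℕ.^ p) ((2 ℕ.* suc M) ℕ.^ P) ⟨
  (U ℕ.^ p ℕ.* (2 ℕ.* suc M) ℕ.^ P) ℕ.^ q                  ≡⟨ cong (λ x → (U ℕ.^ p ℕ.* x) ℕ.^ q) (^-distribʳ-* P 2 (suc M)) ⟩
  (U ℕ.^ p ℕ.* (2 ℕ.^ P ℕ.* suc M ℕ.^ P)) ℕ.^ q            ≤⟨ ℕ.^-monoˡ-≤ q (ℕ.*-monoʳ-≤ (U ℕ.^ p) (ℕ.*-monoʳ-≤ (2 ℕ.^ P) M^P≤)) ⟩
  (U ℕ.^ p ℕ.* (2 ℕ.^ P ℕ.* (P ℕ.* N))) ℕ.^ q              ≡⟨ cong (ℕ._^ q) (solve 4 (λ u t p n → u :* (t :* (p :* n)) := u :* t :* p :* n) refl (U ℕ.^ p) (2 ℕ.^ P) P N) ⟩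
  (U ℕ.^ p ℕ.* 2 ℕ.^ P ℕ.* P ℕ.* N) ℕ.^ q                  ∎
  where
  open ℕ.≤-Reasoning
  open ℕSolver.+-*-Solver

  M+1≤2M : suc (suc M) ℕ.≤ 2 ℕ.* suc M
  M+1≤2M = ℕ.s≤s (ℕ.≤-trans (ℕ.s≤s (ℕ.m≤m+n M 0)) (ℕ.m≤n+m (suc (M ℕ.+ 0)) M))

  exponents : ((2 ℕ.* suc M) ℕ.^ Q) ℕ.^ p ≡ ((2 ℕ.* suc M) ℕ.^ P) ℕ.^ q
  exponents = trans (ℕ.^-*-assoc (2 ℕ.* suc M) Q p) (trans (cong ((2 ℕ.* suc M) ℕ.^_) (trans (ℕ.*-comm Q p) (trans pQ≡qP (ℕ.*-comm q P))))
    (sym (ℕ.^-*-assoc (2 ℕ.* suc M) P q)))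

  -- Enlarging the constant to its `q`-th power lets it join the other factor under a single
  -- exponent `q`.
  U^p≤ : U ℕ.^ p ℕ.≤ (U ℕ.^ p) ℕ.^ q
  U^p≤ = ℕ.≤-trans (ℕ.≤-reflexive (sym (ℕ.^-identityʳ (U ℕ.^ p)))) (ℕ.^-monoʳ-≤ (U ℕ.^ p) {{ℕ.m^n≢0 U p}} (ℕ.>-nonZero⁻¹ q))

-- From inequalities of natural numbers to rational exponents

fromℕ-mono-≤ : ∀ {k l} → k ℕ.≤ l → fromℕ k ℚ.≤ fromℕ l
fromℕ-mono-≤ {k} {l} k≤l = ℚ.toℚᵘ-cancel-≤ (ℚᵘ.≤-respˡ-≃ (ℚᵘ.≃-sym (toℚᵘ-fromℤ (+ k))) (ℚᵘ.≤-respʳ-≃ (ℚᵘ.≃-sym (toℚᵘ-fromℤ (+ l)))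
  (ℚᵘ.*≤* (ℤ.*-monoʳ-≤-nonNeg (+ 1) (ℤ.+≤+ k≤l)))))

fromℕ-* : ∀ k l → fromℕ (k ℕ.* l) ≡ fromℕ k ℚ.* fromℕ l
fromℕ-* k l = trans (cong fromℤ (ℤ.pos-* k l)) (fromℤ-homo-* (+ k) (+ l))

fromℕ-^ : ∀ k l → fromℕ (k ℕ.^ l) ≡ fromℕ k ^ℚ l
fromℕ-^ k zero    = refl
fromℕ-^ k (suc l) = trans (fromℕ-* k (k ℕ.^ l)) (cong (fromℕ k ℚ.*_) (fromℕ-^ k l))

^ℚ-distrib-* : ∀ k x y → (x ℚ.* y) ^ℚ k ≡ x ^ℚ k ℚ.* y ^ℚ k
^ℚ-distrib-* zero    x y = refl
^ℚ-distrib-* (suc k) x y = trans (cong (x ℚ.* y ℚ.*_) (^ℚ-distrib-* k x y))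
  (solve 4 (λ a b x y → a :* b :* (x :* y) := a :* x :* (b :* y)) refl x y (x ^ℚ k) (y ^ℚ k))
  where open ℚSolver.+-*-Solver

1^ℚ : ∀ k → 1ℚ ^ℚ k ≡ 1ℚ
1^ℚ zero    = refl
1^ℚ (suc k) = trans (ℚ.*-identityˡ (1ℚ ^ℚ k)) (1^ℚ k)

^ℚ-nonNeg : ∀ k x → .{{ℚ.Positive x}} → ℚ.NonNegative (x ^ℚ k)
^ℚ-nonNeg zero    x = _
^ℚ-nonNeg (suc k) x = ℚ.nonNeg*nonNeg⇒nonNeg x {{ℚ.pos⇒nonNeg x}} (x ^ℚ k) {{^ℚ-nonNeg k x}}

-- The factor `C` sits inside the `q`-th power so that its inverse `c` can be raised to the same
-- power, as the encoding of the inequality demands.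
scaledPower : ∀ c C → c ℚ.* fromℕ C ≡ 1ℚ → .{{ℚ.Positive c}} → ∀ B N e → B ℕ.^ ∣ ℚ.↥ e ∣ ℕ.≤ (C ℕ.* N) ℕ.^ ℚ.↧ₙ e →
              c · fromℕ B ^ e ≤ fromℕ N
scaledPower c C cC≡1 B N e B^p≤ = begin
  c ^ℚ q ℚ.* fromℕ B ^ℚ p                          ≡⟨ cong (c ^ℚ q ℚ.*_) (fromℕ-^ B p) ⟨
  c ^ℚ q ℚ.* fromℕ (B ℕ.^ p)                       ≤⟨ ℚ.*-monoˡ-≤-nonNeg (c ^ℚ q) {{^ℚ-nonNeg q c}} (fromℕ-mono-≤ B^p≤) ⟩
  c ^ℚ q ℚ.* fromℕ ((C ℕ.* N) ℕ.^ q)               ≡⟨ cong (c ^ℚ q ℚ.*_) (trans (fromℕ-^ (C ℕ.* N) q) (cong (_^ℚ q) (fromℕ-* C N))) ⟩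
  c ^ℚ q ℚ.* (fromℕ C ℚ.* fromℕ N) ^ℚ q            ≡⟨ ^ℚ-distrib-* q c (fromℕ C ℚ.* fromℕ N) ⟨
  (c ℚ.* (fromℕ C ℚ.* fromℕ N)) ^ℚ q               ≡⟨ cong (_^ℚ q) (trans (sym (ℚ.*-assoc c (fromℕ C) (fromℕ N))) (trans (cong (ℚ._* fromℕ N) cC≡1) (ℚ.*-identityˡ (fromℕ N)))) ⟩
  fromℕ N ^ℚ q                                     ∎
  where
  open ℚ.≤-Reasoning
  p = ∣ ℚ.↥ e ∣
  q = ℚ.↧ₙ e

positiveInverse : ∀ C → C ≢ 0 → ∃ λ c → ℚ.Positive c × c ℚ.* fromℕ C ≡ 1ℚ
positiveInverse C C≢0 = ℚ.1/_ (fromℕ C) {{nonZero}} , ℚ.1/pos⇒pos (fromℕ C) {{positive}} , ℚ.*-inverseˡ (fromℕ C) {{nonZero}}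
  where
  positive : ℚ.Positive (fromℕ C)
  positive = ℚ.normalize-pos C 1 {{_}} {{ℕ.≢-nonZero C≢0}}
  nonZero : ℚ.NonZero (fromℕ C)
  nonZero = ℚ.pos⇒nonZero (fromℕ C) {{positive}}

/-* : ∀ i k .{{_ : ℕ.NonZero k}} → (i ℚ./ k) ℚ.* fromℕ k ≡ fromℤ i
/-* i (suc k) = ℚ.toℚᵘ-injective (begin
  ℚ.toℚᵘ ((i ℚ./ suc k) ℚ.* fromℕ (suc k))              ≈⟨ ℚ.toℚᵘ-homo-* (i ℚ./ suc k) (fromℕ (suc k)) ⟩
  ℚ.toℚᵘ (i ℚ./ suc k) ℚᵘ.* ℚ.toℚᵘ (fromℕ (suc k))      ≈⟨ ℚᵘ.*-cong (ℚ.toℚᵘ-fromℚᵘ (ℚᵘ.mkℚᵘ i k)) (toℚᵘ-fromℤ (+ suc k)) ⟩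
  ℚᵘ.mkℚᵘ i k ℚᵘ.* ℚᵘ.mkℚᵘ (+ suc k) 0                  ≈⟨ ℚᵘ.*≡* (trans (ℤ.*-identityʳ _) (cong (i ℤ.*_) (cong +_ (sym (ℕ.*-identityʳ (suc k)))))) ⟩
  ℚᵘ.mkℚᵘ i 0                                           ≈⟨ toℚᵘ-fromℤ i ⟨
  ℚ.toℚᵘ (fromℤ i)                                      ∎)
  where open ℚᵘ.≃-Reasoning

-- The inequality is encoded with the exponent in lowest terms, whereas the fraction P / Q from the
-- construction may be reducible. Cross multiplication relates the two.
lowestTerms : ∀ x P Q → x ℚ.* fromℕ Q ≡ fromℕ P → ∣ ℚ.↥ x ∣ ℕ.* Q ≡ ℚ.↧ₙ x ℕ.* P
lowestTerms x P Q xQ≡P = trans (sym (ℤ.abs-* (ℚ.↥ x) (+ Q))) (trans (cong ∣_∣ (fromℤ-injective {ℚ.↥ x ℤ.* + Q} {ℚ.↧ x ℤ.* + P} (begin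
  fromℤ (ℚ.↥ x ℤ.* + Q)                      ≡⟨ fromℤ-homo-* (ℚ.↥ x) (+ Q) ⟩
  fromℤ (ℚ.↥ x) ℚ.* fromℕ Q                  ≡⟨ cong (ℚ._* fromℕ Q) (*-denominator x) ⟨
  x ℚ.* fromℤ (ℚ.↧ x) ℚ.* fromℕ Q            ≡⟨ solve 3 (λ x d q → x :* d :* q := d :* (x :* q)) refl x (fromℤ (ℚ.↧ x)) (fromℕ Q) ⟩
  fromℤ (ℚ.↧ x) ℚ.* (x ℚ.* fromℕ Q)          ≡⟨ cong (fromℤ (ℚ.↧ x) ℚ.*_) xQ≡P ⟩
  fromℤ (ℚ.↧ x) ℚ.* fromℕ P                  ≡⟨ fromℤ-homo-* (ℚ.↧ x) (+ P) ⟨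
  fromℤ (ℚ.↧ x ℤ.* + P)                      ∎))) (ℤ.abs-* (ℚ.↧ x) (+ P)))
  where
  open ≡-Reasoning
  open ℚSolver.+-*-Solver

half-exponent : ∀ A W .{{_ : ℕ.NonZero W}} → ½ ℚ.* (+ A ℚ./ W ℚ.+ + 1 ℚ./ W) ℚ.* fromℕ (2 ℕ.* W) ≡ fromℕ (suc A)
half-exponent A W = begin
  ½ ℚ.* (+ A ℚ./ W ℚ.+ + 1 ℚ./ W) ℚ.* fromℕ (2 ℕ.* W)
    ≡⟨ cong (½ ℚ.* (+ A ℚ./ W ℚ.+ + 1 ℚ./ W) ℚ.*_) (fromℕ-* 2 W) ⟩
  ½ ℚ.* (+ A ℚ./ W ℚ.+ + 1 ℚ./ W) ℚ.* (fromℕ 2 ℚ.* fromℕ W)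
    ≡⟨ solve 5 (λ h x y t w → h :* (x :+ y) :* (t :* w) := h :* t :* (x :* w :+ y :* w)) refl ½ (+ A ℚ./ W) (+ 1 ℚ./ W) (fromℕ 2) (fromℕ W) ⟩
  ½ ℚ.* fromℕ 2 ℚ.* ((+ A ℚ./ W) ℚ.* fromℕ W ℚ.+ (+ 1 ℚ./ W) ℚ.* fromℕ W)
    ≡⟨ cong₂ (λ x y → ½ ℚ.* fromℕ 2 ℚ.* (x ℚ.+ y)) (/-* (+ A) W) (/-* (+ 1) W) ⟩
  1ℚ ℚ.* (fromℤ (+ A) ℚ.+ fromℤ (+ 1))
    ≡⟨ ℚ.*-identityˡ _ ⟩
  fromℤ (+ A) ℚ.+ fromℤ (+ 1)
    ≡⟨ ℚ.+-comm (fromℤ (+ A)) (fromℤ (+ 1)) ⟩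
  fromℤ (+ 1) ℚ.+ fromℤ (+ A)
    ≡⟨ fromℤ-homo-+ (+ 1) (+ A) ⟨
  fromℕ (suc A) ∎
  where
  open ≡-Reasoning
  open ℚSolver.+-*-Solver

-- Since the maximum is one of its terms, it is enough to construct orders for a single `d`.
maximum-attained : ∀ {k} (v : Vec ℚ (suc k)) → ∃ λ i → Vec.foldr₁ ℚ._⊔_ v ≡ Vec.lookup v i
maximum-attained (x Vec.∷ Vec.[]) = zero , refl
maximum-attained (x Vec.∷ y Vec.∷ v) with ℚ.⊔-sel x (Vec.foldr₁ ℚ._⊔_ (y Vec.∷ v)) | maximum-attained (y Vec.∷ v)
... | inj₁ ≡x | _      = zero , ≡x
... | inj₂ ≡m | i , eq = suc i , trans ≡m eq

-- Counting the constructed orders; the lower bound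

module OrderCount (e d : ℕ) (nontrivial : e ℕ.+ d ≢ 0) (K : NumberField (suc (e ℕ.+ d)))
                  (F : ℕ → ℕ) (F-counts : IsOrderCount K F) where
  open IntegralBasis K using (UnitalIntegralBasis; 1#; integralBasis)

  -- `Q` is the exponent of `m` in the discriminant, twice that in the index. `P` is the exponent e
  -- d of the number of matrices, raised by one through summation over `m`.
  P Q : ℕ
  P = suc (e ℕ.* d)
  Q = 2 ℕ.* (e ℕ.+ d ℕ.+ d)

  Q≢0 : Q ≢ 0
  Q≢0 eq = nontrivial (ℕ.m+n≡0⇒m≡0 (e ℕ.+ d) (ℕ.m*n≡0⇒m≡0 _ 2 (trans (ℕ.*-comm (e ℕ.+ d ℕ.+ d) 2) eq)))

  module _ {U} (basis : UnitalIntegralBasis U) where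
    open UnitalIntegralBasis basis
    open IsIntegralBasis isIntegralBasis
    open LatticeOrders.WithBasis e d K ω integral spanning independent

    κ : ℕ → ℕ
    κ m = ∣ D ∣ ℕ.* m ℕ.^ Q

    instance
      ∣D∣-nonZero : ℕ.NonZero ∣ D ∣
      ∣D∣-nonZero = ℕ.≢-nonZero (D≢0 ∘ ℤ.∣i∣≡0⇒i≡0)
      Q-nonZero : ℕ.NonZero Q
      Q-nonZero = ℕ.≢-nonZero Q≢0

    κ-increasing : ∀ m → κ m ℕ.< κ (suc m)
    κ-increasing m = ℕ.*-monoʳ-< ∣ D ∣ (ℕ.^-monoˡ-< Q (ℕ.n<1+n m))

    module _ (m : ℕ) .{{_ : ℕ.NonZero m}} where
      order : (Fin d → Fin e → Fin m) → Order K
      order c = latticeOrder m (λ j i → + toℕ (c j i))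

      index : ℕ
      index = m ℕ.^ e ℕ.* (m ℕ.* m) ℕ.^ d

      index²≡ : index ℕ.* index ≡ m ℕ.^ Q
      index²≡ = begin
        m ℕ.^ e ℕ.* (m ℕ.* m) ℕ.^ d ℕ.* (m ℕ.^ e ℕ.* (m ℕ.* m) ℕ.^ d)
          ≡⟨ cong₂ (λ x y → m ℕ.^ e ℕ.* x ℕ.* (m ℕ.^ e ℕ.* y)) (^-distribʳ-* d m m) (^-distribʳ-* d m m) ⟩
        m ℕ.^ e ℕ.* (m ℕ.^ d ℕ.* m ℕ.^ d) ℕ.* (m ℕ.^ e ℕ.* (m ℕ.^ d ℕ.* m ℕ.^ d))
          ≡⟨ solve 2 (λ x y → x :* (y :* y) :* (x :* (y :* y)) := x :* y :* y :* (x :* y :* y)) refl (m ℕ.^ e) (m ℕ.^ d) ⟩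
        m ℕ.^ e ℕ.* m ℕ.^ d ℕ.* m ℕ.^ d ℕ.* (m ℕ.^ e ℕ.* m ℕ.^ d ℕ.* m ℕ.^ d)
          ≡⟨ cong (λ x → x ℕ.* m ℕ.^ d ℕ.* (x ℕ.* m ℕ.^ d)) (ℕ.^-distribˡ-+-* m e d) ⟨
        m ℕ.^ (e ℕ.+ d) ℕ.* m ℕ.^ d ℕ.* (m ℕ.^ (e ℕ.+ d) ℕ.* m ℕ.^ d)
          ≡⟨ cong (λ x → x ℕ.* x) (ℕ.^-distribˡ-+-* m (e ℕ.+ d) d) ⟨
        m ℕ.^ (e ℕ.+ d ℕ.+ d) ℕ.* m ℕ.^ (e ℕ.+ d ℕ.+ d)
          ≡⟨ ℕ.^-distribˡ-+-* m (e ℕ.+ d ℕ.+ d) (e ℕ.+ d ℕ.+ d) ⟨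
        m ℕ.^ (e ℕ.+ d ℕ.+ d ℕ.+ (e ℕ.+ d ℕ.+ d))
          ≡⟨ cong (λ k → m ℕ.^ (e ℕ.+ d ℕ.+ d ℕ.+ k)) (ℕ.+-identityʳ (e ℕ.+ d ℕ.+ d)) ⟨
        m ℕ.^ Q ∎
        where
        open ≡-Reasoning
        open ℕSolver.+-*-Solver

      ∣disc∣≡κ : ∣ D ℤ.* (+ index) ℤ.^ 2 ∣ ≡ κ m
      ∣disc∣≡κ = trans (ℤ.abs-* D ((+ index) ℤ.^ 2)) (cong (∣ D ∣ ℕ.*_)
        (trans (cong ∣_∣ (trans (cong (+ index ℤ.*_) (ℤ.*-identityʳ (+ index))) (sym (ℤ.pos-* index index)))) index²≡))

      orderWithDiscriminant : (Fin d → Fin e → Fin m) → Σ (Order K) λ O → ∃ λ disc → IsDiscriminant K O disc × ∣ disc ∣ ≡ κ m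
      orderWithDiscriminant c = order c , D ℤ.* (+ index) ℤ.^ 2 , (D , (_ , isIntegralBasis , discriminant) , refl) , ∣disc∣≡κ

      module Count = Inverse (F-counts (κ m) {{ℕ.m*n≢0 ∣ D ∣ (m ℕ.^ Q) {{∣D∣-nonZero}} {{ℕ.m^n≢0 m Q}}}})

      matrix : Fin ((m ℕ.^ e) ℕ.^ d) → Fin d → Fin e → Fin m
      matrix k j i = Fin.finToFun {m} {e} (Fin.finToFun {m ℕ.^ e} {d} k j) i

      enumerate : Fin ((m ℕ.^ e) ℕ.^ d) → Fin (F (κ m))
      enumerate k = Count.from (orderWithDiscriminant (matrix k))

      enumerate-injective : ∀ {k l} → enumerate k ≡ enumerate l → k ≡ l
      enumerate-injective {k} {l} eq = finToFun-injective {d} {m ℕ.^ e} k l λ j → finToFun-injective {e} {m} _ _ λ i →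
        member-determines-slope m (matrix k) (matrix l) k⊆l j i
        where
        k⊆l : ∀ {x} → x ∈ Order.member (order (matrix k)) → x ∈ Order.member (order (matrix l))
        -- Both orders coincide with the one that `Count.to` assigns to their common number.
        k⊆l x∈ = proj₁ (Count.inverseˡ {orderWithDiscriminant (matrix l)} {enumerate k} eq)
          (proj₂ (Count.inverseˡ {orderWithDiscriminant (matrix k)} {enumerate k} refl) x∈)

      manyOrders : m ℕ.^ (e ℕ.* d) ℕ.≤ F (κ m)
      manyOrders = ℕ.≤-trans (ℕ.≤-reflexive (sym (ℕ.^-*-assoc m e d))) (Fin.injective⇒≤ enumerate-injective)

    manyBelow : ∀ M → M ℕ.^ P ℕ.≤ P ℕ.* cumulative F (κ M)
    manyBelow M = ℕ.≤-trans (^≤powerSum (e ℕ.* d) M) (ℕ.*-monoʳ-≤ P (powerSum≤cumulative F (e ℕ.* d) κ κ-increasing (λ m → manyOrders (suc m)) M))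

  lowerBound : ∀ x → ∣ ℚ.↥ x ∣ ℕ.* Q ≡ ℚ.↧ₙ x ℕ.* P →
               ∃ λ c → 0ℚ ℚ.< c × (∃ λ B₀ → ∀ B → B ≥ B₀ → c · fromℕ B ^ x ≤ fromℕ (cumulative F B))
  lowerBound x pQ≡qP = bound integralBasis
    where
    bound : (∃ λ U → ¬ ¬ UnitalIntegralBasis U) →
            ∃ λ c → 0ℚ ℚ.< c × (∃ λ B₀ → ∀ B → B ≥ B₀ → c · fromℕ B ^ x ≤ fromℕ (cumulative F B))
    bound (U′ , ¬¬basis) =
      let c , c-positive , cC≡1 = positiveInverse C C≢0
      in c , ℚ.positive⁻¹ c {{c-positive}} , U , λ B B≥U → scaledPower c C cC≡1 {{c-positive}} B (cumulative F B) x
           (decidable-stable (B ℕ.^ ∣ ℚ.↥ x ∣ ℕ.≤? (C ℕ.* cumulative F B) ℕ.^ ℚ.↧ₙ x) λ ¬≤ → ¬¬basis (¬≤ ∘ estimate B B≥U))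
      where
      -- `C` is the factor that `growth` puts before the count. The successor keeps `U` nonzero, and
      -- `U` doubles as the threshold for `B`, which guarantees U k ^ Q ≤ B at k = 1.
      U C : ℕ
      U = suc U′
      C = U ℕ.^ ∣ ℚ.↥ x ∣ ℕ.* 2 ℕ.^ P ℕ.* P

      C≢0 : C ≢ 0
      C≢0 = ℕ.≢-nonZero⁻¹ C {{ℕ.m*n≢0 _ P {{ℕ.m*n≢0 _ _ {{ℕ.m^n≢0 U ∣ ℚ.↥ x ∣}} {{ℕ.m^n≢0 2 P}}}}}}

      estimate : ∀ B → B ≥ U → UnitalIntegralBasis U′ → B ℕ.^ ∣ ℚ.↥ x ∣ ℕ.≤ (C ℕ.* cumulative F B) ℕ.^ ℚ.↧ₙ x
      estimate B B≥U basis =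
        -- The search can start at `B` itself, because U (1 + B) ^ Q exceeds `B`. Replacing |D| by
        -- `U` makes the choice of `M` independent of the basis and still keeps `κ (suc M)` at most
        -- `B`.
        let M , UM^Q≤B , B< = largest (λ k → U ℕ.* k ℕ.^ Q) B
              (subst (ℕ._≤ B) (sym (trans (cong (U ℕ.*_) (ℕ.^-zeroˡ Q)) (ℕ.*-identityʳ U))) B≥U)
              B B<U[1+B]^Q
        in growth {U} {B} {M} {cumulative F B} {P} {Q} {∣ ℚ.↥ x ∣} {ℚ.↧ₙ x} B<
             (ℕ.≤-trans (manyBelow basis (suc M)) (ℕ.*-monoʳ-≤ P (cumulative-mono F
               (ℕ.≤-trans (ℕ.*-monoˡ-≤ (suc M ℕ.^ Q) (ℕ.≤-trans ∣D∣≤U (ℕ.n≤1+n U′))) UM^Q≤B))))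
             pQ≡qP
        where
        open UnitalIntegralBasis basis using (∣D∣≤U)

        B<U[1+B]^Q : B ℕ.< U ℕ.* suc B ℕ.^ Q
        B<U[1+B]^Q = begin
          suc B                      ≡⟨ ℕ.^-identityʳ (suc B) ⟨
          suc B ℕ.^ 1                ≤⟨ ℕ.^-monoʳ-≤ (suc B) (ℕ.n≢0⇒n>0 Q≢0) ⟩
          suc B ℕ.^ Q                ≤⟨ ℕ.m≤n*m (suc B ℕ.^ Q) U ⟩
          U ℕ.* suc B ℕ.^ Q          ∎
          where open ℕ.≤-Reasoning

open import Data.Rational.Base using (_<_; _*_)

theorem6p2 : ∀ (n : ℕ) → .{{_ : NonTrivial n}} →
    (K : NumberField n) →
    (F : ℕ → ℕ) → IsOrderCount K F →
    ∃ λ (c : ℚ) → 0ℚ < c × (∃ λ (B₀ : ℕ) →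
    ∀ (B : ℕ) → B ≥ B₀ →
    c · fromℕ B ^ (½ * a n) ≤ fromℕ (cumulative F B))
theorem6p2 n@(suc (suc k)) = attained (maximum-attained (Vec.tabulate {n = n} (λ j → exponentTerm n (toℕ j))))
  where
  Conclusion : ∀ {n} → NumberField n → ℚ → Set₁
  Conclusion K x = ∀ F → IsOrderCount K F →
    ∃ λ (c : ℚ) → 0ℚ < c × (∃ λ (B₀ : ℕ) → ∀ (B : ℕ) → B ≥ B₀ → c · fromℕ B ^ x ≤ fromℕ (cumulative F B))

  attained : (∃ λ i → a n ≡ Vec.lookup (Vec.tabulate (λ j → exponentTerm n (toℕ j))) i) → (K : NumberField n) → Conclusion K (½ * a n)
  -- The degree is rewritten as `suc (e ℕ.+ d)` so that a basis of `K` splits into its two blocks.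
  -- The exponent is held fixed during the transport, and only the type of `K` changes.
  attained (i , a≡) = subst (λ n → (K : NumberField n) → Conclusion K (½ * a (suc (suc k)))) (sym n≡) λ K F F-counts →
      OrderCount.lowerBound e d (λ eq → 1+k≢0 (trans (ℕ.suc-injective n≡) eq)) K F F-counts (½ * a n)
        (lowestTerms (½ * a n) (suc (e ℕ.* d)) (2 ℕ.* (e ℕ.+ d ℕ.+ d)) exponent≡)
    where
    d = toℕ i
    e = suc k ℕ.∸ d

    1+k≢0 : suc k ≢ 0
    1+k≢0 ()

    n≡ : n ≡ suc (e ℕ.+ d)
    n≡ = cong suc (sym (ℕ.m∸n+n≡m (Fin.toℕ≤pred[n] i)))

    exponent≡ : ½ * a n * fromℕ (2 ℕ.* (e ℕ.+ d ℕ.+ d)) ≡ fromℕ (suc (e ℕ.* d))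
    exponent≡ = begin
      ½ * a n * fromℕ (2 ℕ.* (e ℕ.+ d ℕ.+ d))
        ≡⟨ cong₂ (λ x W → ½ * x * fromℕ (2 ℕ.* W)) (trans a≡ (Vec.lookup∘tabulate (λ j → exponentTerm n (toℕ j)) i)) (cong (ℕ._+ d) (sym (ℕ.suc-injective n≡))) ⟩
      ½ * exponentTerm n d * fromℕ (2 ℕ.* (suc k ℕ.+ d))
        ≡⟨ half-exponent (d ℕ.* e) (suc k ℕ.+ d) ⟩
      fromℕ (suc (d ℕ.* e))
        ≡⟨ cong (λ s → fromℕ (suc s)) (ℕ.*-comm d e) ⟩
      fromℕ (suc (e ℕ.* d)) ∎
      where open ≡-Reasoning
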